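{- Let $p\geq3$ be a prime, $\omega=e^{2\pi i/p}$, and let $M=(m_{ij})_{i,j=0}^{p-1}$ be a circulant matrix with entries in $\mathbb Z/p\mathbb Z$. Then $U=(\omega^{m_{ij}})_{i,j=0}^{p-1}$ is a complex Hadamard matrix if and only if there exist $a,b,c\in\mathbb Z/p\mathbb Z$ with $a\neq0$ such that $m_{0j}=aj^2+bj+c$ for all $j\in\mathbb Z/p\mathbb Z$.
   Context: A complex Hadamard matrix has all entries of modulus one and pairwise orthogonal rows. $M$ circulant means $m_{ij}$ depends only on $j-i$ modulo $p$. -}

module Defs where

open import Level using (_⊔_) renaming (suc to lsuc)
open import Algebra.Apartness.Bundles using (HeytingField; HeytingCommutativeRing)
open import Algebra.Bundles using (CommutativeRing; RawRing)
import Algebra.Definitions.RawSemiring as RawSemiringOps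
open import Data.Fin.Base using (Fin; toℕ)
open import Data.Nat.Base as ℕ using (ℕ; zero; suc; NonZero; _!)
open import Data.Nat.DivMod using (_mod_)
open import Data.Nat.Properties using (_!≢0)
open import Data.Product.Base using (_×_; _,_; proj₁; proj₂; ∃)
open import Data.Sum.Base using (_⊎_)
open import Relation.Binary.Core using (Rel)
open import Relation.Binary.PropositionalEquality.Core using (_≡_; _≢_)
open import Relation.Binary.Structures using (IsStrictPartialOrder)
open import Relation.Nullary.Negation.Core using (¬_)

-- The real numbers, axiomatised as a Cauchy-complete Archimedean ordered
-- field.  Classically these axioms determine ℝ up to unique isomorphism.
-- Apartness takes the place of classical inequality, so that excluded
-- middle is not built into the axioms.

record RealNumbers c ℓ₁ ℓ₂ ℓ₃ : Set (lsuc (c ⊔ ℓ₁ ⊔ ℓ₂ ⊔ ℓ₃)) where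
  infix 4 _<_ _≤_ _⟶_
  field
    heytingField : HeytingField c ℓ₁ ℓ₂

  open HeytingField heytingField public

  commutativeRing : CommutativeRing c ℓ₁
  commutativeRing = HeytingCommutativeRing.commutativeRing heytingCommutativeRing

  open CommutativeRing commutativeRing public using (rawRing)
  open RawSemiringOps (RawRing.rawSemiring rawRing) public
    using () renaming (_×_ to _·_)

  field
    _<_                  : Rel Carrier ℓ₃
    isStrictPartialOrder : IsStrictPartialOrder _≈_ _<_
    #⇒<⊎>                : ∀ {x y} → x # y → x < y ⊎ y < x
    <⇒#                  : ∀ {x y} → x < y → x # y
    0<1                  : 0# < 1#
    +-monoˡ-<            : ∀ {x y} z → x < y → x + z < y + z
    *-pos                : ∀ {x y} → 0# < x → 0# < y → 0# < x * y
    archimedean          : ∀ x → ∃ λ n → x < n · 1#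

  _≤_ : Rel Carrier ℓ₃
  x ≤ y = ¬ (y < x)

  _⟶_ : (ℕ → Carrier) → Carrier → Set (c ⊔ ℓ₃)
  s ⟶ x = ∀ ε → 0# < ε → ∃ λ N → ∀ n → N ℕ.≤ n →
            - ε < s n - x × s n - x < ε

  Cauchy : (ℕ → Carrier) → Set (c ⊔ ℓ₃)
  Cauchy s = ∀ ε → 0# < ε → ∃ λ N → ∀ m n → N ℕ.≤ m → N ℕ.≤ n →
               - ε < s m - s n × s m - s n < ε

  field
    complete : ∀ s → Cauchy s → ∃ λ x → s ⟶ x

  module SPO = IsStrictPartialOrder isStrictPartialOrder

  0<n·1 : ∀ n .{{_ : NonZero n}} → 0# < n · 1#
  0<n·1 (suc zero)    = SPO.<-respʳ-≈ (sym (+-identityʳ 1#)) 0<1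
  0<n·1 (suc (suc n)) = SPO.trans (0<n·1 (suc n))
    (SPO.<-respˡ-≈ (+-identityˡ _) (+-monoˡ-< (suc n · 1#) 0<1))

  -- #⇒invertible inverts the difference n · 1# - 0#.
  1/_ : ∀ n .{{_ : NonZero n}} → Carrier
  1/ n = proj₁ (#⇒invertible (#-sym (<⇒# (0<n·1 n))))

module Complex {c ℓ₁ ℓ₂ ℓ₃} (R : RealNumbers c ℓ₁ ℓ₂ ℓ₃) where
  private module ℝ = RealNumbers R
  open ℝ using () renaming (Carrier to ℝ)

  infix 7 _+i_
  record ℂ : Set c where
    constructor _+i_
    field
      re im : ℝ
  open ℂ public

  ℂ-rawRing : RawRing c ℓ₁
  ℂ-rawRing = record
    { Carrier = ℂ
    ; _≈_     = λ z w → re z ℝ.≈ re w × im z ℝ.≈ im w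
    ; _+_     = λ z w → (re z ℝ.+ re w) +i (im z ℝ.+ im w)
    ; _*_     = λ z w → (re z ℝ.* re w ℝ.- im z ℝ.* im w)
                     +i (re z ℝ.* im w ℝ.+ im z ℝ.* re w)
    ; -_      = λ z → (ℝ.- re z) +i (ℝ.- im z)
    ; 0#      = ℝ.0# +i ℝ.0#
    ; 1#      = ℝ.1# +i ℝ.0#
    }

  open RawRing ℂ-rawRing public using (_≈_; _+_; _*_; -_; 0#; 1#)
  open RawSemiringOps (RawRing.rawSemiring ℂ-rawRing) public using (sum; _^_)

  conj : ℂ → ℂ
  conj z = re z +i (ℝ.- im z)

  HasModulus : ℂ → ℝ → Set (ℓ₁ ⊔ ℓ₃)
  HasModulus z r = ℝ.0# ℝ.≤ r × r ℝ.* r ℝ.≈ re z ℝ.* re z ℝ.+ im z ℝ.* im z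

  expTerm : ℂ → ℕ → ℂ
  expTerm z k = ((ℝ.1/ (k !)) {{k !≢0}} +i ℝ.0#) * z ^ k

  expPartialSum : ℂ → ℕ → ℂ
  expPartialSum z n = sum {n} (λ k → expTerm z (toℕ k))

  -- w = e^z, i.e. w is the sum of the series Σ z^k / k!.
  IsExp : ℂ → ℂ → Set (c ⊔ ℓ₃)
  IsExp z w = (λ n → re (expPartialSum z n)) ℝ.⟶ re w
            × (λ n → im (expPartialSum z n)) ℝ.⟶ im w

  -- s = sin x, i.e. s is the imaginary part of e^(ix).
  IsSin : ℝ → ℝ → Set (c ⊔ ℓ₃)
  IsSin x s = ∃ λ t → IsExp (ℝ.0# +i x) (t +i s)

  -- π is the least positive zero of the sine.
  IsPi : ℝ → Set (c ⊔ ℓ₃)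
  IsPi π = ℝ.0# ℝ.< π
         × IsSin π ℝ.0#
         × (∀ x → ℝ.0# ℝ.< x → IsSin x ℝ.0# → π ℝ.≤ x)

  -- Only one π satisfies IsPi, and it is named here so that it can occur in
  -- the exponent: ω = e^(2πi/n).
  IsExp2πi/ : ∀ n .{{_ : NonZero n}} → ℂ → Set (c ⊔ ℓ₃)
  IsExp2πi/ n ω =
    ∃ λ π → IsPi π × IsExp (ℝ.0# +i ((2 ℝ.· π) ℝ.* (ℝ.1/ n))) ω

  record IsComplexHadamard {n} (U : Fin n → Fin n → ℂ) : Set (ℓ₁ ⊔ ℓ₃) where
    field
      unimodular : ∀ i j → HasModulus (U i j) ℝ.1#
      orthogonal : ∀ i k → i ≢ k → sum (λ j → U i j * conj (U k j)) ≈ 0#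

-- Arithmetic of ℤ/n on the representatives 0, …, n − 1.

module ZMod (n : ℕ) .{{_ : NonZero n}} where
  infixl 6 _⊕_ _⊖_
  infixl 7 _⊗_

  0ₙ : Fin n
  0ₙ = 0 mod n

  _⊕_ _⊗_ _⊖_ : Fin n → Fin n → Fin n
  x ⊕ y = (toℕ x ℕ.+ toℕ y) mod n
  x ⊗ y = (toℕ x ℕ.* toℕ y) mod n
  x ⊖ y = (toℕ x ℕ.+ (n ℕ.∸ toℕ y)) mod n

  Circulant : (Fin n → Fin n → Fin n) → Set
  Circulant M = ∀ i j k l → j ⊖ i ≡ l ⊖ k → M i j ≡ M k l

-- Write m_{0,x} = f(x) and p = 2m + 1.  If U is Hadamard, then for every b the
-- sum S_b = Σ_x ω^(f(x) + b x) satisfies S_b · conj S_b = p.  Comparing the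
-- expansions of both factors in powers of the uniformiser ω − 1 of ℤ[ω], where
-- p is a unit times (ω − 1)^(p − 1), gives Σ_x (f(x) + b x)^j ≡ 0 (mod p) for
-- j < m, while the square of Q(b) = Σ_x (f(x) + b x)^m is a nonzero constant
-- mod p.  If f had degree k ≥ 3 mod p, write p − 1 = r k + i with i < k: then
-- Σ_x (f(x) + b x)^(r + i) has degree exactly i in b, and r + i ≤ m with i > 0
-- in case of equality, a contradiction.  Degree ≤ 1 would give Q = 0.
-- Conversely, for quadratic f the inner products of rows are geometric sums.
--
-- Degrees mod p are measured by finite differences: h has degree k with leading
-- coefficient a when Δ^k h is constantly a, and Σ_{x < p} h(x) = Δ^(p − 1) h.
-- That ω is a primitive p-th root of unity comes from the functional equation
-- of exp and from π being the least positive zero of the sine.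

{-# OPTIONS --safe #-}
module Submission where

open import Algebra.Bundles using (CommutativeRing)
open import Data.Nat.Base using (ℕ; NonZero)
open import Defs using (RealNumbers; module Complex; module ZMod)

-- `ℤ[ω]` is handled as the set of integer combinations of the powers of ω, without a basis. Its
-- arithmetic rests on one relation, π^(p - 1) = - p (1 + π s) with π = ω - 1, and on one
-- consequence of it: an integer in π ℤ[ω] is divisible by p. The coefficients of S_b at π are
-- binomial sums Σ C(g(x), i) of exponents g(x) in ℕ. Power sums are reached only modulo p, where
-- Q(b) is m! times the coefficient at order m. Conjugation sends π to - ω̄ π, so S_b and conj S_b
-- have the same coefficients up to powers of the unit - ω̄. Their product therefore fixes only the
-- square of the coefficient at order m; this is why Q² is constant in b, and why the degree of Q
-- has to be excluded through that of Q². The reals carry an apartness relation, and neither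
-- equality nor signs are decidable. Absolute values are replaced by decompositions into positive
-- parts, and cancellation of z ≉ 0 goes through tightness of the apartness.

-- Binomial coefficients and a prime.

module Binomial where
  open import Data.Nat.Base using (ℕ; zero; suc; _+_; _*_; _<_; _≤_; s≤s; z≤n; _!)
  open import Data.Nat.Properties
  open import Data.Nat.Combinatorics using (_C_; nCn≡1; nC1≡n; nCk≡nC[n∸k]; nCk+nC[k+1]≡[n+1]C[k+1]; k>n⇒nCk≡0)
  open import Data.Nat.Divisibility using (_∣_; _∤_; divides; ∣m⇒∣m*n; >⇒∤; ∣1⇒≡1)
  open import Data.Nat.Primality using (Prime; euclidsLemma; ¬prime[1])
  open import Data.Nat.Tactic.RingSolver using (solve-∀)
  open import Data.Sum.Base using (inj₁; inj₂)
  open import Relation.Binary.PropositionalEquality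
  open import Relation.Nullary.Negation using (contradiction)
  open ≡-Reasoning

  ∑ℕ : ℕ → (ℕ → ℕ) → ℕ
  ∑ℕ zero    f = 0
  ∑ℕ (suc n) f = ∑ℕ n f + f n

  -- The coefficient of t^i in the sum of (1 + t)^(g x) over x < N, to be taken at 1 + t = ω.
  coefficient : ℕ → (ℕ → ℕ) → ℕ → ℕ
  coefficient N g i = ∑ℕ N (λ x → g x C i)

  nC0≡1 : ∀ n → n C 0 ≡ 1
  nC0≡1 n = trans (nCk≡nC[n∸k] {0} {n} z≤n) (nCn≡1 n)

  pascal : ∀ n k → suc n C suc k ≡ n C k + n C suc k
  pascal n k = sym (nCk+nC[k+1]≡[n+1]C[k+1] n k)

  absorption : ∀ n k → suc k * (suc n C suc k) ≡ suc n * (n C k)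
  absorption n zero = begin
    1 * (suc n C 1)     ≡⟨ *-identityˡ _ ⟩
    suc n C 1           ≡⟨ nC1≡n (suc n) ⟩
    suc n               ≡⟨ *-identityʳ (suc n) ⟨
    suc n * 1           ≡⟨ cong (suc n *_) (nC0≡1 n) ⟨
    suc n * (n C 0)     ∎
  absorption zero (suc k) = begin
    suc (suc k) * (1 C suc (suc k))   ≡⟨ cong (suc (suc k) *_) (k>n⇒nCk≡0 {1} {suc (suc k)} (s≤s (s≤s z≤n))) ⟩
    suc (suc k) * 0                   ≡⟨ *-zeroʳ (suc (suc k)) ⟩
    0                                 ≡⟨ cong (1 *_) (k>n⇒nCk≡0 {0} {suc k} (s≤s z≤n)) ⟨
    1 * (0 C suc k)                   ∎
  absorption (suc n) (suc k) = begin
    suc (suc k) * (suc (suc n) C suc (suc k))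
      ≡⟨ cong (suc (suc k) *_) (pascal (suc n) (suc k)) ⟩
    suc (suc k) * (suc n C suc k + suc n C suc (suc k))
      ≡⟨ expand (suc k) (suc n C suc k) (suc n C suc (suc k)) ⟩
    suc k * (suc n C suc k) + suc n C suc k + suc (suc k) * (suc n C suc (suc k))
      ≡⟨ cong₂ (λ x y → x + suc n C suc k + y) (absorption n k) (absorption n (suc k)) ⟩
    suc n * (n C k) + suc n C suc k + suc n * (n C suc k)
      ≡⟨ collect (suc n) (n C k) (suc n C suc k) (n C suc k) ⟩
    suc n * (n C k + n C suc k) + suc n C suc k
      ≡⟨ cong (λ x → suc n * x + suc n C suc k) (pascal n k) ⟨
    suc n * (suc n C suc k) + suc n C suc k
      ≡⟨ +-comm _ (suc n C suc k) ⟩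
    suc (suc n) * (suc n C suc k) ∎
    where
    expand : ∀ k a b → suc k * (a + b) ≡ k * a + a + suc k * b
    expand = solve-∀
    collect : ∀ n a b c → n * a + b + n * c ≡ n * (a + c) + b
    collect = solve-∀

  -- Multiplication by n in the basis of binomial polynomials; `PowerSums` converts binomial sums
  -- into power sums with it.
  n*nCk : ∀ n k → n * (n C k) ≡ suc k * (n C suc k) + k * (n C k)
  n*nCk n k = +-cancelˡ-≡ (n C k) _ _ (begin
    suc n * (n C k)                             ≡⟨ absorption n k ⟨
    suc k * (suc n C suc k)                     ≡⟨ cong (suc k *_) (pascal n k) ⟩
    suc k * (n C k + n C suc k)                 ≡⟨ rearr k (n C k) (n C suc k) ⟩
    n C k + (suc k * (n C suc k) + k * (n C k)) ∎)
    where
    rearr : ∀ k a b → suc k * (a + b) ≡ a + (suc k * b + k * a)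
    rearr = solve-∀

  p∣pCk : ∀ {p k} → Prime p → 0 < k → k < p → p ∣ p C k
  p∣pCk {suc n} {suc k} pr _ k<p
    with euclidsLemma (suc k) (suc n C suc k) pr (divides (n C k) (trans (absorption n k) (*-comm (suc n) _)))
  ... | inj₁ d = contradiction d (>⇒∤ k<p)
  ... | inj₂ d = d

  module _ {p} (pr : Prime p) where

    p∤1 : p ∤ 1
    p∤1 d = ¬prime[1] (subst Prime (∣1⇒≡1 d) pr)

    p∤nCk : ∀ n k → k ≤ n → n < p → p ∤ n C k
    p∤nCk n zero _ _ d = p∤1 (subst (p ∣_) (nC0≡1 n) d)
    p∤nCk (suc n) (suc k) (s≤s k≤n) n<p d
      with euclidsLemma (suc n) (n C k) pr
             (subst (p ∣_) (trans (*-comm _ (suc k)) (absorption n k)) (∣m⇒∣m*n (suc k) d))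
    ... | inj₁ e = >⇒∤ n<p e
    ... | inj₂ e = p∤nCk n k k≤n (<-trans (n<1+n n) n<p) e

    p∤n! : ∀ n → n < p → p ∤ n !
    p∤n! zero _ = p∤1
    p∤n! (suc n) n<p d with euclidsLemma (suc n) (n !) pr d
    ... | inj₁ e = >⇒∤ n<p e
    ... | inj₂ e = p∤n! n (<-trans (n<1+n n) n<p) e

-- Integer coefficients and finite sums in a commutative ring.

module RingKit {c ℓ} (K : CommutativeRing c ℓ) where
  open CommutativeRing K public
  open import Algebra.Properties.Semiring.Mult semiring public
  open import Algebra.Properties.Semiring.Exp semiring public
  open import Algebra.Properties.Ring ring public using (-0#≈0#; -‿distribˡ-*; -‿distribʳ-*; -‿involutive; x[y-z]≈xy-xz; [y-z]x≈yx-zx)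
  import Algebra.Properties.Monoid.Sum +-monoid as Sum
  open import Algebra.Solver.Ring.AlmostCommutativeRing
    using (AlmostCommutativeRing; _-Raw-AlmostCommutative⟶_; fromCommutativeRing)
  open Binomial using (∑ℕ)
  open import Data.Fin.Base using (toℕ; Fin)
  open import Data.Integer.Base as ℤ using (ℤ; +_; -[1+_]; ∣_∣; sign; _◃_; _⊖_; +-*-rawRing)
  import Data.Integer.Properties as ℤ
  open import Data.Maybe.Base as Maybe using (Maybe)
  open import Data.Nat.Base as ℕ using (ℕ; zero; suc)
  import Data.Nat.Properties as ℕ
  import Data.Sign.Base as Sign
  open import Data.Sign.Base using (Sign)
  open import Relation.Binary.Consequences using (dec⇒weaklyDec)
  open import Relation.Binary.PropositionalEquality.Core as ≡ using (_≡_)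
  open import Relation.Binary.Reasoning.Setoid setoid
  open import Algebra.Properties.AbelianGroup +-abelianGroup using (⁻¹-∙-comm)

  -- Serves both as the coefficient map of the ring solver and as the map that supplies the integer
  -- coefficients of `ℤ[ω]`.
  ι : ℤ → Carrier
  ι (+ n)    = n × 1#
  ι -[1+ n ] = - (suc n × 1#)

  ι-⊖ : ∀ m n → ι (m ⊖ n) ≈ m × 1# - n × 1#
  ι-⊖ m zero = sym (trans (+-congˡ -0#≈0#) (+-identityʳ _))
  ι-⊖ zero (suc n) = sym (+-identityˡ _)
  ι-⊖ (suc m) (suc n) = begin
    ι (suc m ⊖ suc n)                     ≡⟨ ≡.cong ι (ℤ.[1+m]⊖[1+n]≡m⊖n m n) ⟩
    ι (m ⊖ n)                             ≈⟨ ι-⊖ m n ⟩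
    m × 1# - n × 1#                       ≈⟨ +-identityˡ _ ⟨
    0# + (m × 1# - n × 1#)                ≈⟨ +-congʳ (-‿inverseʳ 1#) ⟨
    1# - 1# + (m × 1# - n × 1#)           ≈⟨ +-assoc _ _ _ ⟩
    1# + (- 1# + (m × 1# - n × 1#))       ≈⟨ +-congˡ (+-assoc _ _ _) ⟨
    1# + (- 1# + m × 1# - n × 1#)         ≈⟨ +-congˡ (+-congʳ (+-comm _ _)) ⟩
    1# + (m × 1# - 1# - n × 1#)           ≈⟨ +-congˡ (+-assoc _ _ _) ⟩
    1# + (m × 1# + (- 1# - n × 1#))       ≈⟨ +-assoc _ _ _ ⟨
    suc m × 1# + (- 1# - n × 1#)          ≈⟨ +-congˡ (⁻¹-∙-comm _ _) ⟩
    suc m × 1# - suc n × 1#               ∎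

  ι-+ : ∀ i j → ι (i ℤ.+ j) ≈ ι i + ι j
  ι-+ (+ m)    (+ n)    = ×-homo-+ 1# m n
  ι-+ (+ m)    -[1+ n ] = ι-⊖ m (suc n)
  ι-+ -[1+ m ] (+ n)    = trans (ι-⊖ n (suc m)) (+-comm _ _)
  ι-+ -[1+ m ] -[1+ n ] = begin
    - (suc (suc (m ℕ.+ n)) × 1#)     ≡⟨ ≡.cong (λ k → - (suc k × 1#)) (ℕ.+-suc m n) ⟨
    - ((suc m ℕ.+ suc n) × 1#)       ≈⟨ -‿cong (×-homo-+ 1# (suc m) (suc n)) ⟩
    - (suc m × 1# + suc n × 1#)      ≈⟨ ⁻¹-∙-comm _ _ ⟨
    - (suc m × 1#) - suc n × 1#      ∎

  signed : Sign → Carrier → Carrier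
  signed Sign.+ x = x
  signed Sign.- x = - x

  signed-* : ∀ s t x y → signed (s Sign.* t) (x * y) ≈ signed s x * signed t y
  signed-* Sign.+ Sign.+ x y = refl
  signed-* Sign.+ Sign.- x y = -‿distribʳ-* x y
  signed-* Sign.- Sign.+ x y = -‿distribˡ-* x y
  signed-* Sign.- Sign.- x y = begin
    x * y            ≈⟨ -‿involutive _ ⟨
    - (- (x * y))    ≈⟨ -‿cong (-‿distribʳ-* x y) ⟩
    - (x * - y)      ≈⟨ -‿distribˡ-* x (- y) ⟩
    - x * - y        ∎

  signed-cong : ∀ s {x y} → x ≈ y → signed s x ≈ signed s y
  signed-cong Sign.+ e = e
  signed-cong Sign.- e = -‿cong e

  ι-◃ : ∀ s n → ι (s ◃ n) ≈ signed s (n × 1#)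
  ι-◃ Sign.+ zero    = refl
  ι-◃ Sign.- zero    = sym -0#≈0#
  ι-◃ Sign.+ (suc n) = refl
  ι-◃ Sign.- (suc n) = refl

  ι-sign-abs : ∀ i → ι i ≈ signed (sign i) (∣ i ∣ × 1#)
  ι-sign-abs (+ n)    = refl
  ι-sign-abs -[1+ n ] = refl

  ι-* : ∀ i j → ι (i ℤ.* j) ≈ ι i * ι j
  ι-* i j = begin
    ι (i ℤ.* j)                                                         ≈⟨ ι-◃ (sign i Sign.* sign j) (∣ i ∣ ℕ.* ∣ j ∣) ⟩
    signed (sign i Sign.* sign j) ((∣ i ∣ ℕ.* ∣ j ∣) × 1#)               ≈⟨ signed-cong (sign i Sign.* sign j) (×1-homo-* ∣ i ∣ ∣ j ∣) ⟩
    signed (sign i Sign.* sign j) ((∣ i ∣ × 1#) * (∣ j ∣ × 1#))          ≈⟨ signed-* (sign i) (sign j) _ _ ⟩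
    signed (sign i) (∣ i ∣ × 1#) * signed (sign j) (∣ j ∣ × 1#)          ≈⟨ *-cong (ι-sign-abs i) (ι-sign-abs j) ⟨
    ι i * ι j                                                           ∎

  ι-neg : ∀ i → ι (ℤ.- i) ≈ - ι i
  ι-neg (+ zero)  = sym -0#≈0#
  ι-neg (+ suc n) = refl
  ι-neg -[1+ n ]  = sym (-‿involutive _)

  almostCommutativeRing : AlmostCommutativeRing c ℓ
  almostCommutativeRing = fromCommutativeRing K

  ι-homomorphism : +-*-rawRing -Raw-AlmostCommutative⟶ almostCommutativeRing
  ι-homomorphism = record
    { ⟦_⟧ = ι ; +-homo = ι-+ ; *-homo = ι-* ; -‿homo = ι-neg
    ; 0-homo = refl ; 1-homo = +-identityʳ 1# }

  -- Coefficients are compared as integers, so the solver also works over rings with undecidable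
  -- equality such as the reals.
  ι-weaklyDec : ∀ i j → Maybe (ι i ≈ ι j)
  ι-weaklyDec i j = Maybe.map (λ e → reflexive (≡.cong ι e)) (dec⇒weaklyDec ℤ._≟_ i j)

  open import Algebra.Solver.Ring +-*-rawRing almostCommutativeRing ι-homomorphism ι-weaklyDec public
    using (solve; _:=_; _:+_; _:*_; _:-_; :-_; _:^_; con; Polynomial)

  ∑ : ℕ → (ℕ → Carrier) → Carrier
  ∑ zero    f = 0#
  ∑ (suc n) f = ∑ n f + f n

  ∑-cong : ∀ n {f g} → (∀ i → i ℕ.< n → f i ≈ g i) → ∑ n f ≈ ∑ n g
  ∑-cong zero    e = refl
  ∑-cong (suc n) e = +-cong (∑-cong n (λ i i<n → e i (ℕ.m<n⇒m<1+n i<n))) (e n (ℕ.n<1+n n))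

  ∑-zero : ∀ n {f} → (∀ i → i ℕ.< n → f i ≈ 0#) → ∑ n f ≈ 0#
  ∑-zero zero    e = refl
  ∑-zero (suc n) e = trans (+-cong (∑-zero n (λ i i<n → e i (ℕ.m<n⇒m<1+n i<n))) (e n (ℕ.n<1+n n))) (+-identityˡ 0#)

  ∑-+ : ∀ n f g → ∑ n (λ i → f i + g i) ≈ ∑ n f + ∑ n g
  ∑-+ zero    f g = sym (+-identityˡ 0#)
  ∑-+ (suc n) f g = trans (+-congʳ (∑-+ n f g))
    (solve 4 (λ a b x y → (a :+ b) :+ (x :+ y) := (a :+ x) :+ (b :+ y)) refl _ _ _ _)

  ∑-*ˡ : ∀ n a f → a * ∑ n f ≈ ∑ n (λ i → a * f i)
  ∑-*ˡ zero    a f = zeroʳ a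
  ∑-*ˡ (suc n) a f = trans (distribˡ a _ _) (+-congʳ (∑-*ˡ n a f))

  ∑-*ʳ : ∀ n a f → ∑ n f * a ≈ ∑ n (λ i → f i * a)
  ∑-*ʳ n a f = trans (*-comm _ a) (trans (∑-*ˡ n a f) (∑-cong n (λ i _ → *-comm a _)))

  ∑-suc : ∀ n f → ∑ (suc n) f ≈ f 0 + ∑ n (λ i → f (suc i))
  ∑-suc zero    f = +-comm 0# _
  ∑-suc (suc n) f = trans (+-congʳ (∑-suc n f)) (+-assoc _ _ _)

  ∑-split : ∀ m n f → ∑ (m ℕ.+ n) f ≈ ∑ m f + ∑ n (λ i → f (m ℕ.+ i))
  ∑-split m zero    f = trans (reflexive (≡.cong (λ k → ∑ k f) (ℕ.+-identityʳ m))) (sym (+-identityʳ _))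
  ∑-split m (suc n) f = trans (reflexive (≡.cong (λ k → ∑ k f) (ℕ.+-suc m n)))
    (trans (+-congʳ (∑-split m n f)) (+-assoc _ _ _))

  ∑-comm : ∀ m n (f : ℕ → ℕ → Carrier) → ∑ m (λ i → ∑ n (f i)) ≈ ∑ n (λ j → ∑ m (λ i → f i j))
  ∑-comm zero    n f = sym (∑-zero n (λ _ _ → refl))
  ∑-comm (suc m) n f = trans (+-congʳ (∑-comm m n f)) (sym (∑-+ n _ _))

  ∑-const : ∀ n a → ∑ n (λ _ → a) ≈ n × a
  ∑-const zero    a = refl
  ∑-const (suc n) a = trans (+-congʳ (∑-const n a)) (+-comm _ a)

  ∑ℕ-× : ∀ n f y → ∑ℕ n f × y ≈ ∑ n (λ i → f i × y)
  ∑ℕ-× zero    f y = refl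
  ∑ℕ-× (suc n) f y = trans (×-homo-+ y (∑ℕ n f) (f n)) (+-congʳ (∑ℕ-× n f y))

  ×≈×1* : ∀ n y → n × y ≈ (n × 1#) * y
  ×≈×1* n y = sym (trans (×-assoc-* n 1# y) (×-congʳ n (*-identityˡ y)))

  -- Each side is `∑ (suc n) f` short of one end term, and the two end terms agree.
  ∑-shift : ∀ n {f} → f n ≈ f 0 → ∑ n (λ i → f (suc i)) ≈ ∑ n f
  ∑-shift n {f} e = begin
    ∑ n (λ i → f (suc i))                    ≈⟨ solve 2 (λ a s → s := (a :+ s) :- a) refl (f 0) _ ⟩
    f 0 + ∑ n (λ i → f (suc i)) - f 0        ≈⟨ +-congʳ (∑-suc n f) ⟨
    ∑ n f + f n - f 0                        ≈⟨ +-congˡ (-‿cong (sym e)) ⟩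
    ∑ n f + f n - f n                        ≈⟨ solve 2 (λ a s → (s :+ a) :- a := s) refl (f n) _ ⟩
    ∑ n f                                    ∎

  ∑-shift^ : ∀ n k {f} → (∀ i → f (i ℕ.+ n) ≈ f i) → ∑ n (λ i → f (i ℕ.+ k)) ≈ ∑ n f
  ∑-shift^ n zero    {f} e = ∑-cong n (λ i _ → reflexive (≡.cong f (ℕ.+-identityʳ i)))
  ∑-shift^ n (suc k) {f} e = begin
    ∑ n (λ i → f (i ℕ.+ suc k))   ≈⟨ ∑-cong n (λ i _ → reflexive (≡.cong f (ℕ.+-suc i k))) ⟩
    ∑ n (λ i → f (suc (i ℕ.+ k))) ≈⟨ ∑-shift n (trans (reflexive (≡.cong f (ℕ.+-comm n k))) (e k)) ⟩
    ∑ n (λ i → f (i ℕ.+ k))       ≈⟨ ∑-shift^ n k e ⟩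
    ∑ n f                         ∎

  sum≈∑ : ∀ n (f : ℕ → Carrier) → Sum.sum {n} (λ i → f (toℕ i)) ≈ ∑ n f
  sum≈∑ zero    f = refl
  sum≈∑ (suc n) f = trans (+-congˡ (sum≈∑ n (λ i → f (suc i)))) (sym (∑-suc n f))

-- Calculus of finite differences.

module FiniteDiff {c ℓ} (K : CommutativeRing c ℓ) where
  open RingKit K
  open Binomial using (nC0≡1; pascal; p∣pCk)

  open import Data.Nat.Base as ℕ using (ℕ; zero; suc; s≤s; z≤n)
  import Data.Nat.Properties as ℕ
  import Data.Integer.Base as ℤ
  open import Data.Nat.Combinatorics using (_C_; nCn≡1; k>n⇒nCk≡0)
  open import Data.Nat.Divisibility using (divides)
  open import Data.Nat.Primality using (Prime; ¬prime[0])
  open import Data.Sum.Base using (inj₁; inj₂)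
  open import Relation.Nullary.Negation using (contradiction)
  open import Relation.Binary.PropositionalEquality.Core as ≡ using (_≡_)
  open import Relation.Binary.Reasoning.Setoid setoid
  open import Algebra.Properties.CommutativeMonoid.Mult +-commutativeMonoid using (×-distrib-+)

  Δ : (ℕ → Carrier) → ℕ → Carrier
  Δ h n = h (suc n) - h n

  Δ^ : ℕ → (ℕ → Carrier) → ℕ → Carrier
  Δ^ zero    h = h
  Δ^ (suc k) h = Δ^ k (Δ h)

  Δ^-suc : ∀ k h n → Δ^ (suc k) h n ≡ Δ (Δ^ k h) n
  Δ^-suc zero    h n = ≡.refl
  Δ^-suc (suc k) h n = Δ^-suc k (Δ h) n

  Δ^-cong : ∀ k {f g} → (∀ n → f n ≈ g n) → ∀ n → Δ^ k f n ≈ Δ^ k g n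
  Δ^-cong zero    e   = e
  Δ^-cong (suc k) e = Δ^-cong k (λ n → +-cong (e (suc n)) (-‿cong (e n)))

  Δ^-+ : ∀ k f g n → Δ^ k (λ i → f i + g i) n ≈ Δ^ k f n + Δ^ k g n
  Δ^-+ zero    f g n = refl
  Δ^-+ (suc k) f g n = trans
    (Δ^-cong k (λ i → solve 4 (λ a b x y → (a :+ b) :- (x :+ y) := (a :- x) :+ (b :- y)) refl _ _ _ _) n)
    (Δ^-+ k (Δ f) (Δ g) n)

  Δ^-*ˡ : ∀ k a f n → Δ^ k (λ i → a * f i) n ≈ a * Δ^ k f n
  Δ^-*ˡ zero    a f n = refl
  Δ^-*ˡ (suc k) a f n = trans
    (Δ^-cong k (λ i → solve 3 (λ a x y → (a :* x) :- (a :* y) := a :* (x :- y)) refl _ _ _) n)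
    (Δ^-*ˡ k a (Δ f) n)

  -- The identity (1 + Δ)^n (1 + Δ) = (1 + Δ)^(n + 1), with `a i` in the place of Δ^i; it is the
  -- induction step of `newton`.
  pascal-∑ : ∀ n (a : ℕ → Carrier) → ∑ (suc n) (λ i → (n C i) × (a i + a (suc i))) ≈ ∑ (suc (suc n)) (λ i → (suc n C i) × a i)
  pascal-∑ n a = begin
    ∑ (suc n) (λ i → (n C i) × (a i + a (suc i)))
      ≈⟨ ∑-cong (suc n) (λ i _ → ×-distrib-+ _ _ (n C i)) ⟩
    ∑ (suc n) (λ i → (n C i) × a i + (n C i) × a (suc i))
      ≈⟨ ∑-+ (suc n) _ _ ⟩
    ∑ (suc n) (λ i → (n C i) × a i) + ∑ (suc n) (λ i → (n C i) × a (suc i))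
      ≈⟨ +-congʳ extend ⟩
    (n C 0) × a 0 + ∑ (suc n) (λ i → (n C suc i) × a (suc i)) + ∑ (suc n) (λ i → (n C i) × a (suc i))
      ≈⟨ trans (+-assoc _ _ _) (+-congˡ (sym (∑-+ (suc n) _ _))) ⟩
    (n C 0) × a 0 + ∑ (suc n) (λ i → (n C suc i) × a (suc i) + (n C i) × a (suc i))
      ≈⟨ +-cong (×-congˡ (≡.trans (nC0≡1 n) (≡.sym (nC0≡1 (suc n))))) (∑-cong (suc n) combine) ⟩
    (suc n C 0) × a 0 + ∑ (suc n) (λ i → (suc n C suc i) × a (suc i))
      ≈⟨ ∑-suc (suc n) _ ⟨
    ∑ (suc (suc n)) (λ i → (suc n C i) × a i) ∎
    where
    extend : ∑ (suc n) (λ i → (n C i) × a i) ≈ (n C 0) × a 0 + ∑ (suc n) (λ i → (n C suc i) × a (suc i))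
    extend = begin
      ∑ (suc n) (λ i → (n C i) × a i)   ≈⟨ +-identityʳ _ ⟨
      ∑ (suc n) (λ i → (n C i) × a i) + 0#
        ≈⟨ +-congˡ (sym (×-congˡ {a (suc n)} (k>n⇒nCk≡0 (ℕ.n<1+n n)))) ⟩
      ∑ (suc (suc n)) (λ i → (n C i) × a i) ≈⟨ ∑-suc (suc n) _ ⟩
      (n C 0) × a 0 + ∑ (suc n) (λ i → (n C suc i) × a (suc i)) ∎
    combine : ∀ i → i ℕ.< suc n → (n C suc i) × a (suc i) + (n C i) × a (suc i) ≈ (suc n C suc i) × a (suc i)
    combine i _ = begin
      (n C suc i) × a (suc i) + (n C i) × a (suc i)  ≈⟨ +-comm _ _ ⟩
      (n C i) × a (suc i) + (n C suc i) × a (suc i)  ≈⟨ ×-homo-+ _ (n C i) (n C suc i) ⟨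
      (n C i ℕ.+ n C suc i) × a (suc i)              ≡⟨ ≡.cong (_× a (suc i)) (pascal n i) ⟨
      (suc n C suc i) × a (suc i) ∎

  -- The shift by n is (1 + Δ)^n, expanded by the binomial theorem.
  newton : ∀ n h x → h (n ℕ.+ x) ≈ ∑ (suc n) (λ i → (n C i) × Δ^ i h x)
  newton zero h x = sym (trans (+-identityˡ _) (trans (×-congˡ (nC0≡1 0)) (×-homo-1 _)))
  newton (suc n) h x = begin
    h (suc (n ℕ.+ x))                                          ≡⟨ ≡.cong h (ℕ.+-suc n x) ⟨
    h (n ℕ.+ suc x)                                            ≈⟨ newton n h (suc x) ⟩
    ∑ (suc n) (λ i → (n C i) × Δ^ i h (suc x))                 ≈⟨ ∑-cong (suc n) (λ i _ → ×-congʳ (n C i) (step i)) ⟩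
    ∑ (suc n) (λ i → (n C i) × (Δ^ i h x + Δ^ (suc i) h x))    ≈⟨ pascal-∑ n (λ i → Δ^ i h x) ⟩
    ∑ (suc (suc n)) (λ i → (suc n C i) × Δ^ i h x)             ∎
    where
    step : ∀ i → Δ^ i h (suc x) ≈ Δ^ i h x + Δ^ (suc i) h x
    step i = begin
      Δ^ i h (suc x)                             ≈⟨ solve 2 (λ a b → b := a :+ (b :- a)) refl (Δ^ i h x) _ ⟩
      Δ^ i h x + (Δ^ i h (suc x) - Δ^ i h x)     ≡⟨ ≡.cong (Δ^ i h x +_) (Δ^-suc i h x) ⟨
      Δ^ i h x + Δ^ (suc i) h x                  ∎

  -- The constant c may vanish, and then the degree is below k. For a polynomial function c is k!
  -- times the usual leading coefficient.
  Deg : ℕ → Carrier → (ℕ → Carrier) → Set ℓ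
  Deg k c h = ∀ n → Δ^ k h n ≈ c

  Deg-cong : ∀ k {c d f g} → c ≈ d → (∀ n → f n ≈ g n) → Deg k c f → Deg k d g
  Deg-cong k c≈d e D n = trans (sym (Δ^-cong k e n)) (trans (D n) c≈d)

  Deg-suc : ∀ k {c h} → Deg k c h → Deg (suc k) 0# h
  Deg-suc k {c} {h} D n = trans (reflexive (Δ^-suc k h n)) (trans (+-cong (D (suc n)) (-‿cong (D n))) (-‿inverseʳ c))

  Deg-raise : ∀ {k l c h} → k ℕ.< l → Deg k c h → Deg l 0# h
  Deg-raise {k} {suc l} {c} (s≤s k≤l) D with ℕ.m≤n⇒m<n∨m≡n k≤l
  ... | inj₁ k<l    = Deg-suc l (Deg-raise k<l D)
  ... | inj₂ ≡.refl = Deg-suc l D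

  Deg-lower : ∀ k {f} → Deg (suc k) 0# f → Deg k (Δ^ k f 0) f
  Deg-lower k {f} D zero    = refl
  Deg-lower k {f} D (suc n) = trans (begin
    Δ^ k f (suc n)                           ≈⟨ solve 2 (λ a b → b := a :+ (b :- a)) refl (Δ^ k f n) _ ⟩
    Δ^ k f n + (Δ^ k f (suc n) - Δ^ k f n)   ≡⟨ ≡.cong (Δ^ k f n +_) (Δ^-suc k f n) ⟨
    Δ^ k f n + Δ^ (suc k) f n                ≈⟨ +-congˡ (D n) ⟩
    Δ^ k f n + 0#                            ≈⟨ +-identityʳ _ ⟩
    Δ^ k f n                                 ∎) (Deg-lower k D n)

  Deg-const : ∀ a → Deg 0 a (λ _ → a)
  Deg-const a n = refl

  Deg-+ : ∀ k {c d f g} → Deg k c f → Deg k d g → Deg k (c + d) (λ n → f n + g n)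
  Deg-+ k D E n = trans (Δ^-+ k _ _ n) (+-cong (D n) (E n))

  Deg-*ˡ : ∀ k a {c f} → Deg k c f → Deg k (a * c) (λ n → a * f n)
  Deg-*ˡ k a D n = trans (Δ^-*ˡ k a _ n) (*-congˡ (D n))

  Deg-∑ : ∀ k N {c : ℕ → Carrier} {f : ℕ → ℕ → Carrier} → (∀ i → i ℕ.< N → Deg k (c i) (f i)) → Deg k (∑ N c) (λ n → ∑ N (λ i → f i n))
  Deg-∑ k zero D n = zeroes k n
    where
    zeroes : ∀ k → Deg k 0# (λ _ → 0#)
    zeroes zero    n = refl
    zeroes (suc k) n = Deg-suc k {0#} {λ _ → 0#} (zeroes k) n
  Deg-∑ k (suc N) D = Deg-+ k (Deg-∑ k N (λ i i<N → D i (ℕ.m<n⇒m<1+n i<N))) (D N (ℕ.n<1+n N))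

  -- The binomial factor is (k + l)! / (k! l!), owed to the normalisation of the leading constants.
  -- In Δ(f g) = Δf g + f Δg + Δf Δg the last product has lower degree, and Pascal's rule adds the
  -- leading constants of the other two.
  Deg-* : ∀ k l {c d f g} → Deg k c f → Deg l d g → Deg (k ℕ.+ l) (((k ℕ.+ l) C k) × (c * d)) (λ n → f n * g n)
  Deg-* zero l {c} {d} {f} {g} D E =
    Deg-cong l (sym (trans (×-congˡ (nC0≡1 l)) (×-homo-1 _))) (λ n → *-congʳ (sym (D n))) (Deg-*ˡ l c E)
  Deg-* (suc k) zero {c} {d} {f} {g} D E =
    ≡.subst (λ z → Deg z ((z C suc k) × (c * d)) (λ n → f n * g n)) (≡.sym (ℕ.+-identityʳ (suc k)))
      (Deg-cong (suc k) {f = λ n → d * f n} (trans (*-comm d c) (sym (trans (×-congˡ (nCn≡1 (suc k))) (×-homo-1 _))))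
         (λ n → trans (*-comm d (f n)) (*-congˡ (sym (E n)))) (Deg-*ˡ (suc k) d D))
  Deg-* (suc k) (suc l) {c} {d} {f} {g} D E =
    Deg-cong (k ℕ.+ suc l) {f = λ n → Δ f n * g n + f n * Δ g n + Δ f n * Δ g n}
      lead (λ n → solve 4 (λ f' f g' g → (f' :- f) :* g :+ f :* (g' :- g) :+ (f' :- f) :* (g' :- g) := f' :* g' :- f :* g) refl _ _ _ _)
      (Deg-+ (k ℕ.+ suc l) (Deg-+ (k ℕ.+ suc l) (Deg-* k (suc l) D E) second) third)
    where
    second : Deg (k ℕ.+ suc l) (((k ℕ.+ suc l) C suc k) × (c * d)) (λ n → f n * Δ g n)
    second = ≡.subst (λ z → Deg z ((z C suc k) × (c * d)) (λ n → f n * Δ g n)) (≡.sym (ℕ.+-suc k l)) (Deg-* (suc k) l {g = Δ g} D E)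
    third : Deg (k ℕ.+ suc l) 0# (λ n → Δ f n * Δ g n)
    third = ≡.subst (λ z → Deg z 0# (λ n → Δ f n * Δ g n)) (≡.sym (ℕ.+-suc k l))
      (Deg-suc (k ℕ.+ l) (Deg-* k l {f = Δ f} {g = Δ g} D E))
    lead : ((k ℕ.+ suc l) C k) × (c * d) + ((k ℕ.+ suc l) C suc k) × (c * d) + 0# ≈ (suc (k ℕ.+ suc l) C suc k) × (c * d)
    lead = trans (+-identityʳ _) (trans (sym (×-homo-+ _ ((k ℕ.+ suc l) C k) _)) (×-congˡ (≡.sym (pascal (k ℕ.+ suc l) k))))

  Deg-id : Deg 1 1# (λ n → n × 1#)
  Deg-id n = solve 2 (λ u x → (u :+ x) :- x := u) refl 1# _

  -- E^p = (1 + Δ)^p = 1 + Δ^p in characteristic p, E being the shift.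
  frobenius : ∀ {p} → Prime p → p × 1# ≈ 0# → ∀ h x → h (p ℕ.+ x) ≈ h x + Δ^ p h x
  frobenius {zero} pr _ h x = contradiction pr ¬prime[0]
  frobenius {suc n} pr char h x = begin
    h (suc n ℕ.+ x)                                             ≈⟨ newton (suc n) h x ⟩
    ∑ (suc n) (λ i → (suc n C i) × Δ^ i h x) + (suc n C suc n) × Δ^ (suc n) h x
                                                                ≈⟨ +-cong (∑-suc n _) (trans (×-congˡ (nCn≡1 (suc n))) (×-homo-1 _)) ⟩
    ((suc n C 0) × h x + ∑ n (λ i → (suc n C suc i) × Δ^ (suc i) h x)) + Δ^ (suc n) h x
                                                                ≈⟨ +-congʳ (+-cong (trans (×-congˡ (nC0≡1 (suc n))) (×-homo-1 _)) (∑-zero n middle)) ⟩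
    h x + 0# + Δ^ (suc n) h x                                   ≈⟨ +-congʳ (+-identityʳ _) ⟩
    h x + Δ^ (suc n) h x                                        ∎
    where
    char× : ∀ y → suc n × y ≈ 0#
    char× y = begin
      suc n × y          ≈⟨ ×-congʳ (suc n) (*-identityˡ y) ⟨
      suc n × (1# * y)   ≈⟨ ×-assoc-* (suc n) 1# y ⟨
      (suc n × 1#) * y   ≈⟨ *-congʳ char ⟩
      0# * y             ≈⟨ zeroˡ y ⟩
      0#                 ∎
    middle : ∀ i → i ℕ.< n → (suc n C suc i) × Δ^ (suc i) h x ≈ 0#
    middle i i<n with p∣pCk pr (s≤s (z≤n {i})) (s≤s i<n)
    ... | divides q e = begin
      (suc n C suc i) × y      ≡⟨ ≡.cong (_× y) (≡.trans e (ℕ.*-comm q (suc n))) ⟩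
      (suc n ℕ.* q) × y        ≈⟨ ×-assocˡ y (suc n) q ⟨
      suc n × (q × y)          ≈⟨ char× (q × y) ⟩
      0#                       ∎
      where y = Δ^ (suc i) h x

  -- Summation is a right inverse of Δ, so this is frobenius for the partial sums of h.
  ∑-char : ∀ {n} → Prime (suc n) → suc n × 1# ≈ 0# → ∀ h → ∑ (suc n) h ≈ Δ^ n h 0
  ∑-char {n} pr char h = begin
    ∑ (suc n) h                              ≡⟨ ≡.cong (λ k → ∑ k h) (ℕ.+-identityʳ (suc n)) ⟨
    ∑ (suc n ℕ.+ 0) h                        ≈⟨ frobenius pr char (λ k → ∑ k h) 0 ⟩
    0# + Δ^ n (Δ (λ k → ∑ k h)) 0            ≈⟨ +-identityˡ _ ⟩
    Δ^ n (Δ (λ k → ∑ k h)) 0                 ≈⟨ Δ^-cong n (λ k → solve 2 (λ s x → (s :+ x) :- s := x) refl (∑ k h) (h k)) 0 ⟩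
    Δ^ n h 0                                 ∎

  -- Newton's formula f(0) + x Δf(0) + x (x - 1)/2 · Δ²f(0), rearranged by powers of x. Here h is
  -- one half, and the term - x/2 · Δ²f(0) accounts for the - a in the linear coefficient.
  quadratic : ∀ {h f} → h + h ≈ 1# → Deg 3 0# f → let a = h * Δ^ 2 f 0 in
    ∀ n → f n ≈ a * ((n × 1#) * (n × 1#)) + (Δ f 0 - a) * (n × 1#) + f 0
  quadratic {h} {f} 2h≈1 D zero = solve 3 (λ a b c → c := a :* (con (ℤ.+ 0) :* con (ℤ.+ 0)) :+ b :* con (ℤ.+ 0) :+ c) refl _ _ (f 0)
  quadratic {h} {f} 2h≈1 D (suc n) = begin
    f (suc n)
      ≈⟨ solve 2 (λ x y → y := x :+ (y :- x)) refl (f n) _ ⟩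
    f n + Δ f n
      ≈⟨ +-cong (quadratic {h} 2h≈1 D n) (linear n) ⟩
    a * (x * x) + (Δ f 0 - a) * x + f 0 + (Δ f 0 + x * d)
      ≈⟨ +-congˡ (+-congˡ (*-congˡ d≈)) ⟩
    a * (x * x) + (Δ f 0 - a) * x + f 0 + (Δ f 0 + x * (a + a))
      ≈⟨ solve 4 (λ a x b c → a :* (x :* x) :+ (b :- a) :* x :+ c :+ (b :+ x :* (a :+ a))
           := a :* ((con (ℤ.+ 1) :+ x) :* (con (ℤ.+ 1) :+ x)) :+ (b :- a) :* (con (ℤ.+ 1) :+ x) :+ c) refl a x (Δ f 0) (f 0) ⟩
    a * ((ι (ℤ.+ 1) + x) * (ι (ℤ.+ 1) + x)) + (Δ f 0 - a) * (ι (ℤ.+ 1) + x) + f 0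
      ≈⟨ +-congʳ (+-cong (*-congˡ (*-cong one one)) (*-congˡ one)) ⟩
    a * ((suc n × 1#) * (suc n × 1#)) + (Δ f 0 - a) * (suc n × 1#) + f 0 ∎
    where
    d = Δ^ 2 f 0
    a = h * d
    x = n × 1#
    one : ι (ℤ.+ 1) + x ≈ suc n × 1#
    one = +-congʳ (+-identityʳ 1#)
    d≈ : d ≈ a + a
    d≈ = trans (sym (*-identityˡ d)) (trans (*-congʳ (sym 2h≈1)) (distribʳ d h h))
    linear : ∀ n → Δ f n ≈ Δ f 0 + (n × 1#) * d
    linear zero    = solve 2 (λ b d → b := b :+ con (ℤ.+ 0) :* d) refl _ d
    linear (suc n) = begin
      Δ f (suc n)                        ≈⟨ solve 2 (λ x y → y := x :+ (y :- x)) refl (Δ f n) _ ⟩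
      Δ f n + Δ^ 2 f n                   ≈⟨ +-cong (linear n) (Deg-lower 2 {f} D n) ⟩
      Δ f 0 + (n × 1#) * d + d           ≈⟨ trans (+-assoc _ _ _) (+-congˡ (trans (+-comm _ d) (+-congʳ (sym (*-identityˡ d))))) ⟩
      Δ f 0 + (1# * d + (n × 1#) * d)    ≈⟨ +-congˡ (distribʳ d 1# _) ⟨
      Δ f 0 + (suc n × 1#) * d           ∎

-- Power sums of f(x) + b x and the degree of f in odd characteristic.

module Planar {c ℓ} (K : CommutativeRing c ℓ) where
  open import Data.Nat.Base as ℕ using (ℕ; zero; suc; s≤s; z≤n)
  open import Data.Nat.Divisibility using (_∣_; _∤_)
  open import Data.Nat.Primality using (Prime; ¬prime[1])
  open import Data.Sum.Base using (_⊎_; inj₁; inj₂)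
  open import Relation.Nullary.Decidable.Core using (Dec; yes; no)
  open FiniteDiff K
  open RingKit K
  open Binomial using (p∤nCk; p∤1)
  import Algebra.Properties.CommutativeSemiring.Binomial commutativeSemiring as Binom
  open import Algebra.Properties.CommutativeSemiring.Exp commutativeSemiring using (^-distrib-*)

  import Data.Nat.Properties as ℕ
  open import Data.Nat.DivMod using (_/_; _%_; m≡m%n+[m/n]*n; m%n<n)
  open import Data.Nat.Combinatorics using (_C_)
  open import Data.Nat.Tactic.RingSolver as ℕSolver using ()
  open import Data.Product.Base using (_,_; proj₂; ∃) renaming (_×_ to _∧_)
  open import Relation.Binary.PropositionalEquality.Core as ≡ using (_≡_)
  open import Relation.Nullary.Negation.Core using (¬_; contradiction)
  open import Relation.Binary.Reasoning.Setoid setoid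

  -- 2m = r k + i is the division of p − 1 by the degree k.
  exponents : ∀ m t → 3 ℕ.+ t ℕ.≤ m ℕ.+ m → ∃ λ r → ∃ λ i →
    (i ℕ.+ r ℕ.* (3 ℕ.+ t) ≡ m ℕ.+ m) ∧ ((r ℕ.+ i ℕ.< m) ⊎ ((r ℕ.+ i ≡ m) ∧ (0 ℕ.< i)))
  exponents m t k≤2m = r , i , ≡.sym eq , conclude i ≡.refl
    where
    k = 3 ℕ.+ t
    r = (m ℕ.+ m) / k
    i = (m ℕ.+ m) % k
    eq : m ℕ.+ m ≡ i ℕ.+ r ℕ.* k
    eq = m≡m%n+[m/n]*n (m ℕ.+ m) k
    i<k : i ℕ.< k
    i<k = m%n<n (m ℕ.+ m) k
    double-even : ∀ a b → a ℕ.+ a ≡ suc (b ℕ.+ b) → ∀ {w : Set} → w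
    double-even (suc a) (suc b) e = double-even a b
      (ℕ.suc-injective (ℕ.suc-injective (≡.trans (≡.cong suc (≡.sym (ℕ.+-suc a a))) (≡.trans e (≡.cong (λ z → suc (suc z)) (ℕ.+-suc b b))))))
    double-even (suc zero) zero ()
    double-even (suc (suc a)) zero ()
    -- As 1 + t = k - 2, this is equivalent to 2 (r + i) ≤ i + r k = 2m. From r = 2 on it follows
    -- from i < k; r = 0 contradicts k ≤ 2m, and for r = 1 the only bad value i = k - 1 would make
    -- 2m odd.
    small : ∀ r i → i ℕ.< k → m ℕ.+ m ≡ i ℕ.+ r ℕ.* k → i ℕ.≤ r ℕ.* (1 ℕ.+ t)
    small zero i i<k e = contradiction (ℕ.≤-trans (≡.subst (k ℕ.≤_) (≡.trans e (ℕ.+-identityʳ i)) k≤2m) ℕ.≤-refl) (ℕ.<⇒≱ i<k)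
    small (suc zero) i (s≤s i≤) e with ℕ.m≤n⇒m<n∨m≡n i≤
    ... | inj₁ (s≤s i≤') = ℕ.≤-trans i≤' (ℕ.≤-reflexive (≡.sym (ℕ.+-identityʳ _)))
    ... | inj₂ ≡.refl = double-even m (2 ℕ.+ t) (≡.trans e (arith t))
      where
      arith : ∀ t → 2 ℕ.+ t ℕ.+ 1 ℕ.* (3 ℕ.+ t) ≡ suc (2 ℕ.+ t ℕ.+ (2 ℕ.+ t))
      arith = ℕSolver.solve-∀
    small (suc (suc r)) i (s≤s i≤) e = ℕ.≤-trans i≤ (ℕ.≤-trans (ℕ.m≤m+n _ (t ℕ.+ r ℕ.* (1 ℕ.+ t))) (ℕ.≤-reflexive (arith t r)))
      where
      arith : ∀ t r → 2 ℕ.+ t ℕ.+ (t ℕ.+ r ℕ.* (1 ℕ.+ t)) ≡ suc (suc r) ℕ.* (1 ℕ.+ t)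
      arith = ℕSolver.solve-∀
    half : ∀ a → a ℕ.+ a ℕ.≤ m ℕ.+ m → a ℕ.≤ m
    half a 2a≤2m = ℕ.≮⇒≥ (λ m<a → ℕ.<⇒≱ (ℕ.+-mono-< m<a m<a) 2a≤2m)
    r+i≤m : r ℕ.+ i ℕ.≤ m
    r+i≤m = half (r ℕ.+ i) (ℕ.≤-trans (ℕ.≤-reflexive (arith₁ r i))
      (ℕ.≤-trans (ℕ.+-monoʳ-≤ (2 ℕ.* r ℕ.+ i) (small r i i<k eq)) (ℕ.≤-reflexive (≡.trans (arith₂ r i t) (≡.sym eq)))))
      where
      arith₁ : ∀ r i → r ℕ.+ i ℕ.+ (r ℕ.+ i) ≡ 2 ℕ.* r ℕ.+ i ℕ.+ i
      arith₁ = ℕSolver.solve-∀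
      arith₂ : ∀ r i t → 2 ℕ.* r ℕ.+ i ℕ.+ r ℕ.* (1 ℕ.+ t) ≡ i ℕ.+ r ℕ.* (3 ℕ.+ t)
      arith₂ = ℕSolver.solve-∀
    0<m : 0 ℕ.< m
    0<m = ℕ.≮⇒≥ (λ m<1 → contradiction (≡.subst (λ m → 3 ℕ.+ t ℕ.≤ m ℕ.+ m) (ℕ.n<1⇒n≡0 m<1) k≤2m) (λ ()))
    conclude : ∀ i' → i ≡ i' → (r ℕ.+ i ℕ.< m) ⊎ ((r ℕ.+ i ≡ m) ∧ (0 ℕ.< i))
    conclude i' e with ℕ.m≤n⇒m<n∨m≡n r+i≤m
    ... | inj₁ lt = inj₁ lt
    conclude (suc i') e | inj₂ r+i≡m = inj₂ (r+i≡m , ≡.subst (0 ℕ.<_) (≡.sym e) (s≤s z≤n))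
    -- With i = 0 and r = m the division reads m k = 2m, impossible for k ≥ 3 and m > 0.
    conclude zero e | inj₂ r+i≡m = contradiction (ℕ.≤-reflexive too-small) (ℕ.<⇒≱ (ℕ.<-≤-trans 0<m (ℕ.m≤m+n m (t ℕ.* m))))
      where
      r≡m : r ≡ m
      r≡m = ≡.trans (≡.sym (≡.trans (≡.cong (r ℕ.+_) e) (ℕ.+-identityʳ r))) r+i≡m
      arith : ∀ m t → m ℕ.* (3 ℕ.+ t) ≡ m ℕ.+ m ℕ.+ (m ℕ.+ t ℕ.* m)
      arith = ℕSolver.solve-∀
      too-small : m ℕ.+ t ℕ.* m ≡ 0
      too-small = ≡.sym (ℕ.+-cancelˡ-≡ (m ℕ.+ m) 0 _ (≡.trans (ℕ.+-identityʳ _) (≡.trans eq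
        (≡.trans (≡.cong₂ (λ i r → i ℕ.+ r ℕ.* k) e r≡m) (arith m t)))))

  module OddCharacteristic (m : ℕ) (pr : Prime (suc (m ℕ.+ m)))
    (char : suc (m ℕ.+ m) × 1# ≈ 0#)
    (faithful : ∀ n → n × 1# ≈ 0# → suc (m ℕ.+ m) ∣ n)
    (domain : ∀ {x y} → x * y ≈ 0# → x ≈ 0# ⊎ y ≈ 0#)
    (zero? : ∀ x → Dec (x ≈ 0#)) where

    p = suc (m ℕ.+ m)

    ∑-low-degree : ∀ {d a h} → d ℕ.< m ℕ.+ m → Deg d a h → ∑ p h ≈ 0#
    ∑-low-degree {h = h} d< D = trans (∑-char pr char h) (Deg-raise d< D 0)

    *-≉0 : ∀ {x y} → ¬ x ≈ 0# → ¬ y ≈ 0# → ¬ x * y ≈ 0#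
    *-≉0 x≉0 y≉0 e with domain e
    ... | inj₁ x≈0 = x≉0 x≈0
    ... | inj₂ y≈0 = y≉0 y≈0

    ×-≉0 : ∀ {n x} → p ∤ n → ¬ x ≈ 0# → ¬ n × x ≈ 0#
    ×-≉0 {n} {x} p∤n x≉0 e = *-≉0 (λ n≈0 → p∤n (faithful n n≈0)) x≉0
      (trans (trans (×-assoc-* n 1# x) (×-congʳ n (*-identityˡ x))) e)

    C×-≉0 : ∀ n k {x} → k ℕ.≤ n → n ℕ.< p → ¬ x ≈ 0# → ¬ (n C k) × x ≈ 0#
    C×-≉0 n k k≤n n<p = ×-≉0 (p∤nCk pr n k k≤n n<p)

    1≉0 : ¬ 1# ≈ 0#
    1≉0 e = p∤1 pr (faithful 1 (trans (+-identityʳ 1#) e))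

    HasDegree : ℕ → (ℕ → Carrier) → Set _
    HasDegree k h = ∃ λ a → (¬ a ≈ 0#) ∧ Deg k a h

    -- The bound keeps the binomial factor of `Deg-*` prime to p.
    HasDegree-* : ∀ k l {f g} → k ℕ.+ l ℕ.< p → HasDegree k f → HasDegree l g → HasDegree (k ℕ.+ l) (λ n → f n * g n)
    HasDegree-* k l k+l<p (a , a≉0 , D) (b , b≉0 , E) =
      _ , C×-≉0 (k ℕ.+ l) k (ℕ.m≤m+n k l) k+l<p (*-≉0 a≉0 b≉0) , Deg-* k l D E

    HasDegree-^ : ∀ k r {f} → r ℕ.* k ℕ.< p → HasDegree k f → HasDegree (r ℕ.* k) (λ n → f n ^ r)
    HasDegree-^ k zero    _     F = 1# , 1≉0 , Deg-const 1#
    HasDegree-^ k (suc r) rk<p F =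
      HasDegree-* k (r ℕ.* k) rk<p F (HasDegree-^ k r (ℕ.≤-<-trans (ℕ.m≤n+m (r ℕ.* k) k) rk<p) F)

    HasDegree-monomial : ∀ l → l ℕ.< p → HasDegree l (λ n → (n × 1#) ^ l)
    HasDegree-monomial l l<p = ≡.subst (λ d → HasDegree d (λ n → (n × 1#) ^ l)) (ℕ.*-identityʳ l)
      (HasDegree-^ 1 l (≡.subst (ℕ._< p) (≡.sym (ℕ.*-identityʳ l)) l<p) (1# , 1≉0 , Deg-id))

    module _ (f : ℕ → Carrier) where

      powerSum : ℕ → ℕ → Carrier
      powerSum j b = ∑ p (λ x → ((b × 1#) * (x × 1#) + f x) ^ j)

      moment : ℕ → ℕ → Carrier
      moment l s = ∑ p (λ x → (x × 1#) ^ l * f x ^ s)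

      powerSum-expand : ∀ j b → powerSum j b ≈ ∑ (suc j) (λ l → (b × 1#) ^ l * ((j C l) × moment l (j ℕ.∸ l)))
      powerSum-expand j b = begin
        ∑ p (λ x → (B * (x × 1#) + f x) ^ j)
          ≈⟨ ∑-cong p (λ x _ → trans (Binom.theorem j (B * (x × 1#)) (f x)) (sum≈∑ (suc j) _)) ⟩
        ∑ p (λ x → ∑ (suc j) (λ l → (j C l) × ((B * (x × 1#)) ^ l * f x ^ (j ℕ.∸ l))))
          ≈⟨ ∑-comm p (suc j) _ ⟩
        ∑ (suc j) (λ l → ∑ p (λ x → (j C l) × ((B * (x × 1#)) ^ l * f x ^ (j ℕ.∸ l))))
          ≈⟨ ∑-cong (suc j) (λ l _ → trans (∑-cong p (λ x _ → term l x)) (sym (∑-*ˡ p _ _))) ⟩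
        ∑ (suc j) (λ l → (B ^ l * ((j C l) × 1#)) * moment l (j ℕ.∸ l))
          ≈⟨ ∑-cong (suc j) (λ l _ → trans (*-assoc _ _ _) (*-congˡ (trans (×-assoc-* (j C l) 1# _) (×-congʳ (j C l) (*-identityˡ _))))) ⟩
        ∑ (suc j) (λ l → B ^ l * ((j C l) × moment l (j ℕ.∸ l))) ∎
        where
        B = b × 1#
        term : ∀ l x → (j C l) × ((B * (x × 1#)) ^ l * f x ^ (j ℕ.∸ l))
                     ≈ (B ^ l * ((j C l) × 1#)) * ((x × 1#) ^ l * f x ^ (j ℕ.∸ l))
        term l x = begin
          (j C l) × ((B * (x × 1#)) ^ l * F)              ≈⟨ ×-congʳ (j C l) (*-identityˡ _) ⟨
          (j C l) × (1# * ((B * (x × 1#)) ^ l * F))       ≈⟨ ×-assoc-* (j C l) 1# _ ⟨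
          ((j C l) × 1#) * ((B * (x × 1#)) ^ l * F)       ≈⟨ *-congˡ (*-congʳ (^-distrib-* B (x × 1#) l)) ⟩
          ((j C l) × 1#) * (B ^ l * (x × 1#) ^ l * F)     ≈⟨ solve 4 (λ c b x f → c :* (b :* x :* f) := (b :* c) :* (x :* f)) refl _ _ _ _ ⟩
          (B ^ l * ((j C l) × 1#)) * ((x × 1#) ^ l * F)   ∎
          where F = f x ^ (j ℕ.∸ l)

      moment-zero : ∀ k l s → l ℕ.+ s ℕ.* k ℕ.< m ℕ.+ m → HasDegree k f → moment l s ≈ 0#
      moment-zero k l s d< F = ∑-low-degree d<
        (proj₂ (proj₂ (HasDegree-* l (s ℕ.* k) d<p (HasDegree-monomial l (ℕ.≤-<-trans (ℕ.m≤m+n l _) d<p))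
          (HasDegree-^ k s (ℕ.≤-<-trans (ℕ.m≤n+m _ l) d<p) F))))
        where d<p = ℕ.m<n⇒m<1+n d<

      -- The summand has degree exactly p - 1, and summing over a full period applies Δ^(p - 1), so
      -- the moment equals its nonzero leading constant.
      moment-nonzero : ∀ k l s → l ℕ.+ s ℕ.* k ≡ m ℕ.+ m → HasDegree k f → ¬ moment l s ≈ 0#
      moment-nonzero k l s d≡ F e with HasDegree-* l (s ℕ.* k) d<p (HasDegree-monomial l (ℕ.≤-<-trans (ℕ.m≤m+n l _) d<p))
                                        (HasDegree-^ k s (ℕ.≤-<-trans (ℕ.m≤n+m _ l) d<p) F)
        where d<p = s≤s (ℕ.≤-reflexive d≡)
      ... | a , a≉0 , D = a≉0 (trans (sym (≡.subst (λ d → Deg d a (λ x → (x × 1#) ^ l * f x ^ s)) d≡ D 0)) (trans (sym (∑-char pr char _)) e))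

      -- Of the coefficients of b^l in the power sum, those with l > i vanish
      -- since the summand has degree < p − 1 in x, and that of b^i does not.
      powerSum-degree : ∀ k r i → 2 ℕ.≤ k → i ℕ.+ r ℕ.* k ≡ m ℕ.+ m → HasDegree k f → HasDegree i (powerSum (r ℕ.+ i))
      powerSum-degree k r i 2≤k e F with HasDegree-monomial i (s≤s (≡.subst (i ℕ.≤_) e (ℕ.m≤m+n i _)))
      ... | a , a≉0 , D = 0# + coeff i * a , (λ z → *-≉0 coeff-i≉0 a≉0 (trans (sym (+-identityˡ _)) z)) ,
        Deg-cong i refl (λ b → sym (top b)) (Deg-+ i low-degree
          (Deg-cong i refl (λ b → *-comm (coeff i) _) (Deg-*ˡ i (coeff i) D)))
        where
        j = r ℕ.+ i
        coeff : ℕ → Carrier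
        coeff l = (j C l) × moment l (j ℕ.∸ l)
        j∸i≡r : j ℕ.∸ i ≡ r
        j∸i≡r = ℕ.m+n∸n≡m r i
        j≤2m : j ℕ.≤ m ℕ.+ m
        j≤2m = ≡.subst (j ℕ.≤_) (≡.trans (ℕ.+-comm _ i) e) (ℕ.+-monoˡ-≤ i
          (ℕ.≤-trans (ℕ.≤-reflexive (≡.sym (ℕ.*-identityʳ r))) (ℕ.*-monoʳ-≤ r (ℕ.≤-trans (s≤s z≤n) 2≤k))))
        coeff-i≉0 : ¬ coeff i ≈ 0#
        coeff-i≉0 = C×-≉0 j i (ℕ.m≤n+m i r) (s≤s j≤2m)
          (moment-nonzero k i (j ℕ.∸ i) (≡.trans (≡.cong (λ s → i ℕ.+ s ℕ.* k) j∸i≡r) e) F)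
        -- Passing from b^l to b^(l + 1) trades a factor f(x) of degree k ≥ 2 for a factor x, which
        -- lowers the degree in x by k - 1. At l = i the degree is p - 1, so beyond i it is smaller.
        high : ∀ t → t ℕ.< r → coeff (suc i ℕ.+ t) ≈ 0#
        high t t<r = trans (×-congʳ (j C (suc i ℕ.+ t)) (moment-zero k (suc i ℕ.+ t) (j ℕ.∸ (suc i ℕ.+ t)) bound F)) (n×0 (j C (suc i ℕ.+ t)))
          where
          n×0 : ∀ n → n × 0# ≈ 0#
          n×0 n = trans (sym (trans (×-assoc-* n 1# 0#) (×-congʳ n (*-identityˡ 0#)))) (zeroʳ _)
          s = r ℕ.∸ suc t
          r≡ : r ≡ s ℕ.+ suc t
          r≡ = ≡.sym (ℕ.m∸n+n≡m t<r)
          arith : ∀ s t i → s ℕ.+ suc t ℕ.+ i ≡ s ℕ.+ (suc i ℕ.+ t)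
          arith = ℕSolver.solve-∀
          s≡ : j ℕ.∸ (suc i ℕ.+ t) ≡ s
          s≡ = ≡.trans (≡.cong (ℕ._∸ (suc i ℕ.+ t)) (≡.trans (≡.cong (ℕ._+ i) r≡) (arith s t i))) (ℕ.m+n∸n≡m s (suc i ℕ.+ t))
          arith₁ : ∀ s t i k → suc (suc i ℕ.+ t ℕ.+ s ℕ.* k) ≡ i ℕ.+ s ℕ.* k ℕ.+ (2 ℕ.+ t)
          arith₁ = ℕSolver.solve-∀
          arith₂ : ∀ s t i k → i ℕ.+ s ℕ.* k ℕ.+ suc t ℕ.* k ≡ i ℕ.+ (s ℕ.+ suc t) ℕ.* k
          arith₂ = ℕSolver.solve-∀
          2+t≤ : 2 ℕ.+ t ℕ.≤ suc t ℕ.* k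
          2+t≤ = ℕ.+-mono-≤ 2≤k (ℕ.≤-trans (ℕ.≤-reflexive (≡.sym (ℕ.*-identityʳ t))) (ℕ.*-monoʳ-≤ t (ℕ.≤-trans (s≤s z≤n) 2≤k)))
          bound : suc i ℕ.+ t ℕ.+ (j ℕ.∸ (suc i ℕ.+ t)) ℕ.* k ℕ.< m ℕ.+ m
          bound = ≡.subst₂ (λ a b → suc i ℕ.+ t ℕ.+ a ℕ.* k ℕ.< b) (≡.sym s≡) e
            (ℕ.≤-trans (ℕ.≤-reflexive (arith₁ s t i k)) (ℕ.≤-trans (ℕ.+-monoʳ-≤ (i ℕ.+ s ℕ.* k) 2+t≤)
              (ℕ.≤-reflexive (≡.trans (arith₂ s t i k) (≡.cong (λ r → i ℕ.+ r ℕ.* k) (≡.sym r≡))))))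
        top : ∀ b → powerSum j b ≈ ∑ i (λ l → (b × 1#) ^ l * coeff l) + (b × 1#) ^ i * coeff i
        top b = begin
          powerSum j b                                             ≈⟨ powerSum-expand j b ⟩
          ∑ (suc j) g                                              ≡⟨ ≡.cong (λ n → ∑ (suc n) g) (ℕ.+-comm r i) ⟩
          ∑ (suc i ℕ.+ r) g                                        ≈⟨ ∑-split (suc i) r g ⟩
          ∑ (suc i) g + ∑ r (λ t → g (suc i ℕ.+ t))                ≈⟨ +-congˡ (∑-zero r (λ t t<r → trans (*-congˡ (high t t<r)) (zeroʳ _))) ⟩
          ∑ (suc i) g + 0#                                         ≈⟨ +-identityʳ _ ⟩
          ∑ (suc i) g                                              ∎
          where
          g : ℕ → Carrier
          g l = (b × 1#) ^ l * coeff l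
        low-degree : Deg i 0# (λ b → ∑ i (λ l → (b × 1#) ^ l * coeff l))
        low-degree = Deg-cong i (∑-zero i (λ _ _ → refl)) (λ _ → refl)
          (Deg-∑ i i {c = λ _ → 0#} (λ l l<i → Deg-cong i (zeroʳ _) (λ b → *-comm (coeff l) _) (Deg-*ˡ i (coeff l)
            (Deg-raise l<i (proj₂ (proj₂ (HasDegree-monomial l (ℕ.<-≤-trans (ℕ.<-≤-trans l<i (≡.subst (i ℕ.≤_) e (ℕ.m≤m+n i _))) (ℕ.n≤1+n _)))))))))

      module _ (periodic : ∀ n → f (p ℕ.+ n) ≈ f n)
        (vanishing : ∀ j → j ℕ.< m → ∀ b → powerSum j b ≈ 0#)
        (κ : Carrier) (κ≉0 : ¬ κ ≈ 0#) (square : ∀ b → powerSum m b * powerSum m b ≈ κ) where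

        -- For r + i < m the power sum vanishes for all b and can have no degree. For r + i = m its
        -- square would have exact degree 2i, where 0 < 2i ≤ 2m < p, yet the square is constant.
        no-degree≥3 : ∀ t → 3 ℕ.+ t ℕ.≤ m ℕ.+ m → ¬ HasDegree (3 ℕ.+ t) f
        no-degree≥3 t k≤2m F with exponents m t k≤2m
        ... | r , i , e , inj₁ r+i<m = absurd (powerSum-degree (3 ℕ.+ t) r i (s≤s (s≤s z≤n)) e F)
          where
          absurd : ¬ HasDegree i (powerSum (r ℕ.+ i))
          absurd (a , a≉0 , D) = a≉0 (trans (sym (D 0)) (trans (Δ^-cong i (vanishing (r ℕ.+ i) r+i<m) 0) (zeroes i)))
            where
            zeroes : ∀ i → Δ^ i (λ _ → 0#) 0 ≈ 0#
            zeroes zero    = refl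
            zeroes (suc i) = Deg-raise {0} {suc i} {0#} {λ _ → 0#} (s≤s z≤n) (Deg-const 0#) 0
        ... | r , i , e , inj₂ (r+i≡m , 0<i) =
          absurd (≡.subst (λ j → HasDegree i (powerSum j)) r+i≡m (powerSum-degree (3 ℕ.+ t) r i (s≤s (s≤s z≤n)) e F))
          where
          i≤m : i ℕ.≤ m
          i≤m = ≡.subst (i ℕ.≤_) r+i≡m (ℕ.m≤n+m i r)
          absurd : ¬ HasDegree i (powerSum m)
          absurd G with HasDegree-* i i (s≤s (ℕ.+-mono-≤ i≤m i≤m)) G G
          ... | a , a≉0 , D = a≉0 (trans (sym (D 0)) (trans (Δ^-cong (i ℕ.+ i) square 0)
                  (Deg-raise (ℕ.<-≤-trans 0<i (ℕ.m≤m+n i i)) (Deg-const κ) 0)))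

        -- In each degree from p - 1 down to 3 the leading constant is tested for zero: a nonzero
        -- one is excluded by `no-degree≥3`, and a zero one lowers the degree.
        descend : ∀ t → 3 ℕ.+ t ℕ.≤ p → Deg (3 ℕ.+ t) 0# f → Deg 3 0# f
        descend zero    _        D = D
        descend (suc t) (s≤s t≤) D with zero? (Δ^ (3 ℕ.+ t) f 0)
        ... | yes z = descend t (ℕ.m≤n⇒m≤1+n t≤) (Deg-cong (3 ℕ.+ t) z (λ _ → refl) (Deg-lower (3 ℕ.+ t) D))
        ... | no nz = contradiction (_ , nz , Deg-lower (3 ℕ.+ t) D) (no-degree≥3 t t≤)

        0<m : 0 ℕ.< m
        0<m = ℕ.n≢0⇒n>0 (λ m≡0 → ¬prime[1] (≡.subst (λ m → Prime (suc (m ℕ.+ m))) m≡0 pr))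

        degree≤2 : Deg 3 0# f
        degree≤2 = descend (p ℕ.∸ 3) (ℕ.≤-reflexive (ℕ.m+[n∸m]≡n 3≤p))
          (≡.subst (λ k → Deg k 0# f) (≡.sym (ℕ.m+[n∸m]≡n 3≤p)) Deg-p)
          where
          3≤p : 3 ℕ.≤ p
          3≤p = s≤s (ℕ.+-mono-≤ 0<m 0<m)
          -- The descent starts here: Δ^p is the shift by p minus the identity, which kills a
          -- function of period p.
          Deg-p : Deg p 0# f
          Deg-p n = begin
            Δ^ p f n                     ≈⟨ solve 2 (λ a b → b := (a :+ b) :- a) refl (f n) _ ⟩
            f n + Δ^ p f n - f n         ≈⟨ +-congʳ (frobenius pr char f n) ⟨
            f (p ℕ.+ n) - f n            ≈⟨ +-congʳ (periodic n) ⟩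
            f n - f n                    ≈⟨ -‿inverseʳ _ ⟩
            0#                           ∎

        -- Otherwise f^m has degree at most m < p - 1, so the power sum at b = 0 vanishes although
        -- its square is κ.
        degree≰1 : ¬ Deg 2 0# f
        degree≰1 D = κ≉0 (trans (sym (square 0)) (trans (*-congʳ powerSum≈0) (zeroˡ _)))
          where
          Deg-^ : ∀ j {a g} → Deg 1 a g → ∃ λ b → Deg j b (λ n → g n ^ j)
          Deg-^ zero    E = 1# , Deg-const 1#
          Deg-^ (suc j) E = _ , Deg-* 1 j E (proj₂ (Deg-^ j E))
          powerSum≈0 : powerSum m 0 ≈ 0#
          powerSum≈0 = ∑-low-degree (ℕ.m<m+n m 0<m) (proj₂ (Deg-^ m
            (Deg-+ 1 (Deg-*ˡ 1 (0 × 1#) Deg-id) (Deg-lower 1 D))))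

-- Arithmetic of ℤ[ω] modulo powers of π = ω - 1.

module Cyclotomic {c ℓ} (K : CommutativeRing c ℓ) where
  open import Data.Nat.Base as ℕ using (ℕ; zero; suc; s≤s; z≤n)
  open import Data.Nat.Primality using (Prime; euclidsLemma)
  open import Relation.Binary.PropositionalEquality.Core as ≡ using (_≡_; _≢_)
  open FiniteDiff K
  open RingKit K
  open Binomial using (nC0≡1; p∣pCk; p∤1; coefficient)

  import Data.Nat.Properties as ℕ
  open import Data.Nat.Combinatorics using (_C_; nCn≡1; nC1≡n; k>n⇒nCk≡0)
  import Data.Nat.Divisibility as ℕ
  open import Data.Integer.Base as ℤ using (ℤ; +_; ∣_∣)
  import Data.Integer.Properties as ℤ
  open import Data.Integer.Divisibility.Signed using (_∣_; divides; ∣ᵤ⇒∣; ∣⇒∣ᵤ; ∣m∣n⇒∣m+n; ∣m⇒∣m*n; ∣n⇒∣m*n; ∣m∣n⇒∣m-n; ∣-refl; _∣?_)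
  open import Data.Product.Base using (_,_; proj₁; proj₂; ∃) renaming (_×_ to _∧_)
  open import Data.Sum.Base using (_⊎_; inj₁; inj₂)
  open import Relation.Nullary.Decidable.Core using (yes; no)
  open import Relation.Nullary.Negation.Core using (¬_; contradiction)
  open import Relation.Binary.Reasoning.Setoid setoid
  open import Algebra.Properties.CommutativeSemiring.Exp commutativeSemiring using (^-distrib-*)

  prime-∣* : ∀ {p} → Prime p → ∀ i j → + p ∣ i ℤ.* j → (+ p ∣ i) ⊎ (+ p ∣ j)
  prime-∣* pr i j d with euclidsLemma ∣ i ∣ ∣ j ∣ pr (≡.subst (_ ℕ.∣_) (ℤ.abs-* i j) (∣⇒∣ᵤ d))
  ... | inj₁ e = inj₁ (∣ᵤ⇒∣ e)
  ... | inj₂ e = inj₂ (∣ᵤ⇒∣ e)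

  -- Gaussian elimination of v 0 without division: such a matrix is invertible mod p.
  annihilator : ∀ {p} → Prime p → ∀ n (v : ℕ → Carrier) (R : ℕ → ℕ → ℤ) →
    (∀ i → i ℕ.< n → ∑ n (λ j → ι (R i j) * v j) ≈ 0#) →
    (∀ i → i ℕ.< n → ¬ + p ∣ R i i) →
    (∀ i j → i ℕ.< n → j ℕ.< n → i ≢ j → + p ∣ R i j) →
    ∃ λ N → ¬ (+ p ∣ N) ∧ (∀ i → i ℕ.< n → ι N * v i ≈ 0#)
  annihilator pr zero v R rel diag off = + 1 , (λ d → p∤1 pr (∣⇒∣ᵤ d)) , λ _ ()
  annihilator {p} pr (suc n) v R rel diag off = extend (annihilator pr n (λ j → v (suc j)) R' rel' diag' off')
    where
    R' : ℕ → ℕ → ℤ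
    R' i j = R 0 0 ℤ.* R (suc i) (suc j) ℤ.- R (suc i) 0 ℤ.* R 0 (suc j)
    ι-R' : ∀ i j → ι (R' i j) ≈ ι (R 0 0) * ι (R (suc i) (suc j)) - ι (R (suc i) 0) * ι (R 0 (suc j))
    ι-R' i j = trans (ι-+ (R 0 0 ℤ.* R (suc i) (suc j)) _)
      (+-cong (ι-* (R 0 0) _) (trans (ι-neg (R (suc i) 0 ℤ.* R 0 (suc j))) (-‿cong (ι-* (R (suc i) 0) _))))
    rel' : ∀ i → i ℕ.< n → ∑ n (λ j → ι (R' i j) * v (suc j)) ≈ 0#
    rel' i i<n = begin
      ∑ n (λ j → ι (R' i j) * v (suc j))
        ≈⟨ ∑-cong n (λ j _ → trans (*-congʳ (ι-R' i j))
             (solve 5 (λ a b c d x → (a :* b :- c :* d) :* x := a :* (b :* x) :+ (:- c) :* (d :* x)) refl a00 _ ai0 _ _)) ⟩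
      ∑ n (λ j → a00 * (ι (R (suc i) (suc j)) * v (suc j)) + - ai0 * (ι (R 0 (suc j)) * v (suc j)))
        ≈⟨ trans (∑-+ n _ _) (sym (+-cong (∑-*ˡ n a00 _) (∑-*ˡ n (- ai0) _))) ⟩
      a00 * si + - ai0 * s0
        ≈⟨ solve 5 (λ a b s t x → a :* s :+ (:- b) :* t := a :* (b :* x :+ s) :- b :* (a :* x :+ t)) refl a00 ai0 si s0 (v 0) ⟩
      a00 * (ai0 * v 0 + si) - ai0 * (a00 * v 0 + s0)
        ≈⟨ +-cong (*-congˡ (trans (sym (∑-suc n _)) (rel (suc i) (s≤s i<n))))
                  (-‿cong (*-congˡ (trans (sym (∑-suc n _)) (rel 0 (s≤s z≤n))))) ⟩
      a00 * 0# - ai0 * 0#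
        ≈⟨ trans (+-cong (zeroʳ _) (-‿cong (zeroʳ _))) (-‿inverseʳ 0#) ⟩
      0# ∎
      where
      a00 = ι (R 0 0)
      ai0 = ι (R (suc i) 0)
      si = ∑ n (λ j → ι (R (suc i) (suc j)) * v (suc j))
      s0 = ∑ n (λ j → ι (R 0 (suc j)) * v (suc j))
    sub : ∀ i j → i ℕ.< n → j ℕ.< n → + p ∣ R (suc i) 0 ℤ.* R 0 (suc j)
    sub i j i<n j<n = ∣m⇒∣m*n _ (off (suc i) 0 (s≤s i<n) (s≤s z≤n) (λ ()))
    diag' : ∀ i → i ℕ.< n → ¬ + p ∣ R' i i
    diag' i i<n d with prime-∣* pr (R 0 0) (R (suc i) (suc i))
                          (≡.subst (+ p ∣_) (cancel (R 0 0 ℤ.* R (suc i) (suc i)) (R (suc i) 0 ℤ.* R 0 (suc i))) (∣m∣n⇒∣m+n d (sub i i i<n i<n)))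
      where
      cancel : ∀ a b → a ℤ.- b ℤ.+ b ≡ a
      cancel a b = ≡.trans (ℤ.+-assoc a (ℤ.- b) b) (≡.trans (≡.cong (λ z → a ℤ.+ z) (ℤ.+-inverseˡ b)) (ℤ.+-identityʳ a))
    ... | inj₁ e = diag 0 (s≤s z≤n) e
    ... | inj₂ e = diag (suc i) (s≤s i<n) e
    off' : ∀ i j → i ℕ.< n → j ℕ.< n → i ≢ j → + p ∣ R' i j
    off' i j i<n j<n i≢j = ∣m∣n⇒∣m-n (∣n⇒∣m*n (R 0 0) (off (suc i) (suc j) (s≤s i<n) (s≤s j<n) (λ e → i≢j (ℕ.suc-injective e)))) (sub i j i<n j<n)
    extend : (∃ λ N → ¬ (+ p ∣ N) ∧ (∀ i → i ℕ.< n → ι N * v (suc i) ≈ 0#)) →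
      ∃ λ N → ¬ (+ p ∣ N) ∧ (∀ i → i ℕ.< suc n → ι N * v i ≈ 0#)
    -- N collects the pivots, all prime to p. Once N kills the other entries, row 0 shows that N
    -- times its pivot kills v 0.
    extend (N , p∤N , kills) = N ℤ.* R 0 0 , p∤N*R00 , kills'
      where
      p∤N*R00 : ¬ + p ∣ N ℤ.* R 0 0
      p∤N*R00 d with prime-∣* pr N (R 0 0) d
      ... | inj₁ e = p∤N e
      ... | inj₂ e = diag 0 (s≤s z≤n) e
      kills' : ∀ i → i ℕ.< suc n → ι (N ℤ.* R 0 0) * v i ≈ 0#
      kills' (suc i) (s≤s i<n) = begin
        ι (N ℤ.* R 0 0) * v (suc i)        ≈⟨ *-congʳ (ι-* N _) ⟩
        ι N * ι (R 0 0) * v (suc i)        ≈⟨ solve 3 (λ a b x → a :* b :* x := b :* (a :* x)) refl _ _ _ ⟩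
        ι (R 0 0) * (ι N * v (suc i))      ≈⟨ *-congˡ (kills i i<n) ⟩
        ι (R 0 0) * 0#                     ≈⟨ zeroʳ _ ⟩
        0#                                 ∎
      kills' zero _ = begin
        ι (N ℤ.* R 0 0) * v 0              ≈⟨ *-congʳ (ι-* N _) ⟩
        ι N * ι (R 0 0) * v 0              ≈⟨ solve 4 (λ a b x s → a :* b :* x := a :* (b :* x :+ s) :- a :* s) refl _ _ _ s ⟩
        ι N * (ι (R 0 0) * v 0 + s) - ι N * s
          ≈⟨ +-cong (*-congˡ (trans (sym (∑-suc n _)) (rel 0 (s≤s z≤n)))) (-‿cong (trans (∑-*ˡ n (ι N) _) (∑-zero n killed))) ⟩
        ι N * 0# - 0#                      ≈⟨ trans (+-congʳ (zeroʳ _)) (-‿inverseʳ 0#) ⟩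
        0#                                 ∎
        where
        s = ∑ n (λ j → ι (R 0 (suc j)) * v (suc j))
        killed : ∀ j → j ℕ.< n → ι N * (ι (R 0 (suc j)) * v (suc j)) ≈ 0#
        killed j j<n = begin
          ι N * (ι (R 0 (suc j)) * v (suc j))  ≈⟨ solve 3 (λ a b x → a :* (b :* x) := b :* (a :* x)) refl _ _ _ ⟩
          ι (R 0 (suc j)) * (ι N * v (suc j))  ≈⟨ *-congˡ (kills j j<n) ⟩
          ι (R 0 (suc j)) * 0#                 ≈⟨ zeroʳ _ ⟩
          0#                                   ∎

  -- The binomial theorem for powers of θ = 1 + τ, obtained from `newton` since Δ multiplies the
  -- sequence θ^n by τ. Appending k zero terms lets the sum be cut at k without comparing k with g.
  -- The remainder has natural coefficients, so it stays in ℤ[ω] whenever θ does.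
  binomial-expansion : ∀ θ g k → ∃ λ d → θ ^ g ≈ ∑ k (λ i → (g C i) × (θ - 1#) ^ i) + (θ - 1#) ^ k * ∑ (suc g) (λ i → d i × (θ - 1#) ^ i)
  binomial-expansion θ g k = (λ i → g C (k ℕ.+ i)) , (begin
    θ ^ g                                                       ≡⟨ ≡.cong (θ ^_) (ℕ.+-identityʳ g) ⟨
    θ ^ (g ℕ.+ 0)                                               ≈⟨ newton g (θ ^_) 0 ⟩
    ∑ (suc g) (λ i → (g C i) × Δ^ i (θ ^_) 0)                   ≈⟨ ∑-cong (suc g) (λ i _ → ×-congʳ (g C i) (trans (differences i 0) (*-identityʳ _))) ⟩
    ∑ (suc g) F                                                 ≈⟨ +-identityʳ _ ⟨
    ∑ (suc g) F + 0#                                            ≈⟨ +-congˡ (∑-zero k (λ i _ → ×-congˡ (k>n⇒nCk≡0 (s≤s (ℕ.m≤m+n g i))))) ⟨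
    ∑ (suc g) F + ∑ k (λ i → F (suc g ℕ.+ i))                   ≈⟨ ∑-split (suc g) k F ⟨
    ∑ (suc g ℕ.+ k) F                                           ≡⟨ ≡.cong (λ n → ∑ n F) (ℕ.+-comm (suc g) k) ⟩
    ∑ (k ℕ.+ suc g) F                                           ≈⟨ ∑-split k (suc g) F ⟩
    ∑ k F + ∑ (suc g) (λ i → F (k ℕ.+ i))                       ≈⟨ +-congˡ (trans (∑-cong (suc g) factor) (sym (∑-*ˡ (suc g) _ _))) ⟩
    ∑ k F + τ ^ k * ∑ (suc g) (λ i → (g C (k ℕ.+ i)) × τ ^ i)   ∎)
    where
    τ = θ - 1#
    F : ℕ → Carrier
    F i = (g C i) × τ ^ i
    differences : ∀ i n → Δ^ i (θ ^_) n ≈ τ ^ i * θ ^ n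
    differences zero    n = sym (*-identityˡ _)
    differences (suc i) n = begin
      Δ^ i (Δ (θ ^_)) n             ≈⟨ Δ^-cong i (λ j → trans (+-congˡ (-‿cong (sym (*-identityˡ _)))) (sym ([y-z]x≈yx-zx _ _ _))) n ⟩
      Δ^ i (λ j → τ * θ ^ j) n      ≈⟨ Δ^-*ˡ i τ (θ ^_) n ⟩
      τ * Δ^ i (θ ^_) n             ≈⟨ *-congˡ (differences i n) ⟩
      τ * (τ ^ i * θ ^ n)           ≈⟨ *-assoc _ _ _ ⟨
      τ ^ suc i * θ ^ n             ∎
    factor : ∀ i → i ℕ.< suc g → F (k ℕ.+ i) ≈ τ ^ k * ((g C (k ℕ.+ i)) × τ ^ i)
    factor i _ = trans (×-congʳ (g C (k ℕ.+ i)) (^-homo-* τ k i)) (sym (×-comm-* (g C (k ℕ.+ i)) _ _))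

  module CyclotomicIntegers (n : ℕ) (pr : Prime (2 ℕ.+ n)) (ω : Carrier) (ω^p≈1 : ω ^ (2 ℕ.+ n) ≈ 1#)
    (cancel : ∀ z → (ω - 1#) * z ≈ 0# → z ≈ 0#) (char0 : ∀ k → k × 1# ≈ 0# → k ≡ 0) where

    p = 2 ℕ.+ n
    π = ω - 1#

    ℤ[ω] : Carrier → Set _
    ℤ[ω] z = ∃ λ (a : ℕ → ℤ) → z ≈ ∑ p (λ i → ι (a i) * ω ^ i)

    ℤ[ω]-resp : ∀ {x y} → x ≈ y → ℤ[ω] x → ℤ[ω] y
    ℤ[ω]-resp e (a , h) = a , trans (sym e) h

    ℤ[ω]-+ : ∀ {x y} → ℤ[ω] x → ℤ[ω] y → ℤ[ω] (x + y)
    ℤ[ω]-+ (a , g) (b , h) = (λ i → a i ℤ.+ b i) , trans (+-cong g h) (trans (sym (∑-+ p _ _))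
      (∑-cong p (λ i _ → trans (sym (distribʳ _ _ _)) (*-congʳ (sym (ι-+ (a i) (b i)))))))

    ℤ[ω]-ι* : ∀ k {x} → ℤ[ω] x → ℤ[ω] (ι k * x)
    ℤ[ω]-ι* k (a , g) = (λ i → k ℤ.* a i) , trans (*-congˡ g) (trans (∑-*ˡ p _ _)
      (∑-cong p (λ i _ → trans (sym (*-assoc _ _ _)) (*-congʳ (sym (ι-* k (a i)))))))

    ℤ[ω]-0 : ℤ[ω] 0#
    ℤ[ω]-0 = (λ _ → + 0) , sym (∑-zero p (λ i _ → zeroˡ _))

    ℤ[ω]-ω* : ∀ {x} → ℤ[ω] x → ℤ[ω] (ω * x)
    ℤ[ω]-ω* {x} (a , g) = a' , (begin
      ω * x                                                             ≈⟨ *-congˡ g ⟩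
      ω * ∑ p (λ i → ι (a i) * ω ^ i)                                   ≈⟨ ∑-*ˡ p ω _ ⟩
      ∑ p (λ i → ω * (ι (a i) * ω ^ i))                                 ≈⟨ ∑-cong p (λ i _ → solve 3 (λ w a x → w :* (a :* x) := a :* (w :* x)) refl ω _ _) ⟩
      ∑ (suc n) (λ i → ι (a i) * ω ^ suc i) + ι (a (suc n)) * ω ^ p     ≈⟨ +-comm _ _ ⟩
      ι (a (suc n)) * ω ^ p + ∑ (suc n) (λ i → ι (a i) * ω ^ suc i)     ≈⟨ +-congʳ (*-congˡ ω^p≈1) ⟩
      ι (a (suc n)) * 1# + ∑ (suc n) (λ i → ι (a i) * ω ^ suc i)        ≈⟨ ∑-suc (suc n) _ ⟨
      ∑ p (λ i → ι (a' i) * ω ^ i)                                      ∎)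
      where
      a' : ℕ → ℤ
      a' zero    = a (suc n)
      a' (suc i) = a i

    ℤ[ω]-ω^* : ∀ i {x} → ℤ[ω] x → ℤ[ω] (ω ^ i * x)
    ℤ[ω]-ω^* zero    h = ℤ[ω]-resp (sym (*-identityˡ _)) h
    ℤ[ω]-ω^* (suc i) h = ℤ[ω]-resp (sym (*-assoc _ _ _)) (ℤ[ω]-ω* (ℤ[ω]-ω^* i h))

    ℤ[ω]-∑ : ∀ k {f} → (∀ i → ℤ[ω] (f i)) → ℤ[ω] (∑ k f)
    ℤ[ω]-∑ zero    h = ℤ[ω]-0
    ℤ[ω]-∑ (suc k) h = ℤ[ω]-+ (ℤ[ω]-∑ k h) (h k)

    ℤ[ω]-* : ∀ {x y} → ℤ[ω] x → ℤ[ω] y → ℤ[ω] (x * y)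
    ℤ[ω]-* {x} {y} (a , g) h = ℤ[ω]-resp (sym (trans (*-congʳ g) (∑-*ʳ p y _)))
      (ℤ[ω]-∑ p (λ i → ℤ[ω]-resp (sym (*-assoc (ι (a i)) (ω ^ i) y)) (ℤ[ω]-ι* (a i) (ℤ[ω]-ω^* i h))))

    ℤ[ω]-1 : ℤ[ω] 1#
    ℤ[ω]-1 = δ , sym (trans (∑-suc (suc n) _) (trans (+-cong (trans (*-identityʳ _) (+-identityʳ 1#)) (∑-zero (suc n) (λ i _ → zeroˡ _))) (+-identityʳ 1#)))
      where
      δ : ℕ → ℤ
      δ zero    = + 1
      δ (suc i) = + 0

    ℤ[ω]-ω : ℤ[ω] ω
    ℤ[ω]-ω = ℤ[ω]-resp (*-identityʳ ω) (ℤ[ω]-ω* ℤ[ω]-1)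

    ℤ[ω]-ι : ∀ k → ℤ[ω] (ι k)
    ℤ[ω]-ι k = ℤ[ω]-resp (*-identityʳ _) (ℤ[ω]-ι* k ℤ[ω]-1)

    ℤ[ω]-neg : ∀ {x} → ℤ[ω] x → ℤ[ω] (- x)
    ℤ[ω]-neg {x} h = ℤ[ω]-resp (trans (*-congʳ (-‿cong (+-identityʳ 1#))) (trans (sym (-‿distribˡ-* 1# x)) (-‿cong (*-identityˡ x)))) (ℤ[ω]-ι* (ℤ.-[1+ 0 ]) h)

    ℤ[ω]-^ : ∀ k {x} → ℤ[ω] x → ℤ[ω] (x ^ k)
    ℤ[ω]-^ zero    h = ℤ[ω]-1
    ℤ[ω]-^ (suc k) h = ℤ[ω]-* h (ℤ[ω]-^ k h)

    ℤ[ω]-× : ∀ k {x} → ℤ[ω] x → ℤ[ω] (k × x)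
    ℤ[ω]-× k h = ℤ[ω]-resp (sym (×≈×1* k _)) (ℤ[ω]-ι* (+ k) h)

    ℤ[ω]-π : ℤ[ω] π
    ℤ[ω]-π = ℤ[ω]-+ ℤ[ω]-ω (ℤ[ω]-neg ℤ[ω]-1)

    cancel^ : ∀ k {x y} → π ^ k * x ≈ π ^ k * y → x ≈ y
    cancel^ k {x} {y} e = trans (sym (solve 2 (λ x y → (x :- y) :+ y := x) refl x y)) (trans (+-congʳ (go k (x - y)
      (trans (x[y-z]≈xy-xz _ x y) (trans (+-congʳ e) (-‿inverseʳ _))))) (+-identityˡ y))
      where
      go : ∀ k z → π ^ k * z ≈ 0# → z ≈ 0#
      go zero    z e = trans (sym (*-identityˡ z)) e
      go (suc k) z e = go k z (cancel _ (trans (sym (*-assoc _ _ _)) e))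

    -- Eisenstein's criterion for Φ_p(1 + t) in terms of its root π.
    eisenstein : ∃ λ s → ℤ[ω] s ∧ (π ^ suc n ≈ - ((p × 1#) * (1# + π * s)))
    eisenstein = s , ℤ[ω]-∑ n (λ i → ℤ[ω]-× (q i) (ℤ[ω]-^ i ℤ[ω]-π)) , (begin
      π ^ suc n                                                ≈⟨ solve 2 (λ a b → a := (b :+ a) :- b) refl _ (∑ (suc n) G) ⟩
      (∑ (suc n) G + π ^ suc n) - ∑ (suc n) G                  ≈⟨ +-congʳ vanish ⟩
      0# - ∑ (suc n) G                                         ≈⟨ +-identityˡ _ ⟩
      - ∑ (suc n) G                                            ≈⟨ -‿cong (trans (∑-suc n G) (+-cong first rest)) ⟩
      - (p × 1# + (p × 1#) * (π * s))                          ≈⟨ -‿cong (trans (+-congʳ (sym (*-identityʳ _))) (sym (distribˡ _ _ _))) ⟩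
      - ((p × 1#) * (1# + π * s))                              ∎)
      where
      -- ω^p - 1 = π (∑ G + π^(p - 1)), and π cancels. Every coefficient of G is divisible by p, and
      -- the constant one is p itself.
      G : ℕ → Carrier
      G i = (p C suc i) × π ^ i
      -- The quotients C(p, i + 2) / p. The value 0 for i ≥ n only makes q total, since the sum for
      -- s stops before n.
      q : ℕ → ℕ
      q i with i ℕ.<? n
      ... | yes i<n = ℕ.quotient (p∣pCk pr (s≤s (z≤n {suc i})) (s≤s (s≤s i<n)))
      ... | no _ = 0
      q-correct : ∀ i → i ℕ.< n → p C (2 ℕ.+ i) ≡ p ℕ.* q i
      q-correct i i<n with i ℕ.<? n
      ... | yes i<n = ≡.trans (ℕ._∣_.equality (p∣pCk pr (s≤s (z≤n {suc i})) (s≤s (s≤s i<n)))) (ℕ.*-comm (ℕ.quotient (p∣pCk pr (s≤s (z≤n {suc i})) (s≤s (s≤s i<n)))) p)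
      ... | no i≮n = contradiction i<n i≮n
      s = ∑ n (λ i → q i × π ^ i)
      expansion : 1# ≈ 1# + π * (∑ (suc n) G + π ^ suc n)
      expansion = begin
        1#                                                       ≈⟨ ω^p≈1 ⟨
        ω ^ p                                                    ≈⟨ proj₂ (binomial-expansion ω p 0) ⟩
        0# + 1# * ∑ (suc p) (λ i → (p C i) × π ^ i)              ≈⟨ trans (+-identityˡ _) (*-identityˡ _) ⟩
        ∑ p (λ i → (p C i) × π ^ i) + (p C p) × π ^ p            ≈⟨ +-cong (∑-suc (suc n) _) (trans (×-congˡ (nCn≡1 p)) (×-homo-1 _)) ⟩
        (p C 0) × 1# + ∑ (suc n) (λ i → (p C suc i) × π ^ suc i) + π ^ p
          ≈⟨ trans (+-assoc _ _ _) (+-cong (trans (×-congˡ (nC0≡1 p)) (×-homo-1 1#)) (+-congʳ (trans (∑-cong (suc n) (λ i _ → sym (×-comm-* (p C suc i) _ _))) (sym (∑-*ˡ (suc n) π G))))) ⟩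
        1# + (π * ∑ (suc n) G + π ^ p)                           ≈⟨ +-congˡ (distribˡ _ _ _) ⟨
        1# + π * (∑ (suc n) G + π ^ suc n)                       ∎
      vanish : ∑ (suc n) G + π ^ suc n ≈ 0#
      vanish = cancel _ (trans (solve 2 (λ u x → x := (u :+ x) :- u) refl 1# _) (trans (+-congʳ (sym expansion)) (-‿inverseʳ 1#)))
      first : G 0 ≈ p × 1#
      first = ×-congˡ (nC1≡n p)
      rest : ∑ n (λ i → G (suc i)) ≈ (p × 1#) * (π * s)
      rest = begin
        ∑ n (λ i → G (suc i))                      ≈⟨ ∑-cong n (λ i i<n → trans (×-congˡ (q-correct i i<n)) (trans (sym (×-assocˡ _ p (q i))) (trans (×≈×1* p _) (*-congˡ (sym (×-comm-* (q i) _ _)))))) ⟩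
        ∑ n (λ i → (p × 1#) * (π * (q i × π ^ i)))  ≈⟨ trans (sym (∑-*ˡ n _ _)) (*-congˡ (sym (∑-*ˡ n π _))) ⟩
        (p × 1#) * (π * s)                         ∎

    -- Rather than inverting 1 + π s, the relation is read as p = - π^(p - 1) - p π s. Substituting
    -- p = π^k y on the right gains one factor π, as long as k + 1 ≤ p - 1.
    p∈π^k : ∀ k → k ℕ.≤ suc n → ∃ λ y → ℤ[ω] y ∧ (p × 1# ≈ π ^ k * y)
    p∈π^k zero    _         = p × 1# , ℤ[ω]-ι (+ p) , sym (*-identityˡ _)
    p∈π^k (suc k) k<n = step (p∈π^k k (ℕ.<⇒≤ k<n)) eisenstein
      where
      r = suc n ℕ.∸ suc k
      step : (∃ λ y → ℤ[ω] y ∧ (p × 1# ≈ π ^ k * y)) → (∃ λ s → ℤ[ω] s ∧ (π ^ suc n ≈ - ((p × 1#) * (1# + π * s)))) →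
        ∃ λ y → ℤ[ω] y ∧ (p × 1# ≈ π ^ suc k * y)
      step (y , Ay , e) (s , As , h) = - (s * y + π ^ r) , ℤ[ω]-neg (ℤ[ω]-+ (ℤ[ω]-* As Ay) (ℤ[ω]-^ r ℤ[ω]-π)) , (begin
        p × 1#                                              ≈⟨ solve 2 (λ P t → P := (:- (P :* t)) :- (:- (P :* (con (+ 1) :+ t)))) refl (p × 1#) (π * s) ⟩
        - ((p × 1#) * (π * s)) - - ((p × 1#) * (ι (+ 1) + π * s))
                                                            ≈⟨ +-congˡ (-‿cong (trans (-‿cong (*-congˡ (+-congʳ (+-identityʳ 1#)))) (sym h))) ⟩
        - ((p × 1#) * (π * s)) - π ^ suc n                  ≈⟨ +-cong (-‿cong (*-congʳ e)) (-‿cong (trans (reflexive (≡.cong (π ^_) (≡.sym (ℕ.m+[n∸m]≡n k<n)))) (^-homo-* π (suc k) r))) ⟩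
        - ((π ^ k * y) * (π * s)) - π ^ suc k * π ^ r       ≈⟨ solve 5 (λ P y t s Q → (:- ((P :* y) :* (t :* s))) :- (t :* P) :* Q := (t :* P) :* (:- (s :* y :+ Q))) refl (π ^ k) y π s (π ^ r) ⟩
        π ^ suc k * - (s * y + π ^ r)                       ∎)

    δ : ℕ → ℕ → ℤ
    δ i j with i ℕ.≟ j
    ... | yes _ = + 1
    ... | no _  = + 0

    δ-refl : ∀ i → δ i i ≡ + 1
    δ-refl i with i ℕ.≟ i
    ... | yes _ = ≡.refl
    ... | no i≢i = contradiction ≡.refl i≢i

    δ-≢ : ∀ i j → i ≢ j → δ i j ≡ + 0
    δ-≢ i j i≢j with i ℕ.≟ j
    ... | yes i≡j = contradiction i≡j i≢j
    ... | no _ = ≡.refl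

    ∑-δ : ∀ k i (x : ℕ → Carrier) → i ℕ.< k → ∑ k (λ j → ι (δ i j) * x j) ≈ x i
    ∑-δ (suc k) i x (s≤s i≤k) with ℕ.m≤n⇒m<n∨m≡n i≤k
    ... | inj₁ i<k = trans (+-cong (∑-δ k i x i<k) (trans (*-congʳ (reflexive (≡.cong ι (δ-≢ i k (ℕ.<⇒≢ i<k))))) (zeroˡ _))) (+-identityʳ _)
    ... | inj₂ ≡.refl = trans (+-cong (∑-zero k (λ j j<k → trans (*-congʳ (reflexive (≡.cong ι (δ-≢ k j (λ e → ℕ.<⇒≢ j<k (≡.sym e)))))) (zeroˡ _)))
                                     (trans (*-congʳ (trans (reflexive (≡.cong ι (δ-refl k))) (+-identityʳ 1#))) (*-identityˡ _))) (+-identityˡ _)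

    ι-injective : ∀ N → ι N ≈ 0# → N ≡ + 0
    ι-injective (+ k)      e = ≡.cong +_ (char0 k e)
    ι-injective ℤ.-[1+ k ] e = contradiction (char0 (suc k) (trans (sym (-‿involutive _)) (trans (-‿cong e) -0#≈0#))) λ ()

    -- p is not invertible in ℤ[ω]: Nakayama's lemma for the generators 1, ω, …, ω^(p−1).
    p∣⇐∈pℤ[ω] : ∀ u w → ℤ[ω] w → ι u ≈ (p × 1#) * w → + p ∣ u
    p∣⇐∈pℤ[ω] u w Aw e with + p ∣? u
    ... | yes d = d
    ... | no p∤u = conclude (annihilator pr p (ω ^_) R rel diag off)
      where
      H : ℕ → ℕ → ℤ
      H i = proj₁ (ℤ[ω]-ω^* i Aw)
      -- H is a matrix of multiplication by w on the generators, so u - p H kills the vector of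
      -- powers of ω because u = p w. Modulo p it is the scalar u, and `annihilator` applies when p
      -- does not divide u. The resulting N kills ω^0 = 1, hence is 0, although p does not divide
      -- it.
      R : ℕ → ℕ → ℤ
      R i j = u ℤ.* δ i j ℤ.- + p ℤ.* H i j
      ι-R : ∀ i j → ι (R i j) ≈ ι u * ι (δ i j) - (p × 1#) * ι (H i j)
      ι-R i j = trans (ι-+ (u ℤ.* δ i j) _) (+-cong (ι-* u (δ i j)) (trans (ι-neg (+ p ℤ.* H i j)) (-‿cong (ι-* (+ p) (H i j)))))
      rel : ∀ i → i ℕ.< p → ∑ p (λ j → ι (R i j) * ω ^ j) ≈ 0#
      rel i i<p = begin
        ∑ p (λ j → ι (R i j) * ω ^ j)
          ≈⟨ ∑-cong p (λ j _ → trans (*-congʳ (ι-R i j)) (solve 5 (λ a b c d x → (a :* b :- c :* d) :* x := a :* (b :* x) :+ (:- c) :* (d :* x)) refl _ _ _ _ _)) ⟩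
        ∑ p (λ j → ι u * (ι (δ i j) * ω ^ j) + - (p × 1#) * (ι (H i j) * ω ^ j))
          ≈⟨ trans (∑-+ p _ _) (+-cong (sym (∑-*ˡ p _ _)) (sym (∑-*ˡ p _ _))) ⟩
        ι u * ∑ p (λ j → ι (δ i j) * ω ^ j) + - (p × 1#) * ∑ p (λ j → ι (H i j) * ω ^ j)
          ≈⟨ +-cong (*-cong e (∑-δ p i (ω ^_) i<p)) (*-congˡ (sym (proj₂ (ℤ[ω]-ω^* i Aw)))) ⟩
        (p × 1#) * w * ω ^ i + - (p × 1#) * (ω ^ i * w)
          ≈⟨ solve 3 (λ P w x → P :* w :* x :+ (:- P) :* (x :* w) := con (+ 0)) refl _ _ _ ⟩
        0# ∎
      p∣pH : ∀ i j → + p ∣ + p ℤ.* H i j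
      p∣pH i j = ∣m⇒∣m*n (H i j) ∣-refl
      diag : ∀ i → i ℕ.< p → ¬ + p ∣ R i i
      diag i _ d = p∤u (≡.subst (+ p ∣_) (≡.trans (cancel-sub (u ℤ.* δ i i) (+ p ℤ.* H i i)) (≡.trans (≡.cong (λ z → u ℤ.* z) (δ-refl i)) (ℤ.*-identityʳ u))) (∣m∣n⇒∣m+n d (p∣pH i i)))
        where
        cancel-sub : ∀ a b → a ℤ.- b ℤ.+ b ≡ a
        cancel-sub a b = ≡.trans (ℤ.+-assoc a (ℤ.- b) b) (≡.trans (≡.cong (λ z → a ℤ.+ z) (ℤ.+-inverseˡ b)) (ℤ.+-identityʳ a))
      off : ∀ i j → i ℕ.< p → j ℕ.< p → i ≢ j → + p ∣ R i j
      off i j _ _ i≢j = ∣m∣n⇒∣m-n (≡.subst (+ p ∣_) (≡.sym (≡.trans (≡.cong (λ z → u ℤ.* z) (δ-≢ i j i≢j)) (ℤ.*-zeroʳ u))) (divides (+ 0) ≡.refl)) (p∣pH i j)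
      conclude : (∃ λ N → ¬ (+ p ∣ N) ∧ (∀ i → i ℕ.< p → ι N * ω ^ i ≈ 0#)) → + p ∣ u
      conclude (N , p∤N , kills) = contradiction (≡.subst (+ p ∣_) (≡.sym (ι-injective N (trans (sym (*-identityʳ _)) (kills 0 (s≤s z≤n))))) (divides (+ 0) ≡.refl)) p∤N

    -- Raising u = π z to the power p - 1 moves it into p ℤ[ω] by `eisenstein`, and p is prime. All
    -- comparisons of leading terms modulo π end in this lemma.
    p∣⇐∈πℤ[ω] : ∀ u z → ℤ[ω] z → ι u ≈ π * z → + p ∣ u
    p∣⇐∈πℤ[ω] u z Az e = root (suc n) (p∣⇐∈pℤ[ω] (u ℤ.^ suc n) (- (1# + π * s) * z ^ suc n)
        (ℤ[ω]-* (ℤ[ω]-neg (ℤ[ω]-+ ℤ[ω]-1 (ℤ[ω]-* ℤ[ω]-π As))) (ℤ[ω]-^ (suc n) Az)) (begin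
      ι (u ℤ.^ suc n)                             ≈⟨ ι-^ u (suc n) ⟩
      ι u ^ suc n                                 ≈⟨ ^-congˡ (suc n) e ⟩
      (π * z) ^ suc n                             ≈⟨ ^-distrib-* π z (suc n) ⟩
      π ^ suc n * z ^ suc n                       ≈⟨ *-congʳ h ⟩
      - ((p × 1#) * (1# + π * s)) * z ^ suc n     ≈⟨ solve 3 (λ P t z → (:- (P :* t)) :* z := P :* ((:- t) :* z)) refl _ _ _ ⟩
      (p × 1#) * (- (1# + π * s) * z ^ suc n)     ∎))
      where
      s = proj₁ eisenstein
      As = proj₁ (proj₂ eisenstein)
      h = proj₂ (proj₂ eisenstein)
      ι-^ : ∀ u k → ι (u ℤ.^ k) ≈ ι u ^ k
      ι-^ u zero    = +-identityʳ 1#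
      ι-^ u (suc k) = trans (ι-* u (u ℤ.^ k)) (*-congˡ (ι-^ u k))
      root : ∀ k → + p ∣ u ℤ.^ k → + p ∣ u
      root zero    d = contradiction (∣⇒∣ᵤ d) (p∤1 pr)
      root (suc k) d with prime-∣* pr u (u ℤ.^ k) d
      ... | inj₁ e = e
      ... | inj₂ e = root k e

    -- The coefficients below k are multiples of p, hence of (θ - 1)^(k + 1), and are absorbed into
    -- the terms beyond order k. Both ω and ω̄ are to be inserted for θ.
    leading-term : ∀ θ → ℤ[ω] θ → ∀ N g k → (∀ i → i ℕ.< k → p ℕ.∣ coefficient N g i) →
      (∃ λ w → ℤ[ω] w ∧ (p × 1# ≈ (θ - 1#) ^ suc k * w)) →
      ∃ λ y → ℤ[ω] y ∧ (∑ N (λ x → θ ^ g x) ≈ (θ - 1#) ^ k * (coefficient N g k × 1# + (θ - 1#) * y))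
    leading-term θ Aθ N g k p∣c (w , Aw , e) = y , Ay , (begin
      ∑ N (λ x → θ ^ g x)
        ≈⟨ ∑-cong N (λ x _ → proj₂ (binomial-expansion θ (g x) (suc k))) ⟩
      ∑ N (λ x → ∑ (suc k) (λ i → (g x C i) × τ ^ i) + τ ^ suc k * rem x)
        ≈⟨ trans (∑-+ N _ _) (+-cong (∑-comm N (suc k) _) (sym (∑-*ˡ N _ _))) ⟩
      ∑ (suc k) (λ i → ∑ N (λ x → (g x C i) × τ ^ i)) + τ ^ suc k * ∑ N rem
        ≈⟨ +-congʳ (+-cong (∑-cong k (λ i i<k → trans (sym (∑ℕ-× N (λ x → g x C i) (τ ^ i))) (divisible i i<k))) (trans (sym (∑ℕ-× N (λ x → g x C k) (τ ^ k))) (×≈×1* (coefficient N g k) _))) ⟩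
      ∑ k (λ i → τ ^ suc k * r i) + (coefficient N g k × 1#) * τ ^ k + τ ^ suc k * ∑ N rem
        ≈⟨ +-congʳ (+-congʳ (sym (∑-*ˡ k _ r))) ⟩
      τ * τ ^ k * ∑ k r + (coefficient N g k × 1#) * τ ^ k + τ * τ ^ k * ∑ N rem
        ≈⟨ solve 5 (λ t T r c s → t :* T :* r :+ c :* T :+ t :* T :* s := T :* (c :+ t :* (r :+ s))) refl τ (τ ^ k) (∑ k r) _ (∑ N rem) ⟩
      τ ^ k * (coefficient N g k × 1# + τ * y) ∎)
      where
      τ = θ - 1#
      Aτ : ℤ[ω] τ
      Aτ = ℤ[ω]-+ Aθ (ℤ[ω]-neg ℤ[ω]-1)
      rem : ℕ → Carrier
      rem x = ∑ (suc (g x)) (λ i → proj₁ (binomial-expansion θ (g x) (suc k)) i × τ ^ i)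
      q : ℕ → ℕ
      q i with i ℕ.<? k
      ... | yes i<k = ℕ.quotient (p∣c i i<k)
      ... | no _ = 0
      q-correct : ∀ i → i ℕ.< k → coefficient N g i ≡ p ℕ.* q i
      q-correct i i<k with i ℕ.<? k
      ... | yes i<k = ≡.trans (ℕ._∣_.equality (p∣c i i<k)) (ℕ.*-comm (ℕ.quotient (p∣c i i<k)) p)
      ... | no i≮k = contradiction i<k i≮k
      r : ℕ → Carrier
      r i = w * (q i × τ ^ i)
      divisible : ∀ i → i ℕ.< k → coefficient N g i × τ ^ i ≈ τ ^ suc k * r i
      divisible i i<k = begin
        coefficient N g i × τ ^ i         ≡⟨ ≡.cong (_× τ ^ i) (q-correct i i<k) ⟩
        (p ℕ.* q i) × τ ^ i               ≈⟨ ×-assocˡ (τ ^ i) p (q i) ⟨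
        p × (q i × τ ^ i)                 ≈⟨ ×≈×1* p _ ⟩
        (p × 1#) * (q i × τ ^ i)          ≈⟨ trans (*-congʳ e) (*-assoc _ _ _) ⟩
        τ ^ suc k * r i                   ∎
      y = ∑ k r + ∑ N rem
      Ay : ℤ[ω] y
      Ay = ℤ[ω]-+ (ℤ[ω]-∑ k (λ i → ℤ[ω]-* Aw (ℤ[ω]-× (q i) (ℤ[ω]-^ i Aτ)))) (ℤ[ω]-∑ N (λ x → ℤ[ω]-∑ (suc (g x)) (λ i → ℤ[ω]-× (proj₁ (binomial-expansion θ (g x) (suc k)) i) (ℤ[ω]-^ i Aτ))))

    module Norm (ω̄ : Carrier) (Aω̄ : ℤ[ω] ω̄) (ωω̄≈1 : ω * ω̄ ≈ 1#) (N : ℕ) where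

      coeff : (ℕ → ℕ) → ℕ → ℕ
      coeff = coefficient N

      norm : (ℕ → ℕ) → Carrier
      norm g = ∑ N (λ x → ω ^ g x) * ∑ N (λ x → ω̄ ^ g x)

      π≈-ωπ̄ : π ≈ - ω * (ω̄ - 1#)
      π≈-ωπ̄ = begin
        ω - 1#                       ≈⟨ +-cong (sym (*-identityʳ ω)) (-‿cong (sym ωω̄≈1)) ⟩
        ω * 1# - ω * ω̄               ≈⟨ solve 3 (λ w v u → w :* u :- w :* v := (:- w) :* (v :- u)) refl ω ω̄ 1# ⟩
        - ω * (ω̄ - 1#)               ∎

      π̄≈-ω̄π : ω̄ - 1# ≈ - ω̄ * π
      π̄≈-ω̄π = begin
        ω̄ - 1#                       ≈⟨ +-cong (sym (*-identityʳ ω̄)) (-‿cong (sym ωω̄≈1)) ⟩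
        ω̄ * 1# - ω * ω̄               ≈⟨ solve 3 (λ w v u → v :* u :- w :* v := (:- v) :* (w :- u)) refl ω ω̄ 1# ⟩
        - ω̄ * (ω - 1#)               ∎

      unit^ : ∀ k → (- ω) ^ k * (- ω̄) ^ k ≈ 1#
      unit^ k = trans (sym (^-distrib-* (- ω) (- ω̄) k)) (trans (^-congˡ k (trans (solve 2 (λ a b → (:- a) :* (:- b) := a :* b) refl ω ω̄) ωω̄≈1)) (1^k k))
        where
        1^k : ∀ k → 1# ^ k ≈ 1#
        1^k zero    = refl
        1^k (suc k) = trans (*-identityˡ _) (1^k k)

      -- The two sums have the same coefficient at order k, whence the square. Writing ω̄ - 1 = - ω̄
      -- π turns the product into a power of π, at the price of the unit (- ω̄)^k.
      norm-leading : ∀ g k → k ℕ.≤ n → (∀ i → i ℕ.< k → p ℕ.∣ coeff g i) →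
        ∃ λ z → ℤ[ω] z ∧ (norm g ≈ π ^ (k ℕ.+ k) * ((- ω̄) ^ k * (ι (+ coeff g k ℤ.* + coeff g k) + π * z)))
      norm-leading g k k≤n p∣c = combine (leading-term ω ℤ[ω]-ω N g k p∣c (w , Aw , e))
        (leading-term ω̄ Aω̄ N g k p∣c ((- ω) ^ suc k * w , ℤ[ω]-* (ℤ[ω]-^ (suc k) (ℤ[ω]-neg ℤ[ω]-ω)) Aw , e'))
        where
        w = proj₁ (p∈π^k (suc k) (s≤s k≤n))
        Aw = proj₁ (proj₂ (p∈π^k (suc k) (s≤s k≤n)))
        e = proj₂ (proj₂ (p∈π^k (suc k) (s≤s k≤n)))
        κ = coeff g k × 1#
        ℤ[ω]-κ : ℤ[ω] κ
        ℤ[ω]-κ = ℤ[ω]-ι (+ coeff g k)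
        e' : p × 1# ≈ (ω̄ - 1#) ^ suc k * ((- ω) ^ suc k * w)
        e' = begin
          p × 1#                                       ≈⟨ e ⟩
          π ^ suc k * w                                ≈⟨ *-congʳ (^-congˡ (suc k) π≈-ωπ̄) ⟩
          (- ω * (ω̄ - 1#)) ^ suc k * w                 ≈⟨ *-congʳ (^-distrib-* (- ω) (ω̄ - 1#) (suc k)) ⟩
          (- ω) ^ suc k * (ω̄ - 1#) ^ suc k * w         ≈⟨ trans (*-congʳ (*-comm _ _)) (*-assoc _ _ _) ⟩
          (ω̄ - 1#) ^ suc k * ((- ω) ^ suc k * w)       ∎
        combine : (∃ λ y → ℤ[ω] y ∧ (∑ N (λ x → ω ^ g x) ≈ π ^ k * (κ + π * y))) →
          (∃ λ y → ℤ[ω] y ∧ (∑ N (λ x → ω̄ ^ g x) ≈ (ω̄ - 1#) ^ k * (κ + (ω̄ - 1#) * y))) →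
          ∃ λ z → ℤ[ω] z ∧ (norm g ≈ π ^ (k ℕ.+ k) * ((- ω̄) ^ k * (ι (+ coeff g k ℤ.* + coeff g k) + π * z)))
        combine (y , Ay , S) (ȳ , Aȳ , S̄) = κ * y + - ω̄ * ȳ * (κ + π * y) ,
          ℤ[ω]-+ (ℤ[ω]-* ℤ[ω]-κ Ay) (ℤ[ω]-* (ℤ[ω]-* (ℤ[ω]-neg Aω̄) Aȳ) (ℤ[ω]-+ ℤ[ω]-κ (ℤ[ω]-* ℤ[ω]-π Ay))) , (begin
          norm g
            ≈⟨ *-cong S S̄ ⟩
          (π ^ k * (κ + π * y)) * ((ω̄ - 1#) ^ k * (κ + (ω̄ - 1#) * ȳ))
            ≈⟨ *-congˡ (*-cong (trans (^-congˡ k π̄≈-ω̄π) (^-distrib-* (- ω̄) π k)) (+-congˡ (*-congʳ π̄≈-ω̄π))) ⟩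
          (π ^ k * (κ + π * y)) * (((- ω̄) ^ k * π ^ k) * (κ + (- ω̄ * π) * ȳ))
            ≈⟨ solve 7 (λ P c t y V v Y → (P :* (c :+ t :* y)) :* ((V :* P) :* (c :+ (v :* t) :* Y)) :=
                 (P :* P) :* (V :* (c :* c :+ t :* (c :* y :+ v :* Y :* (c :+ t :* y))))) refl (π ^ k) κ π y ((- ω̄) ^ k) (- ω̄) ȳ ⟩
          (π ^ k * π ^ k) * ((- ω̄) ^ k * (κ * κ + π * (κ * y + - ω̄ * ȳ * (κ + π * y))))
            ≈⟨ *-cong (sym (^-homo-* π k k)) (*-congˡ (+-congʳ (sym (ι-* (+ coeff g k) (+ coeff g k))))) ⟩
          π ^ (k ℕ.+ k) * ((- ω̄) ^ k * (ι (+ coeff g k ℤ.* + coeff g k) + π * (κ * y + - ω̄ * ȳ * (κ + π * y)))) ∎)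

      -- Multiplying by (- ω)^k removes the unit, and what remains puts u into π ℤ[ω].
      unit-cancel : ∀ k u z w → ℤ[ω] z → ℤ[ω] w → (- ω̄) ^ k * (ι u + π * z) ≈ π * w → + p ∣ u
      unit-cancel k u z w Az Aw e = p∣⇐∈πℤ[ω] u ((- ω) ^ k * w - z) (ℤ[ω]-+ (ℤ[ω]-* (ℤ[ω]-^ k (ℤ[ω]-neg ℤ[ω]-ω)) Aw) (ℤ[ω]-neg Az)) (begin
        ι u                                                         ≈⟨ solve 3 (λ u t z → u := (u :+ t :* z) :- t :* z) refl (ι u) π z ⟩
        (ι u + π * z) - π * z                                       ≈⟨ +-congʳ (trans (sym (*-identityˡ _)) (*-congʳ (sym (unit^ k)))) ⟩
        (- ω) ^ k * (- ω̄) ^ k * (ι u + π * z) - π * z               ≈⟨ +-congʳ (trans (*-assoc _ _ _) (*-congˡ e)) ⟩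
        (- ω) ^ k * (π * w) - π * z                                 ≈⟨ solve 4 (λ W t w z → W :* (t :* w) :- t :* z := t :* (W :* w :- z)) refl _ _ _ _ ⟩
        π * ((- ω) ^ k * w - z)                                     ∎)

      -- Since p has order 2m in π, a sum of norm p has order m, like a square root of p.
      module SquareRoot (m : ℕ) (m+m≡ : m ℕ.+ m ≡ suc n) where

        p∣*⇒p∣ : ∀ a → + p ∣ + a ℤ.* + a → p ℕ.∣ a
        p∣*⇒p∣ a d with prime-∣* pr (+ a) (+ a) d
        ... | inj₁ e = ∣⇒∣ᵤ e
        ... | inj₂ e = ∣⇒∣ᵤ e

        m≤n : m ℕ.≤ n
        m≤n = half m m+m≡
          where
          half : ∀ m → m ℕ.+ m ≡ suc n → m ℕ.≤ n
          half (suc m) e = ≡.subst (suc m ℕ.≤_) (ℕ.suc-injective e) (ℕ.m≤n+m (suc m) m)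

        -- Induction on the order: once the coefficients below k vanish mod p, the norm starts with
        -- π^(2k) times a unit times c_k². For k < m the norm p lies in π^(2k + 1) ℤ[ω], so p
        -- divides c_k².
        coeff-vanishing : ∀ g → norm g ≈ p × 1# → ∀ k → k ℕ.≤ m → ∀ i → i ℕ.< k → p ℕ.∣ coeff g i
        coeff-vanishing g h (suc k) k<m i (s≤s i≤k) with ℕ.m≤n⇒m<n∨m≡n i≤k
        ... | inj₁ i<k = coeff-vanishing g h k (ℕ.<⇒≤ k<m) i i<k
        ... | inj₂ ≡.refl =
          let z , Az , e = norm-leading g k (ℕ.≤-trans (ℕ.<⇒≤ k<m) m≤n) (coeff-vanishing g h k (ℕ.<⇒≤ k<m))
              w , Aw , e' = p∈π^k (suc (k ℕ.+ k)) (≡.subst (suc (k ℕ.+ k) ℕ.≤_) m+m≡ (ℕ.+-mono-≤ k<m (ℕ.<⇒≤ k<m)))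
          in p∣*⇒p∣ (coeff g k) (unit-cancel k _ z w Az Aw (cancel^ (k ℕ.+ k)
                (trans (sym e) (trans h (trans e' (trans (*-congʳ (*-comm _ _)) (*-assoc _ _ _)))))))

        norm-leading-m : ∀ g → norm g ≈ p × 1# → ∃ λ z → ℤ[ω] z ∧ (norm g ≈ π ^ (m ℕ.+ m) * ((- ω̄) ^ m * (ι (+ coeff g m ℤ.* + coeff g m) + π * z)))
        norm-leading-m g h = norm-leading g m m≤n (coeff-vanishing g h m ℕ.≤-refl)

        -- If p divided c_m, then p would lie in π^(2m + 1) ℤ[ω]. Inserted into π^(2m) = - p (1 + π
        -- s), this puts 1 into π ℤ[ω], so p would divide 1.
        coeff-nonvanishing : ∀ g → norm g ≈ p × 1# → ¬ p ℕ.∣ coeff g m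
        coeff-nonvanishing g h (ℕ.divides q d) = p∤1 pr (∣⇒∣ᵤ (p∣⇐∈πℤ[ω] (+ 1) t At (trans (+-identityʳ 1#) one≈)))
          where
          z = proj₁ (norm-leading-m g h)
          Az = proj₁ (proj₂ (norm-leading-m g h))
          e = proj₂ (proj₂ (norm-leading-m g h))
          w = proj₁ (p∈π^k 1 (s≤s z≤n))
          Aw = proj₁ (proj₂ (p∈π^k 1 (s≤s z≤n)))
          e' = proj₂ (proj₂ (p∈π^k 1 (s≤s z≤n)))
          s = proj₁ eisenstein
          As = proj₁ (proj₂ eisenstein)
          e'' = proj₂ (proj₂ eisenstein)
          κ = + coeff g m ℤ.* + coeff g m
          x = w * ι (+ q ℤ.* + coeff g m)
          κ≈ : ι κ ≈ π * x
          κ≈ = begin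
            ι κ                                              ≡⟨ ≡.cong (λ a → ι (a ℤ.* + coeff g m)) (≡.trans (≡.cong +_ (≡.trans d (ℕ.*-comm q p))) (ℤ.pos-* p q)) ⟩
            ι (+ p ℤ.* + q ℤ.* + coeff g m)                  ≡⟨ ≡.cong ι (ℤ.*-assoc (+ p) (+ q) (+ coeff g m)) ⟩
            ι (+ p ℤ.* (+ q ℤ.* + coeff g m))                ≈⟨ ι-* (+ p) (+ q ℤ.* + coeff g m) ⟩
            p × 1# * ι (+ q ℤ.* + coeff g m)                 ≈⟨ *-congʳ (trans e' (*-congʳ (*-identityʳ π))) ⟩
            π * w * ι (+ q ℤ.* + coeff g m)                  ≈⟨ *-assoc _ _ _ ⟩
            π * x                                            ∎
          t = - (((- ω̄) ^ m * (x + z)) * (1# + π * s))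
          At : ℤ[ω] t
          At = ℤ[ω]-neg (ℤ[ω]-* (ℤ[ω]-* (ℤ[ω]-^ m (ℤ[ω]-neg Aω̄)) (ℤ[ω]-+ (ℤ[ω]-* Aw (ℤ[ω]-ι (+ q ℤ.* + coeff g m))) Az)) (ℤ[ω]-+ ℤ[ω]-1 (ℤ[ω]-* ℤ[ω]-π As)))
          one≈ : 1# ≈ π * t
          one≈ = cancel^ (m ℕ.+ m) (begin
            π ^ (m ℕ.+ m) * 1#                                      ≈⟨ *-identityʳ _ ⟩
            π ^ (m ℕ.+ m)                                           ≡⟨ ≡.cong (π ^_) m+m≡ ⟩
            π ^ suc n                                               ≈⟨ e'' ⟩
            - ((p × 1#) * (1# + π * s))                             ≈⟨ -‿cong (*-congʳ (trans (sym h) (trans e (*-congˡ (*-congˡ (+-congʳ κ≈)))))) ⟩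
            - (π ^ (m ℕ.+ m) * ((- ω̄) ^ m * (π * x + π * z)) * (1# + π * s))
              ≈⟨ solve 6 (λ P V t x z S → :- (P :* (V :* (t :* x :+ t :* z)) :* S) := P :* (t :* (:- ((V :* (x :+ z)) :* S)))) refl _ _ π x z _ ⟩
            π ^ (m ℕ.+ m) * (π * t)                                 ∎)

        -- Both norms equal p, so the same π^(2m) and the same unit (- ω̄)^m cancel from their
        -- expansions, and the squares agree modulo π.
        coeff-square : ∀ g g' → norm g ≈ p × 1# → norm g' ≈ p × 1# →
          + p ∣ + coeff g m ℤ.* + coeff g m ℤ.- + coeff g' m ℤ.* + coeff g' m
        coeff-square g g' h h' = p∣⇐∈πℤ[ω] (u ℤ.- u') (z' - z) (ℤ[ω]-+ Az' (ℤ[ω]-neg Az)) (begin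
            ι (u ℤ.- u')                                 ≈⟨ trans (ι-+ u (ℤ.- u')) (+-congˡ (ι-neg u')) ⟩
            ι u - ι u'                                   ≈⟨ solve 5 (λ u v t z y → u :- v := ((u :+ t :* z) :- (v :+ t :* y)) :+ t :* (y :- z)) refl _ _ π z z' ⟩
            (ι u + π * z) - (ι u' + π * z') + π * (z' - z) ≈⟨ +-congʳ (trans (+-congʳ equal) (-‿inverseʳ _)) ⟩
            0# + π * (z' - z)                            ≈⟨ +-identityˡ _ ⟩
            π * (z' - z)                                 ∎)
          where
          z = proj₁ (norm-leading-m g h)
          Az = proj₁ (proj₂ (norm-leading-m g h))
          e = proj₂ (proj₂ (norm-leading-m g h))
          z' = proj₁ (norm-leading-m g' h')
          Az' = proj₁ (proj₂ (norm-leading-m g' h'))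
          e' = proj₂ (proj₂ (norm-leading-m g' h'))
          u = + coeff g m ℤ.* + coeff g m
          u' = + coeff g' m ℤ.* + coeff g' m
          twisted : (- ω̄) ^ m * (ι u + π * z) ≈ (- ω̄) ^ m * (ι u' + π * z')
          twisted = cancel^ (m ℕ.+ m) (trans (sym e) (trans h (trans (sym h') e')))
          untwist : ∀ x → (- ω) ^ m * ((- ω̄) ^ m * x) ≈ x
          untwist x = trans (sym (*-assoc _ _ _)) (trans (*-congʳ (unit^ m)) (*-identityˡ x))
          equal : ι u + π * z ≈ ι u' + π * z'
          equal = trans (sym (untwist _)) (trans (*-congˡ twisted) (untwist _))

-- From binomial sums to power sums.

module PowerSums {c ℓ} (K : CommutativeRing c ℓ) (N : ℕ) (g : ℕ → ℕ) where
  open import Data.Nat.Base as ℕ using (ℕ; zero; suc; _!)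
  open RingKit K
  open Binomial using (nC0≡1; n*nCk)
  import Data.Nat.Properties as ℕ
  open import Data.Nat.Combinatorics using (_C_)
  open import Relation.Binary.PropositionalEquality.Core as ≡ using (_≡_)
  open import Relation.Binary.Reasoning.Setoid setoid
  open import Algebra.Properties.CommutativeMonoid.Mult +-commutativeMonoid using (×-distrib-+)

  ×-zeroʳ : ∀ n → n × 0# ≈ 0#
  ×-zeroʳ n = trans (×-congʳ n (sym (zeroˡ 0#))) (trans (sym (×-assoc-* n 0# 0#)) (zeroʳ _))

  ×-∑ : ∀ n k f → n × ∑ k f ≈ ∑ k (λ i → n × f i)
  ×-∑ n zero    f = ×-zeroʳ n
  ×-∑ n (suc k) f = trans (×-distrib-+ _ _ n) (+-congʳ (×-∑ n k f))

  -- Interpolates between the binomial sums at i = 0 and the power sums at l = 0.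
  mixed : ℕ → ℕ → Carrier
  mixed i l = ∑ N (λ x → (g x × 1#) ^ i * ((g x C l) × 1#))

  mixed-0ʳ : ∀ i → mixed i 0 ≈ ∑ N (λ x → (g x × 1#) ^ i)
  mixed-0ʳ i = ∑-cong N (λ x _ → trans (*-congˡ (trans (×-congˡ (nC0≡1 (g x))) (×-homo-1 1#))) (*-identityʳ _))

  mixed-suc : ∀ i l → mixed (suc i) l ≈ suc l × mixed i (suc l) + l × mixed i l
  mixed-suc i l = begin
    mixed (suc i) l                                        ≈⟨ ∑-cong N (λ x _ → term (g x)) ⟩
    ∑ N (λ x → suc l × G x (suc l) + l × G x l)            ≈⟨ ∑-+ N _ _ ⟩
    ∑ N (λ x → suc l × G x (suc l)) + ∑ N (λ x → l × G x l)
                                                           ≈⟨ +-cong (×-∑ (suc l) N _) (×-∑ l N _) ⟨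
    suc l × mixed i (suc l) + l × mixed i l                ∎
    where
    G : ℕ → ℕ → Carrier
    G x l = (g x × 1#) ^ i * ((g x C l) × 1#)
    term : ∀ n → (n × 1#) ^ suc i * ((n C l) × 1#) ≈ suc l × ((n × 1#) ^ i * ((n C suc l) × 1#)) + l × ((n × 1#) ^ i * ((n C l) × 1#))
    term n = begin
      (n × 1#) * P * ((n C l) × 1#)               ≈⟨ solve 3 (λ n P c → n :* P :* c := P :* (n :* c)) refl _ _ _ ⟩
      P * ((n × 1#) * ((n C l) × 1#))             ≈⟨ *-congˡ (×1-homo-* n (n C l)) ⟨
      P * ((n ℕ.* (n C l)) × 1#)                  ≡⟨ ≡.cong (λ k → P * (k × 1#)) (n*nCk n l) ⟩
      P * ((suc l ℕ.* (n C suc l) ℕ.+ l ℕ.* (n C l)) × 1#)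
        ≈⟨ *-congˡ (trans (×-homo-+ 1# (suc l ℕ.* (n C suc l)) (l ℕ.* (n C l))) (sym (+-cong (×-assocˡ 1# (suc l) (n C suc l)) (×-assocˡ 1# l (n C l))))) ⟩
      P * (suc l × ((n C suc l) × 1#) + l × ((n C l) × 1#))
        ≈⟨ trans (distribˡ P _ _) (+-cong (×-comm-* (suc l) P _) (×-comm-* l P _)) ⟩
      suc l × (P * ((n C suc l) × 1#)) + l × (P * ((n C l) × 1#)) ∎
      where P = (n × 1#) ^ i

  module _ (k : ℕ) (vanishing : ∀ l → l ℕ.< k → mixed 0 l ≈ 0#) where

    mixed-vanishing : ∀ i l → i ℕ.+ l ℕ.< k → mixed i l ≈ 0#
    mixed-vanishing zero    l l<k = vanishing l l<k
    mixed-vanishing (suc i) l i+l<k = begin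
      mixed (suc i) l                           ≈⟨ mixed-suc i l ⟩
      suc l × mixed i (suc l) + l × mixed i l   ≈⟨ +-cong (×-congʳ (suc l) (mixed-vanishing i (suc l) (≡.subst (ℕ._< k) (≡.sym (ℕ.+-suc i l)) i+l<k)))
                                                           (×-congʳ l (mixed-vanishing i l (ℕ.<-trans (ℕ.n<1+n _) i+l<k))) ⟩
      suc l × 0# + l × 0#                       ≈⟨ +-cong (×-zeroʳ (suc l)) (×-zeroʳ l) ⟩
      0# + 0#                                   ≈⟨ +-identityˡ 0# ⟩
      0#                                        ∎

    -- In the binomial basis x^i C(x, l) starts with (k! / l!) C(x, k), and the lower terms sum to
    -- zero. Multiplying by l! avoids the division.
    mixed-critical : ∀ i l → i ℕ.+ l ≡ k → (l !) × mixed i l ≈ (k !) × mixed 0 k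
    mixed-critical zero    l ≡.refl = refl
    mixed-critical (suc i) l e = begin
      (l !) × mixed (suc i) l                              ≈⟨ ×-congʳ (l !) (mixed-suc i l) ⟩
      (l !) × (suc l × mixed i (suc l) + l × mixed i l)    ≈⟨ ×-congʳ (l !) (+-congˡ (trans (×-congʳ l (mixed-vanishing i l (ℕ.≤-reflexive e))) (×-zeroʳ l))) ⟩
      (l !) × (suc l × mixed i (suc l) + 0#)               ≈⟨ ×-congʳ (l !) (+-identityʳ _) ⟩
      (l !) × (suc l × mixed i (suc l))                    ≈⟨ ×-assocˡ _ (l !) (suc l) ⟩
      (l ! ℕ.* suc l) × mixed i (suc l)                  ≡⟨ ≡.cong (_× mixed i (suc l)) (ℕ.*-comm (l !) (suc l)) ⟩
      (suc l !) × mixed i (suc l)                          ≈⟨ mixed-critical i (suc l) (≡.trans (ℕ.+-suc i l) e) ⟩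
      (k !) × mixed 0 k                                    ∎

    powers-vanishing : ∀ j → j ℕ.< k → ∑ N (λ x → (g x × 1#) ^ j) ≈ 0#
    powers-vanishing j j<k = trans (sym (mixed-0ʳ j)) (mixed-vanishing j 0 (≡.subst (ℕ._< k) (≡.sym (ℕ.+-identityʳ j)) j<k))

    powers-critical : ∑ N (λ x → (g x × 1#) ^ k) ≈ (k !) × mixed 0 k
    powers-critical = trans (sym (mixed-0ʳ k)) (trans (sym (×-homo-1 _)) (mixed-critical k 0 (ℕ.+-identityʳ k)))

-- Residues in `Fin p` as elements of a ring of characteristic p.

module ModQuadratic {c ℓ} (K : CommutativeRing c ℓ) where
  open import Data.Nat.Base as ℕ using (ℕ; zero; suc; NonZero)
  open import Defs using (module ZMod)
  open RingKit K

  import Data.Nat.Properties as ℕ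
  open import Data.Fin.Base using (Fin; toℕ)
  open import Data.Fin.Properties using (toℕ-fromℕ<; toℕ<n; toℕ-injective)
  open import Data.Nat.DivMod using (_%_; _/_; m≡m%n+[m/n]*n; m%n<n; _mod_)
  open import Data.Sum.Base using (inj₁; inj₂)
  open import Relation.Binary.PropositionalEquality.Core as ≡ using (_≡_; _≢_)
  open import Relation.Nullary.Negation.Core using (¬_; contradiction)
  open import Relation.Binary.Reasoning.Setoid setoid
  import Data.Nat.Divisibility as ℕ

  module Residues (p : ℕ) .{{p≢0 : NonZero p}} (char : p × 1# ≈ 0#)
    (faithful : ∀ n → n × 1# ≈ 0# → p ℕ.∣ n) where
    open ZMod p

    ⟦_⟧ : Fin p → Carrier
    ⟦ x ⟧ = toℕ x × 1#

    %-×1 : ∀ n → (n % p) × 1# ≈ n × 1#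
    %-×1 n = sym (begin
      n × 1#                                   ≡⟨ ≡.cong (_× 1#) (m≡m%n+[m/n]*n n p) ⟩
      (n % p ℕ.+ n / p ℕ.* p) × 1#             ≈⟨ ×-homo-+ 1# (n % p) _ ⟩
      (n % p) × 1# + (n / p ℕ.* p) × 1#        ≈⟨ +-congˡ (trans (×1-homo-* (n / p) p) (trans (*-congˡ char) (zeroʳ ((n / p) × 1#)))) ⟩
      (n % p) × 1# + 0#                        ≈⟨ +-identityʳ _ ⟩
      (n % p) × 1#                             ∎)

    ⟦mod⟧ : ∀ n → ⟦ n mod p ⟧ ≈ n × 1#
    ⟦mod⟧ n = trans (reflexive (≡.cong (_× 1#) (toℕ-fromℕ< (m%n<n n p)))) (%-×1 n)

    ⟦⟧-injective : ∀ {x y} → ⟦ x ⟧ ≈ ⟦ y ⟧ → x ≡ y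
    ⟦⟧-injective {x} {y} e = toℕ-injective (go (toℕ x) (toℕ y) (toℕ<n x) (toℕ<n y) e)
      where
      ordered : ∀ a b → a ℕ.≤ b → b ℕ.< p → a × 1# ≈ b × 1# → a ≡ b
      ordered a b a≤b b<p e = ℕ.≤-antisym a≤b (ℕ.m∸n≡0⇒m≤n (small (b ℕ.∸ a) (ℕ.≤-<-trans (ℕ.m∸n≤m b a) b<p) (faithful (b ℕ.∸ a) zero-difference)))
        where
        small : ∀ k → k ℕ.< p → p ℕ.∣ k → k ≡ 0
        small zero    _   _ = ≡.refl
        small (suc k) k<p d = contradiction d (ℕ.>⇒∤ k<p)
        zero-difference : (b ℕ.∸ a) × 1# ≈ 0#
        zero-difference = begin
          (b ℕ.∸ a) × 1#                          ≈⟨ solve 2 (λ d a → d := (a :+ d) :- a) refl _ (a × 1#) ⟩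
          a × 1# + (b ℕ.∸ a) × 1# - a × 1#        ≈⟨ +-congʳ (×-homo-+ 1# a (b ℕ.∸ a)) ⟨
          (a ℕ.+ (b ℕ.∸ a)) × 1# - a × 1#         ≡⟨ ≡.cong (λ k → k × 1# - a × 1#) (ℕ.m+[n∸m]≡n a≤b) ⟩
          b × 1# - a × 1#                         ≈⟨ +-congʳ (sym e) ⟩
          a × 1# - a × 1#                         ≈⟨ -‿inverseʳ (a × 1#) ⟩
          0#                                      ∎
      go : ∀ a b → a ℕ.< p → b ℕ.< p → a × 1# ≈ b × 1# → a ≡ b
      go a b a<p b<p e with ℕ.≤-total a b
      ... | inj₁ a≤b = ordered a b a≤b b<p e
      ... | inj₂ b≤a = ≡.sym (ordered b a b≤a a<p (sym e))

    ⟦⊕⟧ : ∀ x y → ⟦ x ⊕ y ⟧ ≈ ⟦ x ⟧ + ⟦ y ⟧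
    ⟦⊕⟧ x y = trans (⟦mod⟧ (toℕ x ℕ.+ toℕ y)) (×-homo-+ 1# (toℕ x) (toℕ y))

    ⟦⊗⟧ : ∀ x y → ⟦ x ⊗ y ⟧ ≈ ⟦ x ⟧ * ⟦ y ⟧
    ⟦⊗⟧ x y = trans (⟦mod⟧ (toℕ x ℕ.* toℕ y)) (×1-homo-* (toℕ x) (toℕ y))

    ⟦⊖⟧ : ∀ x y → ⟦ x ⊖ y ⟧ ≈ ⟦ x ⟧ - ⟦ y ⟧
    ⟦⊖⟧ x y = begin
      ⟦ x ⊖ y ⟧                                    ≈⟨ trans (⟦mod⟧ (toℕ x ℕ.+ (p ℕ.∸ toℕ y))) (×-homo-+ 1# (toℕ x) (p ℕ.∸ toℕ y)) ⟩
      ⟦ x ⟧ + (p ℕ.∸ toℕ y) × 1#                   ≈⟨ solve 3 (λ x d y → x :+ d := x :+ (d :+ y) :- y) refl _ _ ⟦ y ⟧ ⟩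
      ⟦ x ⟧ + ((p ℕ.∸ toℕ y) × 1# + ⟦ y ⟧) - ⟦ y ⟧ ≈⟨ +-congʳ (+-congˡ (×-homo-+ 1# (p ℕ.∸ toℕ y) (toℕ y))) ⟨
      ⟦ x ⟧ + (p ℕ.∸ toℕ y ℕ.+ toℕ y) × 1# - ⟦ y ⟧ ≡⟨ ≡.cong (λ k → ⟦ x ⟧ + k × 1# - ⟦ y ⟧) (ℕ.m∸n+n≡m (ℕ.<⇒≤ (toℕ<n y))) ⟩
      ⟦ x ⟧ + p × 1# - ⟦ y ⟧                       ≈⟨ +-congʳ (trans (+-congˡ char) (+-identityʳ ⟦ x ⟧)) ⟩
      ⟦ x ⟧ - ⟦ y ⟧                                ∎

    ⟦quadratic⟧ : ∀ a b c j → ⟦ a ⊗ (j ⊗ j) ⊕ b ⊗ j ⊕ c ⟧ ≈ ⟦ a ⟧ * (⟦ j ⟧ * ⟦ j ⟧) + ⟦ b ⟧ * ⟦ j ⟧ + ⟦ c ⟧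
    ⟦quadratic⟧ a b c j = trans (⟦⊕⟧ (a ⊗ (j ⊗ j) ⊕ b ⊗ j) c) (+-congʳ (trans (⟦⊕⟧ (a ⊗ (j ⊗ j)) (b ⊗ j))
      (+-cong (trans (⟦⊗⟧ a (j ⊗ j)) (*-congˡ {x = ⟦ a ⟧} (⟦⊗⟧ j j))) (⟦⊗⟧ b j))))

    ⟦0⟧ : ⟦ 0ₙ ⟧ ≈ 0#
    ⟦0⟧ = ⟦mod⟧ 0

    ≢0⇒⟦⟧≉0 : ∀ {a} → a ≢ 0ₙ → ¬ ⟦ a ⟧ ≈ 0#
    ≢0⇒⟦⟧≉0 a≢0 e = a≢0 (⟦⟧-injective (trans e (sym ⟦0⟧)))

-- Quadratic coefficients from the congruences for binomial sums.

module PlanarModP {c ℓ} (K : CommutativeRing c ℓ) where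
  open import Data.Nat.Base as ℕ using (ℕ; suc; s≤s; _!)
  open import Data.Nat.Primality using (Prime)
  open Binomial using (coefficient; p∤n!)
  open RingKit K
  open FiniteDiff K
  open ModQuadratic K using (module Residues)
  private module Sums = PowerSums K
  open Planar K using (module OddCharacteristic)

  import Data.Nat.Properties as ℕ
  open import Data.Fin.Base using (Fin; toℕ)
  open import Data.Integer.Base as ℤ using (ℤ; +_)
  open import Data.Integer.Divisibility.Signed using (∣ᵤ⇒∣; _∣_; divides)
  import Data.Nat.Divisibility as ℕ
  open import Data.Nat.Combinatorics using (_C_)
  open import Data.Product.Base using (_,_; proj₁; proj₂; ∃) renaming (_×_ to _∧_)
  open import Relation.Binary.PropositionalEquality.Core as ≡ using (_≡_)
  open import Data.Sum.Base using (_⊎_)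
  open import Relation.Nullary.Decidable.Core using (Dec)
  open import Relation.Nullary.Negation.Core using (¬_)
  open import Relation.Binary.Reasoning.Setoid setoid

  module PlanarSequence (m : ℕ) (pr : Prime (suc (m ℕ.+ m)))
    (char : suc (m ℕ.+ m) × 1# ≈ 0#)
    (faithful : ∀ n → n × 1# ≈ 0# → suc (m ℕ.+ m) ℕ.∣ n)
    (domain : ∀ {x y} → x * y ≈ 0# → x ≈ 0# ⊎ y ≈ 0#)
    (zero? : ∀ x → Dec (x ≈ 0#))
    (residue : ∀ z → ∃ λ (r : Fin (suc (m ℕ.+ m))) → toℕ r × 1# ≈ z)
    (F : ℕ → ℕ) (periodic : ∀ n → F (suc (m ℕ.+ m) ℕ.+ n) ≡ F n) where

    open Residues (suc (m ℕ.+ m)) char faithful using (⟦_⟧)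

    p = suc (m ℕ.+ m)

    -- Kept in ℕ because it is both an exponent of ω and the upper entry of binomial coefficients.
    line : ℕ → ℕ → ℕ
    line b x = b ℕ.* x ℕ.+ F x

    module _ (vanishing : ∀ b i → i ℕ.< m → p ℕ.∣ coefficient p (line b) i)
      (nonvanishing : ∀ b → ¬ p ℕ.∣ coefficient p (line b) m)
      (square : ∀ b → + p ∣ + coefficient p (line b) m ℤ.* + coefficient p (line b) m
                            ℤ.- + coefficient p (line 0) m ℤ.* + coefficient p (line 0) m) where

      open OddCharacteristic m pr char faithful domain zero? using (powerSum; degree≤2; degree≰1; ×-≉0; *-≉0)

      ∣⇒ι≈0 : ∀ i → + p ∣ i → ι i ≈ 0#
      ∣⇒ι≈0 i (divides q e) = trans (reflexive (≡.cong ι e)) (trans (ι-* q (+ p)) (trans (*-congˡ char) (zeroʳ (ι q))))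

      f : ℕ → Carrier
      f n = F n × 1#

      powerSum≈ : ∀ j b → powerSum f j b ≈ ∑ p (λ x → (line b x × 1#) ^ j)
      powerSum≈ j b = ∑-cong p (λ x _ → ^-congˡ j (sym (trans (×-homo-+ 1# (b ℕ.* x) (F x)) (+-congʳ (×1-homo-* b x)))))

      mixed≈ : ∀ b l → Sums.mixed p (line b) 0 l ≈ coefficient p (line b) l × 1#
      mixed≈ b l = trans (∑-cong p (λ x _ → *-identityˡ ((line b x C l) × 1#))) (sym (∑ℕ-× p (λ x → line b x C l) 1#))

      mixed-vanishing : ∀ b l → l ℕ.< m → Sums.mixed p (line b) 0 l ≈ 0#
      mixed-vanishing b l l<m = trans (mixed≈ b l) (∣⇒ι≈0 (+ coefficient p (line b) l) (∣ᵤ⇒∣ (vanishing b l l<m)))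

      powerSum-vanishing : ∀ j → j ℕ.< m → ∀ b → powerSum f j b ≈ 0#
      powerSum-vanishing j j<m b = trans (powerSum≈ j b) (Sums.powers-vanishing p (line b) m (mixed-vanishing b) j j<m)

      κ : ℕ → Carrier
      κ b = (m !) × (coefficient p (line b) m × 1#)

      powerSum-critical : ∀ b → powerSum f m b ≈ κ b
      powerSum-critical b = trans (powerSum≈ m b) (trans (Sums.powers-critical p (line b) m (mixed-vanishing b)) (×-congʳ (m !) (mixed≈ b m)))

      κ≉0 : ∀ b → ¬ κ b ≈ 0#
      κ≉0 b = ×-≉0 (p∤n! pr m (s≤s (ℕ.m≤m+n m m))) (λ e → nonvanishing b (faithful (coefficient p (line b) m) e))

      κ-square : ∀ b → κ b * κ b ≈ κ 0 * κ 0
      κ-square b = trans (expand b) (trans (*-congˡ {x = ((m !) × 1#) * ((m !) × 1#)} squares) (sym (expand 0)))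
        where
        C₁ : ℕ → Carrier
        C₁ b = coefficient p (line b) m × 1#
        expand : ∀ b → κ b * κ b ≈ ((m !) × 1#) * ((m !) × 1#) * (C₁ b * C₁ b)
        expand b = trans (*-cong (×≈×1* (m !) (C₁ b)) (×≈×1* (m !) (C₁ b)))
          (solve 2 (λ f c → (f :* c) :* (f :* c) := f :* f :* (c :* c)) refl ((m !) × 1#) (C₁ b))
        squares : C₁ b * C₁ b ≈ C₁ 0 * C₁ 0
        squares = begin
          C₁ b * C₁ b                                      ≈⟨ solve 2 (λ x y → x := (x :- y) :+ y) refl _ (C₁ 0 * C₁ 0) ⟩
          C₁ b * C₁ b - C₁ 0 * C₁ 0 + C₁ 0 * C₁ 0          ≈⟨ +-congʳ (+-cong (ι-* c₁ c₁) (trans (ι-neg (c₀ ℤ.* c₀)) (-‿cong (ι-* c₀ c₀)))) ⟨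
          ι (c₁ ℤ.* c₁) + ι (ℤ.- (c₀ ℤ.* c₀)) + C₁ 0 * C₁ 0 ≈⟨ +-congʳ (trans (sym (ι-+ (c₁ ℤ.* c₁) (ℤ.- (c₀ ℤ.* c₀)))) (∣⇒ι≈0 _ (square b))) ⟩
          0# + C₁ 0 * C₁ 0                                 ≈⟨ +-identityˡ _ ⟩
          C₁ 0 * C₁ 0                                      ∎
          where
          c₁ = + coefficient p (line b) m
          c₀ = + coefficient p (line 0) m

      power-square : ∀ b → powerSum f m b * powerSum f m b ≈ κ 0 * κ 0
      power-square b = trans (*-cong (powerSum-critical b) (powerSum-critical b)) (κ-square b)

      f-periodic : ∀ n → f (p ℕ.+ n) ≈ f n
      f-periodic n = reflexive (≡.cong (_× 1#) (periodic n))

      Deg-3 : Deg 3 0# f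
      Deg-3 = degree≤2 f f-periodic powerSum-vanishing (κ 0 * κ 0) (*-≉0 (κ≉0 0) (κ≉0 0)) power-square

      ¬Deg-2 : ¬ Deg 2 0# f
      ¬Deg-2 = degree≰1 f f-periodic powerSum-vanishing (κ 0 * κ 0) (*-≉0 (κ≉0 0) (κ≉0 0)) power-square

      coefficients : ∃ λ (a : Fin p) → ∃ λ (b : Fin p) → ∃ λ (c : Fin p) → (¬ ⟦ a ⟧ ≈ 0#) ∧
        (∀ n → f n ≈ ⟦ a ⟧ * ((n × 1#) * (n × 1#)) + ⟦ b ⟧ * (n × 1#) + ⟦ c ⟧)
      coefficients = proj₁ ra , proj₁ rb , proj₁ rc , a≉0 , λ n → trans (quadratic {half} {f} 2half≈1 Deg-3 n)
        (sym (+-cong (+-cong (*-congʳ {x = (n × 1#) * (n × 1#)} (proj₂ ra)) (*-congʳ {x = n × 1#} (proj₂ rb))) (proj₂ rc)))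
        where
        -- 2 (m + 1) = p + 1, so m + 1 is the inverse of 2.
        half = suc m × 1#
        2half≈1 : half + half ≈ 1#
        2half≈1 = begin
          suc m × 1# + suc m × 1#        ≈⟨ ×-homo-+ 1# (suc m) (suc m) ⟨
          (suc m ℕ.+ suc m) × 1#         ≡⟨ ≡.cong (λ k → suc k × 1#) (ℕ.+-suc m m) ⟩
          1# + p × 1#                    ≈⟨ +-congˡ char ⟩
          1# + 0#                        ≈⟨ +-identityʳ 1# ⟩
          1#                             ∎
        a = half * Δ^ 2 f 0
        ra = residue a
        rb = residue (Δ f 0 - a)
        rc = residue (f 0)
        a≉0 : ¬ ⟦ proj₁ ra ⟧ ≈ 0#
        a≉0 e = ¬Deg-2 (λ n → trans (Deg-lower 2 {f} Deg-3 n) (begin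
          Δ^ 2 f 0                       ≈⟨ *-identityˡ _ ⟨
          1# * Δ^ 2 f 0                  ≈⟨ *-congʳ {x = Δ^ 2 f 0} (sym 2half≈1) ⟩
          (half + half) * Δ^ 2 f 0       ≈⟨ distribʳ (Δ^ 2 f 0) half half ⟩
          a + a                          ≈⟨ +-cong (trans (sym (proj₂ ra)) e) (trans (sym (proj₂ ra)) e) ⟩
          0# + 0#                        ≈⟨ +-identityˡ 0# ⟩
          0#                             ∎))

-- The ring ℤ/p as integers up to congruence.

module ModRing (p : ℕ) .{{p≢0 : NonZero p}} where
  open import Data.Nat.Base as ℕ using (ℕ; zero; suc; NonZero)
  open import Algebra.Bundles using (CommutativeRing)
  open import Data.Fin.Base using (Fin; toℕ; fromℕ<)
  open import Data.Fin.Properties using (toℕ-fromℕ<)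
  open import Data.Integer.Base as ℤ using (ℤ; +_; _+_; _*_; -_; _-_; 0ℤ; 1ℤ; ∣_∣)
  import Data.Integer.DivMod as ℤ
  import Data.Integer.Properties as ℤ
  open import Data.Integer.Divisibility.Signed
  open import Data.Integer.Tactic.RingSolver using (solve-∀)
  import Data.Nat.Divisibility as ℕ
  open import Data.Nat.Primality using (Prime; euclidsLemma)
  open import Data.Product.Base using (_,_; ∃)
  open import Data.Sum.Base using (_⊎_; inj₁; inj₂)
  open import Level using (0ℓ)
  open import Relation.Binary.PropositionalEquality
  open import Relation.Nullary.Decidable using (Dec; map′)

  infix 4 _≈_
  -- A record, so that x and y can be recovered from the type; a difference x - y alone does not
  -- determine them.
  record _≈_ (x y : ℤ) : Set where
    constructor congruent
    field p∣x-y : + p ∣ x - y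
  open _≈_ public

  private
    by : ∀ {z z'} → z' ≡ z → + p ∣ z → + p ∣ z'
    by e = subst (+ p ∣_) (sym e)

  ≈-refl : ∀ {x} → x ≈ x
  ≈-refl {x} = congruent (by (ℤ.+-inverseʳ x) (divides 0ℤ refl))

  ≈-sym : ∀ {x y} → x ≈ y → y ≈ x
  ≈-sym {x} {y} (congruent d) = congruent (by (flip x y) (∣m⇒∣-m d))
    where
    flip : ∀ x y → y - x ≡ - (x - y)
    flip = solve-∀

  ≈-trans : ∀ {x y z} → x ≈ y → y ≈ z → x ≈ z
  ≈-trans {x} {y} {z} (congruent d) (congruent e) = congruent (by (telescope x y z) (∣m∣n⇒∣m+n d e))
    where
    telescope : ∀ x y z → x - z ≡ (x - y) + (y - z)
    telescope = solve-∀

  ≡⇒≈ : ∀ {x y} → x ≡ y → x ≈ y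
  ≡⇒≈ refl = ≈-refl

  +-cong : ∀ {x y u v} → x ≈ y → u ≈ v → x + u ≈ y + v
  +-cong {x} {y} {u} {v} (congruent d) (congruent e) = congruent (by (rearrange x y u v) (∣m∣n⇒∣m+n d e))
    where
    rearrange : ∀ x y u v → (x + u) - (y + v) ≡ (x - y) + (u - v)
    rearrange = solve-∀

  *-cong : ∀ {x y u v} → x ≈ y → u ≈ v → x * u ≈ y * v
  *-cong {x} {y} {u} {v} (congruent d) (congruent e) =
    congruent (by (rearrange x y u v) (∣m∣n⇒∣m+n (∣m⇒∣m*n u d) (∣n⇒∣m*n y e)))
    where
    rearrange : ∀ x y u v → x * u - y * v ≡ (x - y) * u + y * (u - v)
    rearrange = solve-∀

  neg-cong : ∀ {x y} → x ≈ y → - x ≈ - y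
  neg-cong {x} {y} (congruent d) = congruent (by (rearrange x y) (∣m⇒∣-m d))
    where
    rearrange : ∀ x y → - x - - y ≡ - (x - y)
    rearrange = solve-∀

  ℤ/p : CommutativeRing 0ℓ 0ℓ
  ℤ/p = record
    { Carrier = ℤ ; _≈_ = _≈_ ; _+_ = _+_ ; _*_ = _*_ ; -_ = -_ ; 0# = 0ℤ ; 1# = 1ℤ
    ; isCommutativeRing = record
      { isRing = record
        { +-isAbelianGroup = record
          { isGroup = record
            { isMonoid = record
              { isSemigroup = record
                { isMagma = record
                  { isEquivalence = record { refl = ≈-refl ; sym = ≈-sym ; trans = ≈-trans }
                  ; ∙-cong = +-cong }
                ; assoc = λ x y z → ≡⇒≈ (ℤ.+-assoc x y z) }
              ; identity = (λ x → ≡⇒≈ (ℤ.+-identityˡ x)) , λ x → ≡⇒≈ (ℤ.+-identityʳ x) }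
            ; inverse = (λ x → ≡⇒≈ (ℤ.+-inverseˡ x)) , λ x → ≡⇒≈ (ℤ.+-inverseʳ x)
            ; ⁻¹-cong = neg-cong }
          ; comm = λ x y → ≡⇒≈ (ℤ.+-comm x y) }
        ; *-cong = *-cong
        ; *-assoc = λ x y z → ≡⇒≈ (ℤ.*-assoc x y z)
        ; *-identity = (λ x → ≡⇒≈ (ℤ.*-identityˡ x)) , λ x → ≡⇒≈ (ℤ.*-identityʳ x)
        ; distrib = (λ x y z → ≡⇒≈ (ℤ.*-distribˡ-+ x y z)) , λ x y z → ≡⇒≈ (ℤ.*-distribʳ-+ x y z) }
      ; *-comm = λ x y → ≡⇒≈ (ℤ.*-comm x y) } }

  ≈0⇒∣ : ∀ {x} → x ≈ 0ℤ → + p ∣ x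
  ≈0⇒∣ {x} (congruent d) = by (sym (ℤ.+-identityʳ x)) d

  ∣⇒≈0 : ∀ {x} → + p ∣ x → x ≈ 0ℤ
  ∣⇒≈0 {x} d = congruent (by (ℤ.+-identityʳ x) d)

  ≈0? : ∀ x → Dec (x ≈ 0ℤ)
  ≈0? x = map′ ∣⇒≈0 ≈0⇒∣ (+ p ∣? x)

  *-≈0 : Prime p → ∀ {x y} → x * y ≈ 0ℤ → x ≈ 0ℤ ⊎ y ≈ 0ℤ
  *-≈0 pr {x} {y} e with euclidsLemma ∣ x ∣ ∣ y ∣ pr (subst (p ℕ.∣_) (ℤ.abs-* x y) (∣⇒∣ᵤ (≈0⇒∣ e)))
  ... | inj₁ d = inj₁ (∣⇒≈0 (∣ᵤ⇒∣ d))
  ... | inj₂ d = inj₂ (∣⇒≈0 (∣ᵤ⇒∣ d))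

  open import Algebra.Properties.Semiring.Mult (CommutativeRing.semiring ℤ/p) using (_×_)

  ×1≡+ : ∀ n → n × 1ℤ ≡ + n
  ×1≡+ zero    = refl
  ×1≡+ (suc n) = cong (λ z → 1ℤ + z) (×1≡+ n)

  char : p × 1ℤ ≈ 0ℤ
  char = ∣⇒≈0 (divides 1ℤ (trans (×1≡+ p) (sym (ℤ.*-identityˡ (+ p)))))

  faithful : ∀ n → n × 1ℤ ≈ 0ℤ → p ℕ.∣ n
  faithful n e = ∣⇒∣ᵤ (≈0⇒∣ (≈-trans (≡⇒≈ (sym (×1≡+ n))) e))

  residue : ∀ z → ∃ λ (r : Fin p) → toℕ r × 1ℤ ≈ z
  residue z = r , congruent (by reduce (∣m⇒∣-m (divides (z ℤ./ℕ p) refl)))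
    where
    r : Fin p
    r = fromℕ< (ℤ.n%ℕd<d z p)
    shift : ∀ a b → a - (a + b) ≡ - b
    shift = solve-∀
    reduce : toℕ r × 1ℤ - z ≡ - ((z ℤ./ℕ p) * + p)
    reduce = trans (cong₂ _-_ (trans (×1≡+ (toℕ r)) (cong +_ (toℕ-fromℕ< (ℤ.n%ℕd<d z p)))) (ℤ.a≡a%ℕn+[a/ℕn]*n z p)) (shift (+ (z ℤ.%ℕ p)) _)

-- Circulant matrices of p-th roots of unity.

module CirculantHadamard {c ℓ d ℓ'} (K : CommutativeRing c ℓ) (𝔽 : CommutativeRing d ℓ') where
  open import Defs using (module ZMod)
  private module F = RingKit 𝔽
  open RingKit K
  open import Algebra.Properties.CommutativeSemiring.Exp commutativeSemiring using (^-distrib-*)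
  import Algebra.Properties.CommutativeMonoid.Sum +-commutativeMonoid as Sum
  open Cyclotomic K using (module CyclotomicIntegers)
  open ModQuadratic 𝔽 using (module Residues)
  open PlanarModP 𝔽 using (module PlanarSequence)

  open import Data.Fin.Base using (Fin; toℕ)
  open import Data.Fin.Properties using (toℕ<n; toℕ-fromℕ<)
  open import Data.Integer.Base using (+_)
  open import Data.Nat.Base as ℕ using (ℕ; zero; suc; s≤s; z≤n)
  open import Data.Nat.Coprimality using (prime⇒coprime; coprime-Bézout)
  import Data.Nat.Divisibility as ℕ
  open import Data.Nat.DivMod using (_%_; _/_; _mod_; m≡m%n+[m/n]*n; m%n<n)
  open import Data.Nat.GCD using (module Bézout)
  open import Data.Nat.Primality using (Prime)
  import Data.Nat.Properties as ℕ
  open import Data.Product.Base using (_,_; proj₁; proj₂; ∃) renaming (_×_ to _∧_)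
  open import Data.Sum.Base using (_⊎_; inj₁; inj₂)
  open import Relation.Binary.PropositionalEquality.Core as ≡ using (_≡_; _≢_)
  open import Relation.Nullary.Decidable.Core using (Dec)
  open import Relation.Nullary.Negation.Core using (¬_)
  import Relation.Binary.Reasoning.Setoid as SetoidReasoning

  module OddPrime (m' : ℕ) (pr : Prime (suc (suc m' ℕ.+ suc m')))
    (char : suc (suc m' ℕ.+ suc m') F.× F.1# F.≈ F.0#)
    (faithful : ∀ n → n F.× F.1# F.≈ F.0# → suc (suc m' ℕ.+ suc m') ℕ.∣ n)
    (domain : ∀ {x y} → x F.* y F.≈ F.0# → x F.≈ F.0# ⊎ y F.≈ F.0#)
    (zero? : ∀ x → Dec (x F.≈ F.0#))
    (residue : ∀ z → ∃ λ (r : Fin (suc (suc m' ℕ.+ suc m'))) → toℕ r F.× F.1# F.≈ z)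
    (char0 : ∀ k → k × 1# ≈ 0# → k ≡ 0) (cancel-≉0 : ∀ {z} → ¬ z ≈ 0# → ∀ w → z * w ≈ 0# → w ≈ 0#)
    (ω ω̄ : Carrier) (ωω̄≈1 : ω * ω̄ ≈ 1#) (ω^p≈1 : ω ^ suc (suc m' ℕ.+ suc m') ≈ 1#) (ω≉1 : ¬ ω ≈ 1#) where

    m = suc m'
    p = suc (m ℕ.+ m)
    -- Chosen so that p = 2 + n and m + m = suc n hold by computation, as `CyclotomicIntegers` and
    -- `SquareRoot` expect.
    n = m' ℕ.+ suc m'

    open Residues p char faithful
    open ZMod p

    1^ : ∀ k → 1# ^ k ≈ 1#
    1^ zero    = refl
    1^ (suc k) = trans (*-identityˡ _) (1^ k)

    ω^*ω̄^≈1 : ∀ k → ω ^ k * ω̄ ^ k ≈ 1#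
    ω^*ω̄^≈1 k = trans (sym (^-distrib-* ω ω̄ k)) (trans (^-congˡ k ωω̄≈1) (1^ k))

    ω^p*≈1 : ∀ k → ω ^ (k ℕ.* p) ≈ 1#
    ω^p*≈1 k = trans (reflexive (≡.cong (ω ^_) (ℕ.*-comm k p))) (trans (sym (^-assocʳ ω p k)) (trans (^-congˡ k ω^p≈1) (1^ k)))

    ω^mod : ∀ k → ω ^ k ≈ ω ^ toℕ (k mod p)
    ω^mod k = begin
      ω ^ k                                   ≡⟨ ≡.cong (ω ^_) (m≡m%n+[m/n]*n k p) ⟩
      ω ^ (k % p ℕ.+ k / p ℕ.* p)             ≈⟨ ^-homo-* ω (k % p) _ ⟩
      ω ^ (k % p) * ω ^ (k / p ℕ.* p)         ≈⟨ trans (*-congˡ {x = ω ^ (k % p)} (ω^p*≈1 (k / p))) (*-identityʳ _) ⟩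
      ω ^ (k % p)                             ≡⟨ ≡.cong (ω ^_) (≡.sym (toℕ-fromℕ< (m%n<n k p))) ⟩
      ω ^ toℕ (k mod p)                       ∎
      where
      open SetoidReasoning setoid

    -- Lets equations between powers of ω be proved by ring reasoning on the exponents in 𝔽.
    ω^-resp : ∀ {k l} → k F.× F.1# F.≈ l F.× F.1# → ω ^ k ≈ ω ^ l
    ω^-resp {k} {l} e = trans (ω^mod k) (trans (reflexive (≡.cong (λ r → ω ^ toℕ r) (⟦⟧-injective {k mod p} {l mod p} (F.trans (⟦mod⟧ k) (F.trans e (F.sym (⟦mod⟧ l))))))) (sym (ω^mod l)))

    toℕ-mod : ∀ (j : Fin p) → toℕ j mod p ≡ j
    toℕ-mod j = ⟦⟧-injective (⟦mod⟧ (toℕ j))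

    -- A Bézout relation between s and the prime p would turn ω^s ≈ 1 and ω^p ≈ 1 into ω ≈ 1.
    ω^≉1 : ∀ s → 0 ℕ.< s → s ℕ.< p → ¬ ω ^ s ≈ 1#
    ω^≉1 s 0<s s<p e = ω≉1 (bezout (coprime-Bézout (prime⇒coprime pr {{ℕ.>-nonZero 0<s}} s<p)))
      where
      ω^*s≈1 : ∀ y → ω ^ (y ℕ.* s) ≈ 1#
      ω^*s≈1 y = trans (reflexive (≡.cong (ω ^_) (ℕ.*-comm y s))) (trans (sym (^-assocʳ ω s y)) (trans (^-congˡ y e) (1^ y)))
      bezout : Bézout.Identity 1 p s → ω ≈ 1#
      bezout (Bézout.+- x y eq) = trans (sym (*-identityʳ ω)) (trans (*-congˡ {x = ω} (sym (ω^*s≈1 y))) (trans (reflexive (≡.cong (ω ^_) eq)) (ω^p*≈1 x)))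
      bezout (Bézout.-+ x y eq) = trans (sym (*-identityʳ ω)) (trans (*-congˡ {x = ω} (sym (ω^p*≈1 x))) (trans (reflexive (≡.cong (ω ^_) eq)) (ω^*s≈1 y)))

    cancel-unit : ∀ {z} → ¬ z ≈ 1# → ∀ w → (z - 1#) * w ≈ 0# → w ≈ 0#
    cancel-unit {z} z≉1 = cancel-≉0 λ e → z≉1 (trans (solve 2 (λ z u → z := (z :- u) :+ u) refl z 1#) (trans (+-congʳ e) (+-identityˡ 1#)))

    ×1≉0 : ∀ k → 0 ℕ.< k → k ℕ.< p → ¬ k F.× F.1# F.≈ F.0#
    ×1≉0 (suc k) _ k<p e = ℕ.>⇒∤ k<p (faithful (suc k) e)

    module _ (M : Fin p → Fin p → Fin p) (circulant : Circulant M) where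

      -- Powers of the inverse ω̄ stand for conjugates, so that this part is pure ring theory.
      Orthogonal : Set ℓ
      Orthogonal = ∀ i k → i ≢ k → Sum.sum (λ j → ω ^ toℕ (M i j) * ω̄ ^ toℕ (M k j)) ≈ 0#

      entry : ∀ i j k → ⟦ k ⟧ F.≈ ⟦ j ⟧ F.- ⟦ i ⟧ → M i j ≡ M 0ₙ k
      entry i j k e = circulant i j 0ₙ k (⟦⟧-injective (F.trans (⟦⊖⟧ j i) (F.trans (F.sym e) (F.sym (F.trans (⟦⊖⟧ k 0ₙ)
        (F.trans (F.+-congˡ (F.trans (F.-‿cong ⟦0⟧) F.-0#≈0#)) (F.+-identityʳ ⟦ k ⟧)))))))

      firstRow : ℕ → ℕ
      firstRow x = toℕ (M 0ₙ (x mod p))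

      mod-+p : ∀ x → (p ℕ.+ x) mod p ≡ x mod p
      mod-+p x = ⟦⟧-injective (F.trans (⟦mod⟧ (p ℕ.+ x)) (F.trans (F.×-homo-+ F.1# p x)
        (F.trans (F.+-congʳ char) (F.trans (F.+-identityˡ _) (F.sym (⟦mod⟧ x))))))

      firstRow-periodic : ∀ x → firstRow (p ℕ.+ x) ≡ firstRow x
      firstRow-periodic x = ≡.cong (λ j → toℕ (M 0ₙ j)) (mod-+p x)

      module Forward (orthogonal : Orthogonal) where
        open PlanarSequence m pr char faithful domain zero? residue firstRow firstRow-periodic using (line; coefficients)
        open CyclotomicIntegers n pr ω ω^p≈1 (cancel-unit ω≉1) char0 using (ℤ[ω]; ℤ[ω]-resp; ℤ[ω]-^; ℤ[ω]-ω; module Norm)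

        -- ω̄ equals ω^(p - 1).
        ℤ[ω]-ω̄ : ℤ[ω] ω̄
        ℤ[ω]-ω̄ = ℤ[ω]-resp (trans (sym (trans (*-congʳ {ω ^ suc n} ωω̄≈1) (*-identityˡ _))) (trans (solve 3 (λ w v x → w :* v :* x := v :* (w :* x)) refl ω ω̄ (ω ^ suc n))
          (trans (*-congˡ {x = ω̄} ω^p≈1) (*-identityʳ ω̄)))) (ℤ[ω]-^ (suc n) ℤ[ω]-ω)

        open Norm ω̄ ℤ[ω]-ω̄ ωω̄≈1 p using (norm; module SquareRoot)
        open SquareRoot m ≡.refl using (coeff-vanishing; coeff-nonvanishing; coeff-square)

        open SetoidReasoning setoid

        -- The periodic autocorrelation of the first row of U.
        correlation : ℕ → Carrier
        correlation k = ∑ p (λ y → ω ^ firstRow (k ℕ.+ y) * ω̄ ^ firstRow y)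

        correlation≈0 : ∀ k → 0 ℕ.< k → k ℕ.< p → correlation k ≈ 0#
        correlation≈0 k 0<k k<p = begin
          correlation k                                             ≈⟨ sum≈∑ p _ ⟨
          Sum.sum {p} (λ j → ω ^ firstRow (k ℕ.+ toℕ j) * ω̄ ^ firstRow (toℕ j))
                                                                    ≈⟨ Sum.sum-cong-≋ (λ j → *-cong (reflexive (≡.cong (λ r → ω ^ toℕ r) (≡.sym (row-i j)))) (row-0 j)) ⟩
          Sum.sum {p} (λ j → ω ^ toℕ (M i j) * ω̄ ^ toℕ (M 0ₙ j))                 ≈⟨ orthogonal i 0ₙ i≢0 ⟩
          0#                                                        ∎
          where
          -- The entry of row i at j is that of row 0 at j - i, so the first row shifted by k is row
          -- - k.
          i = (p ℕ.∸ k) mod p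
          -k≈ : ⟦ i ⟧ F.≈ F.- (k F.× F.1#)
          -k≈ = F.trans (⟦mod⟧ (p ℕ.∸ k)) (F.trans (F.solve 2 (λ x k → x F.:= (x F.:+ k) F.:- k) F.refl _ (k F.× F.1#))
            (F.trans (F.+-congʳ (F.trans (F.sym (F.×-homo-+ F.1# (p ℕ.∸ k) k)) (F.trans (F.reflexive (≡.cong (F._× F.1#) (ℕ.m∸n+n≡m (ℕ.<⇒≤ k<p)))) char))) (F.+-identityˡ _)))
          i≢0 : i ≢ 0ₙ
          i≢0 e = ×1≉0 k 0<k k<p (F.trans (F.sym (F.-‿involutive _)) (F.trans (F.-‿cong (F.trans (F.sym -k≈) (F.trans (F.reflexive (≡.cong ⟦_⟧ e)) ⟦0⟧))) F.-0#≈0#))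
          row-i : ∀ j → M i j ≡ M 0ₙ ((k ℕ.+ toℕ j) mod p)
          row-i j = entry i j _ (F.trans (⟦mod⟧ (k ℕ.+ toℕ j)) (F.trans (F.×-homo-+ F.1# k (toℕ j)) (F.trans (F.+-comm _ _)
            (F.+-congˡ (F.trans (F.sym (F.-‿involutive _)) (F.-‿cong (F.sym -k≈)))))))
          row-0 : ∀ j → ω̄ ^ firstRow (toℕ j) ≈ ω̄ ^ toℕ (M 0ₙ j)
          row-0 j = reflexive (≡.cong (λ r → ω̄ ^ toℕ (M 0ₙ r)) (toℕ-mod j))

        -- Grouping the double sum by the difference k of the two indices gives the Fourier
        -- transform of the autocorrelation at b. Orthogonality leaves only the term k = 0, which is
        -- p.
        norm≈p : ∀ b → norm (line b) ≈ p × 1#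
        norm≈p b = begin
          ∑ p (λ x → ω ^ g x) * ∑ p (λ y → ω̄ ^ g y)                           ≈⟨ ∑-*ˡ p _ _ ⟩
          ∑ p (λ y → ∑ p (λ x → ω ^ g x) * ω̄ ^ g y)                           ≈⟨ ∑-cong p (λ y _ → trans (*-congʳ {ω̄ ^ g y} (sym (∑-shift^ p y periodic))) (∑-*ʳ p (ω̄ ^ g y) _)) ⟩
          ∑ p (λ y → ∑ p (λ k → ω ^ g (k ℕ.+ y) * ω̄ ^ g y))                   ≈⟨ ∑-comm p p (λ y k → ω ^ g (k ℕ.+ y) * ω̄ ^ g y) ⟩
          ∑ p (λ k → ∑ p (λ y → ω ^ g (k ℕ.+ y) * ω̄ ^ g y))                   ≈⟨ ∑-cong p (λ k _ → trans (∑-cong p (λ y _ → twist k y)) (sym (∑-*ˡ p (ω ^ (b ℕ.* k)) _))) ⟩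
          ∑ p (λ k → ω ^ (b ℕ.* k) * correlation k)                           ≈⟨ ∑-suc (m ℕ.+ m) _ ⟩
          ω ^ (b ℕ.* 0) * correlation 0 + ∑ (m ℕ.+ m) (λ k → ω ^ (b ℕ.* suc k) * correlation (suc k))
                                                                             ≈⟨ +-cong (*-cong (reflexive (≡.cong (ω ^_) (ℕ.*-zeroʳ b))) (trans (∑-cong p (λ y _ → ω^*ω̄^≈1 (firstRow y))) (∑-const p 1#)))
                                                                                  (∑-zero (m ℕ.+ m) (λ k k<2m → trans (*-congˡ {x = ω ^ (b ℕ.* suc k)} (correlation≈0 (suc k) (s≤s z≤n) (s≤s k<2m))) (zeroʳ _))) ⟩
          1# * (p × 1#) + 0#                                                  ≈⟨ trans (+-identityʳ _) (*-identityˡ _) ⟩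
          p × 1#                                                              ∎
          where
          g = line b
          periodic : ∀ x → ω ^ g (x ℕ.+ p) ≈ ω ^ g x
          periodic x = begin
            ω ^ (b ℕ.* (x ℕ.+ p) ℕ.+ firstRow (x ℕ.+ p))         ≡⟨ ≡.cong₂ (λ s t → ω ^ (s ℕ.+ t)) (ℕ.*-distribˡ-+ b x p) (≡.trans (≡.cong firstRow (ℕ.+-comm x p)) (firstRow-periodic x)) ⟩
            ω ^ (b ℕ.* x ℕ.+ b ℕ.* p ℕ.+ firstRow x)             ≡⟨ ≡.cong (ω ^_) (rearr (b ℕ.* x) (b ℕ.* p) (firstRow x)) ⟩
            ω ^ (g x ℕ.+ b ℕ.* p)                                ≈⟨ trans (^-homo-* ω (g x) (b ℕ.* p)) (trans (*-congˡ {x = ω ^ g x} (ω^p*≈1 b)) (*-identityʳ _)) ⟩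
            ω ^ g x                                              ∎
            where
            rearr : ∀ u v w → u ℕ.+ v ℕ.+ w ≡ u ℕ.+ w ℕ.+ v
            rearr u v w = ≡.trans (ℕ.+-assoc u v w) (≡.trans (≡.cong (u ℕ.+_) (ℕ.+-comm v w)) (≡.sym (ℕ.+-assoc u w v)))
          twist : ∀ k y → ω ^ g (k ℕ.+ y) * ω̄ ^ g y ≈ ω ^ (b ℕ.* k) * (ω ^ firstRow (k ℕ.+ y) * ω̄ ^ firstRow y)
          twist k y = begin
            ω ^ (b ℕ.* (k ℕ.+ y) ℕ.+ firstRow (k ℕ.+ y)) * ω̄ ^ (b ℕ.* y ℕ.+ firstRow y)
              ≈⟨ *-cong (trans (^-homo-* ω (b ℕ.* (k ℕ.+ y)) _) (*-congʳ (trans (reflexive (≡.cong (ω ^_) (ℕ.*-distribˡ-+ b k y))) (^-homo-* ω (b ℕ.* k) _)))) (^-homo-* ω̄ (b ℕ.* y) _) ⟩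
            (ω ^ (b ℕ.* k) * ω ^ (b ℕ.* y)) * ω ^ firstRow (k ℕ.+ y) * (ω̄ ^ (b ℕ.* y) * ω̄ ^ firstRow y)
              ≈⟨ solve 5 (λ s t u v w → (s :* t) :* u :* (v :* w) := (t :* v) :* (s :* (u :* w))) refl _ _ _ _ _ ⟩
            (ω ^ (b ℕ.* y) * ω̄ ^ (b ℕ.* y)) * (ω ^ (b ℕ.* k) * (ω ^ firstRow (k ℕ.+ y) * ω̄ ^ firstRow y))
              ≈⟨ trans (*-congʳ (ω^*ω̄^≈1 (b ℕ.* y))) (*-identityˡ _) ⟩
            ω ^ (b ℕ.* k) * (ω ^ firstRow (k ℕ.+ y) * ω̄ ^ firstRow y) ∎

        quadratic-coefficients : ∃ λ a → ∃ λ b → ∃ λ c → a ≢ 0ₙ ∧ (∀ j → M 0ₙ j ≡ a ⊗ (j ⊗ j) ⊕ b ⊗ j ⊕ c)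
        quadratic-coefficients = conclude (coefficients
          (λ b i i<m → coeff-vanishing (line b) (norm≈p b) m ℕ.≤-refl i i<m)
          (λ b → coeff-nonvanishing (line b) (norm≈p b))
          (λ b → coeff-square (line b) (line 0) (norm≈p b) (norm≈p 0)))
          where
          conclude : (∃ λ a → ∃ λ b → ∃ λ c → (¬ ⟦ a ⟧ F.≈ F.0#) ∧ (∀ x → firstRow x F.× F.1# F.≈ ⟦ a ⟧ F.* ((x F.× F.1#) F.* (x F.× F.1#)) F.+ ⟦ b ⟧ F.* (x F.× F.1#) F.+ ⟦ c ⟧)) →
            ∃ λ a → ∃ λ b → ∃ λ c → a ≢ 0ₙ ∧ (∀ j → M 0ₙ j ≡ a ⊗ (j ⊗ j) ⊕ b ⊗ j ⊕ c)
          conclude (a , b , c , a≉0 , h) = a , b , c , (λ e → a≉0 (F.trans (F.reflexive (≡.cong ⟦_⟧ e)) ⟦0⟧)) , λ j →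
            ⟦⟧-injective (F.trans (F.reflexive (≡.cong (λ r → ⟦ M 0ₙ r ⟧) (≡.sym (toℕ-mod j)))) (F.trans (h (toℕ j)) (F.sym (⟦quadratic⟧ a b c j))))

      module Backward (a b c : Fin p) (a≢0 : a ≢ 0ₙ) (quadratic : ∀ j → M 0ₙ j ≡ a ⊗ (j ⊗ j) ⊕ b ⊗ j ⊕ c) where

        Q : F.Carrier → F.Carrier
        Q x = ⟦ a ⟧ F.* (x F.* x) F.+ ⟦ b ⟧ F.* x F.+ ⟦ c ⟧

        Q-cong : ∀ {x y} → x F.≈ y → Q x F.≈ Q y
        Q-cong e = F.+-congʳ (F.+-cong (F.*-congˡ (F.*-cong e e)) (F.*-congˡ e))

        ⟦entry⟧ : ∀ i j → ⟦ M i j ⟧ F.≈ Q (⟦ j ⟧ F.- ⟦ i ⟧)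
        ⟦entry⟧ i j = F.trans (F.reflexive (≡.cong ⟦_⟧ (≡.trans (entry i j (j ⊖ i) (⟦⊖⟧ j i)) (quadratic (j ⊖ i)))))
          (F.trans (⟦quadratic⟧ a b c (j ⊖ i)) (Q-cong (⟦⊖⟧ j i)))

        -- The ratio of consecutive summands is constant, so that the sum is
        -- invariant under multiplication by a root of unity ω^s ≠ 1.
        orthogonal : Orthogonal
        orthogonal i k i≢k = trans (trans (Sum.sum-cong-≋ as-row) (sum≈∑ p z)) (cancel-unit (ω^≉1 (toℕ s) 0<s (toℕ<n s)) _ (begin
          (ω ^ toℕ s - 1#) * ∑ p z                  ≈⟨ solve 3 (λ w u T → (w :- u) :* T := w :* T :- u :* T) refl (ω ^ toℕ s) 1# (∑ p z) ⟩
          ω ^ toℕ s * ∑ p z - 1# * ∑ p z            ≈⟨ +-cong (trans (∑-*ˡ p _ z) (trans (∑-cong p (λ x _ → sym (ratio x))) (∑-shift p z-periodic))) (-‿cong (*-identityˡ (∑ p z))) ⟩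
          ∑ p z - ∑ p z                             ≈⟨ -‿inverseʳ (∑ p z) ⟩
          0#                                        ∎))
          where
          open SetoidReasoning setoid
          row : Fin p → ℕ → ℕ
          row i x = toℕ (M i (x mod p))
          z : ℕ → Carrier
          z x = ω ^ row i x * ω̄ ^ row k x
          as-row : ∀ j → ω ^ toℕ (M i j) * ω̄ ^ toℕ (M k j) ≈ z (toℕ j)
          as-row j = *-cong (reflexive (≡.cong (λ r → ω ^ toℕ (M i r)) (≡.sym (toℕ-mod j))))
            (reflexive (≡.cong (λ r → ω̄ ^ toℕ (M k r)) (≡.sym (toℕ-mod j))))
          z-periodic : z p ≈ z 0
          z-periodic = reflexive (≡.cong (λ r → ω ^ toℕ (M i r) * ω̄ ^ toℕ (M k r)) (≡.trans (≡.cong (_mod p) (≡.sym (ℕ.+-identityʳ p))) (mod-+p 0)))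
          -- As x grows by 1, the exponent f(x - i) - f(x - k) grows by 2a (k - i), whatever x is.
          -- This is nonzero as p is odd, a ≠ 0 and i ≠ k.
          slope = (⟦ a ⟧ F.+ ⟦ a ⟧) F.* (⟦ k ⟧ F.- ⟦ i ⟧)
          s = proj₁ (residue slope)
          slope≉0 : ¬ slope F.≈ F.0#
          slope≉0 e = factor (domain e)
            where
            double : ¬ ⟦ a ⟧ F.+ ⟦ a ⟧ F.≈ F.0#
            double e = split (domain {2 F.× F.1#} {⟦ a ⟧} (F.trans (F.sym (F.×≈×1* 2 ⟦ a ⟧)) (F.trans (F.+-congˡ (F.+-identityʳ ⟦ a ⟧)) e)))
              where
              3≤p : 3 ℕ.≤ p
              3≤p = s≤s (ℕ.+-mono-≤ {1} {m} {1} {m} (s≤s z≤n) (s≤s z≤n))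
              split : ¬ (2 F.× F.1# F.≈ F.0# ⊎ ⟦ a ⟧ F.≈ F.0#)
              split (inj₁ e) = ×1≉0 2 (s≤s z≤n) 3≤p e
              split (inj₂ e) = ≢0⇒⟦⟧≉0 a≢0 e
            factor : ¬ (⟦ a ⟧ F.+ ⟦ a ⟧ F.≈ F.0# ⊎ ⟦ k ⟧ F.- ⟦ i ⟧ F.≈ F.0#)
            factor (inj₁ e) = double e
            factor (inj₂ e) = i≢k (⟦⟧-injective (F.sym (F.trans (F.solve 2 (λ k i → k F.:= (k F.:- i) F.:+ i) F.refl ⟦ k ⟧ ⟦ i ⟧) (F.trans (F.+-congʳ e) (F.+-identityˡ ⟦ i ⟧)))))
          0<s : 0 ℕ.< toℕ s
          0<s = ℕ.n≢0⇒n>0 λ e → slope≉0 (F.trans (F.sym (proj₂ (residue slope))) (F.reflexive (≡.cong (F._× F.1#) e)))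
          ⟦row⟧ : ∀ i x → row i x F.× F.1# F.≈ Q (x F.× F.1# F.- ⟦ i ⟧)
          ⟦row⟧ i x = F.trans (⟦entry⟧ i (x mod p)) (Q-cong (F.+-congʳ (⟦mod⟧ x)))
          -- Exponents are natural numbers, so the terms to be subtracted are moved to the other
          -- side.
          exponents : ∀ x → (row i (suc x) ℕ.+ row k x) F.× F.1# F.≈ (toℕ s ℕ.+ (row i x ℕ.+ row k (suc x))) F.× F.1#
          exponents x = F.trans (F.×-homo-+ F.1# (row i (suc x)) (row k x)) (F.trans (F.+-cong (⟦row⟧ i (suc x)) (⟦row⟧ k x)) (F.trans
            (F.solve 7 (λ a b c i k u x → (a F.:* ((u F.:+ x F.:- i) F.:* (u F.:+ x F.:- i)) F.:+ b F.:* (u F.:+ x F.:- i) F.:+ c) F.:+ (a F.:* ((x F.:- k) F.:* (x F.:- k)) F.:+ b F.:* (x F.:- k) F.:+ c)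
              F.:= (a F.:+ a) F.:* (u F.:* (k F.:- i)) F.:+ ((a F.:* ((x F.:- i) F.:* (x F.:- i)) F.:+ b F.:* (x F.:- i) F.:+ c) F.:+ (a F.:* ((u F.:+ x F.:- k) F.:* (u F.:+ x F.:- k)) F.:+ b F.:* (u F.:+ x F.:- k) F.:+ c)))
              F.refl ⟦ a ⟧ ⟦ b ⟧ ⟦ c ⟧ ⟦ i ⟧ ⟦ k ⟧ F.1# (x F.× F.1#))
            (F.sym (F.trans (F.×-homo-+ F.1# (toℕ s) _) (F.+-cong (F.trans (proj₂ (residue slope)) (F.*-congˡ (F.sym (F.*-identityˡ _))))
              (F.trans (F.×-homo-+ F.1# (row i x) (row k (suc x))) (F.+-cong (⟦row⟧ i x) (⟦row⟧ k (suc x)))))))))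
          ratio : ∀ x → z (suc x) ≈ ω ^ toℕ s * z x
          ratio x = begin
            ω ^ i' * ω̄ ^ k'                                        ≈⟨ trans (sym (*-identityʳ _)) (*-congˡ {x = ω ^ i' * ω̄ ^ k'} (sym (ω^*ω̄^≈1 k₀))) ⟩
            ω ^ i' * ω̄ ^ k' * (ω ^ k₀ * ω̄ ^ k₀)                    ≈⟨ solve 4 (λ a b c d → a :* b :* (c :* d) := (a :* c) :* (b :* d)) refl (ω ^ i') (ω̄ ^ k') (ω ^ k₀) (ω̄ ^ k₀) ⟩
            (ω ^ i' * ω ^ k₀) * (ω̄ ^ k' * ω̄ ^ k₀)                  ≈⟨ *-congʳ {ω̄ ^ k' * ω̄ ^ k₀} (trans (sym (^-homo-* ω i' k₀)) (trans (ω^-resp {i' ℕ.+ k₀} {toℕ s ℕ.+ (i₀ ℕ.+ k')} (exponents x)) (trans (^-homo-* ω (toℕ s) (i₀ ℕ.+ k')) (*-congˡ {x = ω ^ toℕ s} (^-homo-* ω i₀ k'))))) ⟩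
            (ω ^ toℕ s * (ω ^ i₀ * ω ^ k')) * (ω̄ ^ k' * ω̄ ^ k₀)    ≈⟨ solve 5 (λ a b c d e → (a :* (b :* c)) :* (d :* e) := (c :* d) :* (a :* (b :* e))) refl (ω ^ toℕ s) (ω ^ i₀) (ω ^ k') (ω̄ ^ k') (ω̄ ^ k₀) ⟩
            (ω ^ k' * ω̄ ^ k') * (ω ^ toℕ s * (ω ^ i₀ * ω̄ ^ k₀))    ≈⟨ trans (*-congʳ {ω ^ toℕ s * (ω ^ i₀ * ω̄ ^ k₀)} (ω^*ω̄^≈1 k')) (*-identityˡ _) ⟩
            ω ^ toℕ s * (ω ^ i₀ * ω̄ ^ k₀)                          ∎
            where
            i' = row i (suc x)
            k' = row k (suc x)
            i₀ = row i x
            k₀ = row k x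

-- Consequences of the ordered field axioms.

module Reals {c ℓ₁ ℓ₂ ℓ₃} (R : RealNumbers c ℓ₁ ℓ₂ ℓ₃) where
  open RingKit (RealNumbers.commutativeRing R) public
  open RealNumbers R public
    using (_<_; _#_; #⇒<⊎>; <⇒#; 0<1; +-monoˡ-<; *-pos; archimedean; #⇒invertible; invertible⇒#; tight; #-sym; 0<n·1; 1/_; module SPO)
  open SPO public using (<-respˡ-≈; <-respʳ-≈) renaming (trans to <-trans; irrefl to <-irrefl)

  open import Data.Nat.Base as ℕ using (ℕ; zero; suc; NonZero)
  import Data.Nat.Properties as ℕ
  open import Data.Product.Base using (_,_; proj₁; proj₂; ∃) renaming (_×_ to _∧_)
  open import Data.Sum.Base using (_⊎_; inj₁; inj₂)
  open import Relation.Binary.PropositionalEquality.Core as ≡ using (_≡_)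
  open import Relation.Nullary.Negation.Core using (¬_; contradiction)

  <-resp-≈ : ∀ {x y u v} → x ≈ u → y ≈ v → x < y → u < v
  <-resp-≈ p q l = <-respʳ-≈ q (<-respˡ-≈ p l)

  +-monoʳ-< : ∀ {x y} z → x < y → z + x < z + y
  +-monoʳ-< z l = <-resp-≈ (+-comm _ z) (+-comm _ z) (+-monoˡ-< z l)

  +-mono-< : ∀ {x y u v} → x < y → u < v → x + u < y + v
  +-mono-< {y = y} {u} l l' = <-trans (+-monoˡ-< u l) (+-monoʳ-< y l')

  +-pos : ∀ {x y} → 0# < x → 0# < y → 0# < x + y
  +-pos l l' = <-respˡ-≈ (+-identityˡ 0#) (+-mono-< l l')

  <⇒0<- : ∀ {x y} → x < y → 0# < y - x
  <⇒0<- {x} l = <-respˡ-≈ (-‿inverseʳ x) (+-monoˡ-< (- x) l)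

  0<-⇒< : ∀ {x y} → 0# < y - x → x < y
  0<-⇒< {x} {y} l = <-resp-≈ (+-identityˡ x) (solve 2 (λ x y → (y :- x) :+ x := y) refl x y) (+-monoˡ-< x l)

  neg-mono-< : ∀ {x y} → x < y → - y < - x
  neg-mono-< {x} {y} l = 0<-⇒< (<-respʳ-≈ (solve 2 (λ x y → y :- x := (:- x) :- (:- y)) refl x y) (<⇒0<- l))

  *-monoˡ-< : ∀ {x y} z → 0# < z → x < y → x * z < y * z
  *-monoˡ-< {x} {y} z 0<z l = 0<-⇒< (<-respʳ-≈ ([y-z]x≈yx-zx z y x) (*-pos (<⇒0<- l) 0<z))

  *-monoʳ-< : ∀ {x y} z → 0# < z → x < y → z * x < z * y
  *-monoʳ-< z 0<z l = <-resp-≈ (*-comm _ z) (*-comm _ z) (*-monoˡ-< z 0<z l)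

  *-mono-< : ∀ {x y u v} → 0# < y → 0# < u → x < y → u < v → x * u < y * v
  *-mono-< {y = y} {u} 0<y 0<u l l' = <-trans (*-monoˡ-< u 0<u l) (*-monoʳ-< y 0<y l')

  ×-pos : ∀ n {x} → 0# < x → 0# < suc n × x
  ×-pos zero    l = <-respʳ-≈ (sym (+-identityʳ _)) l
  ×-pos (suc n) l = +-pos l (×-pos n l)

  ×-mono-< : ∀ n {x y} → x < y → suc n × x < suc n × y
  ×-mono-< zero    l = <-resp-≈ (sym (+-identityʳ _)) (sym (+-identityʳ _)) l
  ×-mono-< (suc n) l = +-mono-< l (×-mono-< n l)

  <-×-≤ : ∀ {m n u x} → 0# < x → m ℕ.≤ n → u < m × x → u < n × x
  <-×-≤ {m} {n} {u} {x} 0<x m≤n l = ≡.subst (λ k → u < k × x) (ℕ.m∸n+n≡m m≤n) (go (n ℕ.∸ m))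
    where
    go : ∀ k → u < (k ℕ.+ m) × x
    go zero    = l
    go (suc k) = <-trans (go k) (<-respˡ-≈ (+-identityˡ _) (+-monoˡ-< _ 0<x))

  #0⇒ : ∀ {x} → x # 0# → x < 0# ⊎ 0# < x
  #0⇒ = #⇒<⊎>

  ¬#⇒≈ : ∀ {x y} → ¬ x # y → x ≈ y
  ¬#⇒≈ {x} {y} = proj₁ (tight x y)

  private
    x-0≈x : ∀ x → x - 0# ≈ x
    x-0≈x x = trans (+-congˡ -0#≈0#) (+-identityʳ x)

  inverse-pos : ∀ {x y} → 0# < x → x * y ≈ 1# → 0# < y
  inverse-pos {x} {y} 0<x xy≈1 with #⇒<⊎> (invertible⇒# {y} {0#} (x , trans (*-congˡ (x-0≈x y)) xy≈1 , trans (*-congʳ (x-0≈x y)) (trans (*-comm y x) xy≈1)))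
  ... | inj₂ 0<y = 0<y
  ... | inj₁ y<0 = contradiction (<-trans 0<1 (<-resp-≈ xy≈1 (zeroʳ x) (*-monoʳ-< x 0<x y<0))) (<-irrefl refl)

  #0⇒inverse : ∀ {x} → x # 0# → ∃ λ y → x * y ≈ 1#
  #0⇒inverse {x} l with #⇒invertible l
  ... | y , yx≈1 , _ = y , trans (*-comm x y) (trans (*-congˡ (sym (x-0≈x x))) yx≈1)

  inverse : ∀ {x} → 0# < x → ∃ λ y → 0# < y ∧ (x * y ≈ 1#)
  inverse {x} 0<x with #0⇒inverse (#-sym (<⇒# 0<x))
  ... | y , xy≈1 = y , inverse-pos 0<x xy≈1 , xy≈1

  1/-correct : ∀ n .{{_ : NonZero n}} → (n × 1#) * (1/ n) ≈ 1#
  1/-correct n = trans (*-congʳ (sym (x-0≈x (n × 1#)))) (proj₂ (proj₂ (#⇒invertible (#-sym (<⇒# (0<n·1 n))))))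

  1/-pos : ∀ n .{{_ : NonZero n}} → 0# < 1/ n
  1/-pos n = inverse-pos (0<n·1 n) (1/-correct n)

  quotient : ∀ {x ε} → 0# < x → 0# < ε → ∃ λ δ → 0# < δ ∧ (δ * x ≈ ε)
  quotient {x} {ε} 0<x 0<ε with inverse 0<x
  ... | y , 0<y , xy≈1 = ε * y , *-pos 0<ε 0<y , trans (*-assoc ε y x) (trans (*-congˡ (trans (*-comm y x) xy≈1)) (*-identityʳ ε))

  archimedean-unit : ∀ x {ε} → 0# < ε → ∃ λ n → x < n × ε
  archimedean-unit x {ε} 0<ε with inverse 0<ε
  ... | y , 0<y , εy≈1 with archimedean (x * y)
  ... | n , l = n , <-resp-≈ (trans (*-assoc x y ε) (trans (*-congˡ (trans (*-comm y ε) εy≈1)) (*-identityʳ x))) (sym (×≈×1* n ε)) (*-monoˡ-< ε 0<ε l)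

  ×1≉0 : ∀ n → n × 1# ≈ 0# → n ≡ 0
  ×1≉0 zero    _ = ≡.refl
  ×1≉0 (suc n) e = contradiction (×-pos n 0<1) (<-irrefl (sym e))

  -- The sign of x cannot be decided, but under x x < 0 both signs are absurd. Tightness then gives
  -- x ≈ 0, and so 0 < 0.
  square-nonneg : ∀ x → ¬ x * x < 0#
  square-nonneg x l = <-irrefl refl (<-respʳ-≈ xx≈0 (<-respˡ-≈ refl l))
    where
    x≈0 : x ≈ 0#
    x≈0 = ¬#⇒≈ λ x#0 → go (#0⇒ x#0)
      where
      go : x < 0# ⊎ 0# < x → _
      go (inj₂ 0<x) = <-irrefl refl (<-trans l (*-pos 0<x 0<x))
      go (inj₁ x<0) = <-irrefl refl (<-trans l (<-respʳ-≈ (solve 1 (λ x → (:- x) :* (:- x) := x :* x) refl x) (*-pos 0<-x 0<-x)))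
        where
        0<-x : 0# < - x
        0<-x = <-respˡ-≈ -0#≈0# (neg-mono-< x<0)
    xx≈0 : 0# ≈ x * x
    xx≈0 = sym (trans (*-congʳ x≈0) (zeroˡ x))

  sum-of-squares≈0 : ∀ {x y} → x * x + y * y ≈ 0# → x ≈ 0#
  sum-of-squares≈0 {x} {y} e = ¬#⇒≈ λ x#0 → square-nonneg y (negative (square-pos (#0⇒ x#0)))
    where
    square-pos : x < 0# ⊎ 0# < x → 0# < x * x
    square-pos (inj₂ 0<x) = *-pos 0<x 0<x
    square-pos (inj₁ x<0) = <-respʳ-≈ (solve 1 (λ x → (:- x) :* (:- x) := x :* x) refl x) (*-pos 0<-x 0<-x)
      where
      0<-x : 0# < - x
      0<-x = <-respˡ-≈ -0#≈0# (neg-mono-< x<0)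
    negative : 0# < x * x → y * y < 0#
    negative l = <-resp-≈ (+-identityˡ (y * y)) e (+-monoˡ-< (y * y) l)

-- The ring of complex numbers and conjugation.

module ComplexRing {c ℓ₁ ℓ₂ ℓ₃} (R : RealNumbers c ℓ₁ ℓ₂ ℓ₃) where
  private module ℝ = Reals R
  open ℝ using (solve; _:=_; _:+_; _:*_; _:-_; :-_; con)
  open Complex R
  open import Algebra.Bundles using (CommutativeRing)
  open import Data.Integer.Base using (+_)
  open import Data.Nat.Base using (zero; suc)
  open import Data.Product.Base using (_,_; proj₁; proj₂; ∃)
  open import Relation.Nullary.Negation.Core using (¬_)
  open import Relation.Binary.PropositionalEquality.Core as ≡ using (_≡_)

  ℂ-commutativeRing : CommutativeRing c ℓ₁
  ℂ-commutativeRing = record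
    { Carrier = ℂ ; _≈_ = _≈_ ; _+_ = _+_ ; _*_ = _*_ ; -_ = -_ ; 0# = 0# ; 1# = 1#
    ; isCommutativeRing = record
      { isRing = record
        { +-isAbelianGroup = record
          { isGroup = record
            { isMonoid = record
              { isSemigroup = record
                { isMagma = record
                  { isEquivalence = record
                    { refl = ℝ.refl , ℝ.refl
                    ; sym = λ (e , f) → ℝ.sym e , ℝ.sym f
                    ; trans = λ (e , f) (e' , f') → ℝ.trans e e' , ℝ.trans f f' }
                  ; ∙-cong = λ (e , f) (e' , f') → ℝ.+-cong e e' , ℝ.+-cong f f' }
                ; assoc = λ x y z → ℝ.+-assoc _ _ _ , ℝ.+-assoc _ _ _ }
              ; identity = (λ x → ℝ.+-identityˡ _ , ℝ.+-identityˡ _) , λ x → ℝ.+-identityʳ _ , ℝ.+-identityʳ _ }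
            ; inverse = (λ x → ℝ.-‿inverseˡ _ , ℝ.-‿inverseˡ _) , λ x → ℝ.-‿inverseʳ _ , ℝ.-‿inverseʳ _
            ; ⁻¹-cong = λ (e , f) → ℝ.-‿cong e , ℝ.-‿cong f }
          ; comm = λ x y → ℝ.+-comm _ _ , ℝ.+-comm _ _ }
        ; *-cong = λ (e , f) (e' , f') →
            ℝ.+-cong (ℝ.*-cong e e') (ℝ.-‿cong (ℝ.*-cong f f')) , ℝ.+-cong (ℝ.*-cong e f') (ℝ.*-cong f e')
        ; *-assoc = λ (a +i b) (x +i y) (u +i v) →
            solve 6 (λ a b x y u v → (a :* x :- b :* y) :* u :- (a :* y :+ b :* x) :* v
              := a :* (x :* u :- y :* v) :- b :* (x :* v :+ y :* u)) ℝ.refl a b x y u v ,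
            solve 6 (λ a b x y u v → (a :* x :- b :* y) :* v :+ (a :* y :+ b :* x) :* u
              := a :* (x :* v :+ y :* u) :+ b :* (x :* u :- y :* v)) ℝ.refl a b x y u v
        ; *-identity = (λ z → *-identityˡ z) , λ z → trans≈ (*-comm z 1#) (*-identityˡ z)
        ; distrib = (λ z w u → distribˡ z w u) , λ z w u → trans≈ (*-comm (w + u) z)
            (trans≈ (distribˡ z w u) (+≈ (*-comm z w) (*-comm z u))) }
      ; *-comm = *-comm } }
    where
    trans≈ : ∀ {x y z} → x ≈ y → y ≈ z → x ≈ z
    trans≈ (e , f) (e' , f') = ℝ.trans e e' , ℝ.trans f f'
    +≈ : ∀ {x y u v} → x ≈ y → u ≈ v → x + u ≈ y + v
    +≈ (e , f) (e' , f') = ℝ.+-cong e e' , ℝ.+-cong f f'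
    *-comm : ∀ z w → z * w ≈ w * z
    *-comm (a +i b) (x +i y) =
      solve 4 (λ a b x y → a :* x :- b :* y := x :* a :- y :* b) ℝ.refl a b x y ,
      solve 4 (λ a b x y → a :* y :+ b :* x := x :* b :+ y :* a) ℝ.refl a b x y
    *-identityˡ : ∀ z → 1# * z ≈ z
    *-identityˡ (a +i b) =
      ℝ.trans (ℝ.+-cong (ℝ.*-identityˡ a) (ℝ.trans (ℝ.-‿cong (ℝ.zeroˡ b)) ℝ.-0#≈0#)) (ℝ.+-identityʳ a) ,
      ℝ.trans (ℝ.+-cong (ℝ.*-identityˡ b) (ℝ.zeroˡ a)) (ℝ.+-identityʳ b)
    distribˡ : ∀ z w u → z * (w + u) ≈ z * w + z * u
    distribˡ (a +i b) (x +i y) (u +i v) =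
      solve 6 (λ a b x y u v → a :* (x :+ u) :- b :* (y :+ v) := (a :* x :- b :* y) :+ (a :* u :- b :* v)) ℝ.refl a b x y u v ,
      solve 6 (λ a b x y u v → a :* (y :+ v) :+ b :* (x :+ u) := (a :* y :+ b :* x) :+ (a :* v :+ b :* u)) ℝ.refl a b x y u v


  private module ℂR = RingKit ℂ-commutativeRing
  open ℂR using (_×_)

  conj-+ : ∀ z w → conj (z + w) ≈ conj z + conj w
  conj-+ (a +i b) (x +i y) = ℝ.refl , solve 2 (λ b y → :- (b :+ y) := (:- b) :+ (:- y)) ℝ.refl b y

  conj-* : ∀ z w → conj (z * w) ≈ conj z * conj w
  conj-* (a +i b) (x +i y) =
    solve 4 (λ a b x y → a :* x :- b :* y := a :* x :- (:- b) :* (:- y)) ℝ.refl a b x y ,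
    solve 4 (λ a b x y → :- (a :* y :+ b :* x) := a :* (:- y) :+ (:- b) :* x) ℝ.refl a b x y

  conj-0 : conj 0# ≈ 0#
  conj-0 = ℝ.refl , ℝ.-0#≈0#

  conj-1 : conj 1# ≈ 1#
  conj-1 = ℝ.refl , ℝ.-0#≈0#

  conj-^ : ∀ z n → conj (z ^ n) ≈ conj z ^ n
  conj-^ z zero    = conj-1
  conj-^ z (suc n) = ℂR.trans (conj-* z (z ^ n)) (ℂR.*-congˡ {conj z} (conj-^ z n))

  *-conj : ∀ z → z * conj z ≈ (re z ℝ.* re z ℝ.+ im z ℝ.* im z) +i ℝ.0#
  *-conj (a +i b) =
    solve 2 (λ a b → a :* a :- b :* (:- b) := a :* a :+ b :* b) ℝ.refl a b ,
    solve 2 (λ a b → a :* (:- b) :+ b :* a := con (+ 0)) ℝ.refl a b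

  re-× : ∀ n z → re (n × z) ≡ n ℝ.× re z
  re-× zero    z = ≡.refl
  re-× (suc n) z = ≡.cong (re z ℝ.+_) (re-× n z)

  im-× : ∀ n z → im (n × z) ≡ n ℝ.× im z
  im-× zero    z = ≡.refl
  im-× (suc n) z = ≡.cong (im z ℝ.+_) (im-× n z)

  char0 : ∀ n → n × 1# ≈ 0# → n ≡ 0
  char0 n (e , _) = ℝ.×1≉0 n (ℝ.trans (ℝ.reflexive (≡.sym (re-× n 1#))) e)

  -- Mere inequality z ≉ 0 gives no inverse of z. Instead, a component of w apart from 0 would be
  -- invertible, so N = z · conj z would vanish, and z with it. Tightness turns this into the
  -- vanishing of both components.
  cancel-≉0 : ∀ {z} → ¬ z ≈ 0# → ∀ w → z * w ≈ 0# → w ≈ 0#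
  cancel-≉0 {z} z≉0 w zw≈0 =
    annihilated (ℝ.trans (solve 3 (λ N x y → N :* x := (N :* x :- con (+ 0) :* y)) ℝ.refl N (re w) (im w)) (proj₁ Nw≈0)) ,
    annihilated (ℝ.trans (solve 3 (λ N x y → N :* y := (N :* y :+ con (+ 0) :* x)) ℝ.refl N (re w) (im w)) (proj₂ Nw≈0))
    where
    N = re z ℝ.* re z ℝ.+ im z ℝ.* im z
    Nw≈0 : (N +i ℝ.0#) * w ≈ 0#
    Nw≈0 = ℂR.trans (ℂR.*-congʳ {w} (ℂR.sym (*-conj z))) (ℂR.trans (ℂR.*-congʳ {w} (ℂR.*-comm z (conj z)))
      (ℂR.trans (ℂR.*-assoc (conj z) z w) (ℂR.trans (ℂR.*-congˡ {conj z} zw≈0) (ℂR.zeroʳ (conj z)))))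
    annihilated : ∀ {x} → N ℝ.* x ℝ.≈ ℝ.0# → x ℝ.≈ ℝ.0#
    annihilated {x} Nx≈0 = ℝ.¬#⇒≈ λ x#0 → z≉0 (z≈0 (N≈0 (ℝ.#0⇒inverse x#0)))
      where
      N≈0 : ∃ (λ y → x ℝ.* y ℝ.≈ ℝ.1#) → N ℝ.≈ ℝ.0#
      N≈0 (y , xy≈1) = ℝ.trans (ℝ.sym (ℝ.*-identityʳ N)) (ℝ.trans (ℝ.*-congˡ (ℝ.sym xy≈1))
        (ℝ.trans (ℝ.sym (ℝ.*-assoc N x y)) (ℝ.trans (ℝ.*-congʳ Nx≈0) (ℝ.zeroˡ y))))
      z≈0 : N ℝ.≈ ℝ.0# → z ≈ 0#
      z≈0 e = ℝ.sum-of-squares≈0 e , ℝ.sum-of-squares≈0 (ℝ.trans (ℝ.+-comm _ _) e)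

-- Products of partial sums of the exponential series.

module ExpSeries {c ℓ} (K : CommutativeRing c ℓ) where
  open RingKit K
  import Algebra.Properties.CommutativeSemiring.Binomial commutativeSemiring as Binom

  open import Data.Nat.Base as ℕ using (ℕ; zero; suc; _!)
  import Data.Nat.Properties as ℕ
  open import Data.Nat.Combinatorics using (_C_; nCk≡n!/k![n-k]!; k![n∸k]!∣n!)
  open import Data.Nat.DivMod using (m/n*n≡m)
  open import Relation.Binary.PropositionalEquality.Core as ≡ using (_≡_)
  open import Relation.Binary.Reasoning.Setoid setoid

  nCk*k![n∸k]!≡n! : ∀ {n k} → k ℕ.≤ n → (n C k) ℕ.* (k ! ℕ.* (n ℕ.∸ k) !) ≡ n !
  nCk*k![n∸k]!≡n! {n} {k} k≤n = ≡.trans (≡.cong (ℕ._* (k ! ℕ.* (n ℕ.∸ k) !)) (nCk≡n!/k![n-k]! k≤n))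
    (m/n*n≡m {{k ℕ.!* (n ℕ.∸ k) !≢0}} (k![n∸k]!∣n! k≤n))

  -- The index pairs with sum below n are summed along rows instead of antidiagonals.
  cauchy-product : ∀ n (a b : ℕ → Carrier) →
    ∑ n (λ j → ∑ (suc j) (λ k → a k * b (j ℕ.∸ k))) ≈ ∑ n (λ k → a k * ∑ (n ℕ.∸ k) b)
  cauchy-product zero    a b = refl
  cauchy-product (suc n) a b = begin
    ∑ n (λ j → ∑ (suc j) (λ k → a k * b (j ℕ.∸ k))) + ∑ (suc n) (λ k → a k * b (n ℕ.∸ k))
      ≈⟨ +-congʳ (cauchy-product n a b) ⟩
    ∑ n (λ k → a k * ∑ (n ℕ.∸ k) b) + ∑ (suc n) (λ k → a k * b (n ℕ.∸ k))
      ≈⟨ +-congʳ (trans (sym (+-identityʳ _)) (+-congˡ (sym (trans (*-congˡ (reflexive (≡.cong (λ r → ∑ r b) (ℕ.n∸n≡0 n)))) (zeroʳ (a n)))))) ⟩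
    ∑ (suc n) (λ k → a k * ∑ (n ℕ.∸ k) b) + ∑ (suc n) (λ k → a k * b (n ℕ.∸ k))
      ≈⟨ ∑-+ (suc n) _ _ ⟨
    ∑ (suc n) (λ k → a k * ∑ (n ℕ.∸ k) b + a k * b (n ℕ.∸ k))
      ≈⟨ ∑-cong (suc n) (λ k k<1+n → trans (sym (distribˡ (a k) _ _)) (*-congˡ (reflexive (≡.cong (λ r → ∑ r b) (≡.sym (ℕ.+-∸-assoc 1 (ℕ.≤-pred k<1+n))))))) ⟩
    ∑ (suc n) (λ k → a k * ∑ (suc n ℕ.∸ k) b) ∎

  product-difference : ∀ n (a b : ℕ → Carrier) →
    ∑ n a * ∑ n b - ∑ n (λ k → a k * ∑ (n ℕ.∸ k) b) ≈ ∑ n (λ k → a k * (∑ n b - ∑ (n ℕ.∸ k) b))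
  product-difference n a b = begin
    ∑ n a * ∑ n b - ∑ n (λ k → a k * ∑ (n ℕ.∸ k) b)
      ≈⟨ solve 3 (λ x y u → x :* y :- u := x :* y :+ :- u) refl (∑ n a) (∑ n b) _ ⟩
    ∑ n a * ∑ n b + - ∑ n (λ k → a k * ∑ (n ℕ.∸ k) b)
      ≈⟨ +-cong (∑-*ʳ n (∑ n b) a) (trans (trans (trans (-‿cong (sym (*-identityˡ _))) (-‿distribˡ-* 1# _)) (∑-*ˡ n (- 1#) _))
           (∑-cong n (λ k _ → trans (sym (-‿distribˡ-* 1# _)) (-‿cong (*-identityˡ _))))) ⟩
    ∑ n (λ k → a k * ∑ n b) + ∑ n (λ k → - (a k * ∑ (n ℕ.∸ k) b))
      ≈⟨ ∑-+ n _ _ ⟨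
    ∑ n (λ k → a k * ∑ n b - a k * ∑ (n ℕ.∸ k) b)
      ≈⟨ ∑-cong n (λ k _ → sym (x[y-z]≈xy-xz (a k) _ _)) ⟩
    ∑ n (λ k → a k * (∑ n b - ∑ (n ℕ.∸ k) b)) ∎

  module _ (φ : ℕ → Carrier) (k!φ≈1 : ∀ k → (k !) × φ k ≈ 1#) where

    term : Carrier → ℕ → Carrier
    term z k = φ k * z ^ k

    φ-binomial : ∀ {n k} → k ℕ.≤ n → φ n * ((n C k) × 1#) ≈ φ k * φ (n ℕ.∸ k)
    φ-binomial {n} {k} k≤n = begin
      φ n * C₁                                               ≈⟨ trans (sym (*-identityʳ _)) (*-congˡ (sym (trans (*-cong (unit k) (unit (n ℕ.∸ k))) (*-identityˡ 1#)))) ⟩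
      φ n * C₁ * ((F k * φ k) * (F (n ℕ.∸ k) * φ (n ℕ.∸ k)))  ≈⟨ solve 6 (λ p c f x g y → p :* c :* ((f :* x) :* (g :* y)) := (c :* (f :* g)) :* p :* (x :* y)) refl (φ n) C₁ (F k) (φ k) (F (n ℕ.∸ k)) _ ⟩
      C₁ * (F k * F (n ℕ.∸ k)) * φ n * (φ k * φ (n ℕ.∸ k))    ≈⟨ *-congʳ (*-congʳ (trans (*-congˡ (sym (×1-homo-* (k !) ((n ℕ.∸ k) !)))) (sym (×1-homo-* (n C k) _)))) ⟩
      ((n C k) ℕ.* (k ! ℕ.* (n ℕ.∸ k) !)) × 1# * φ n * (φ k * φ (n ℕ.∸ k))
                                                             ≡⟨ ≡.cong (λ r → r × 1# * φ n * (φ k * φ (n ℕ.∸ k))) (nCk*k![n∸k]!≡n! k≤n) ⟩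
      F n * φ n * (φ k * φ (n ℕ.∸ k))                        ≈⟨ trans (*-congʳ (unit n)) (*-identityˡ _) ⟩
      φ k * φ (n ℕ.∸ k)                                      ∎
      where
      C₁ = (n C k) × 1#
      F : ℕ → Carrier
      F k = (k !) × 1#
      unit : ∀ k → F k * φ k ≈ 1#
      unit k = trans (sym (×≈×1* (k !) (φ k))) (k!φ≈1 k)

    term-+ : ∀ z w j → term (z + w) j ≈ ∑ (suc j) (λ k → term z k * term w (j ℕ.∸ k))
    term-+ z w j = begin
      φ j * (z + w) ^ j                                                       ≈⟨ *-congˡ (trans (Binom.theorem j z w) (sum≈∑ (suc j) _)) ⟩
      φ j * ∑ (suc j) (λ k → (j C k) × (z ^ k * w ^ (j ℕ.∸ k)))               ≈⟨ ∑-*ˡ (suc j) (φ j) _ ⟩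
      ∑ (suc j) (λ k → φ j * ((j C k) × (z ^ k * w ^ (j ℕ.∸ k))))             ≈⟨ ∑-cong (suc j) (λ k k<1+j → step k (ℕ.≤-pred k<1+j)) ⟩
      ∑ (suc j) (λ k → term z k * term w (j ℕ.∸ k))                           ∎
      where
      step : ∀ k → k ℕ.≤ j → φ j * ((j C k) × (z ^ k * w ^ (j ℕ.∸ k))) ≈ term z k * term w (j ℕ.∸ k)
      step k k≤j = begin
        φ j * ((j C k) × (z ^ k * w ^ (j ℕ.∸ k)))            ≈⟨ trans (*-congˡ (×≈×1* (j C k) _)) (sym (*-assoc (φ j) _ _)) ⟩
        φ j * ((j C k) × 1#) * (z ^ k * w ^ (j ℕ.∸ k))       ≈⟨ *-congʳ (φ-binomial k≤j) ⟩
        φ k * φ (j ℕ.∸ k) * (z ^ k * w ^ (j ℕ.∸ k))          ≈⟨ solve 4 (λ a b x y → a :* b :* (x :* y) := (a :* x) :* (b :* y)) refl _ _ _ _ ⟩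
        term z k * term w (j ℕ.∸ k)                          ∎

    -- What the square of index pairs has beyond the triangle of those with sum below n: each term
    -- of one series meets only a tail of the other, which makes the difference small.
    partial-product : ∀ z w n →
      ∑ n (term z) * ∑ n (term w) - ∑ n (term (z + w)) ≈ ∑ n (λ k → term z k * (∑ n (term w) - ∑ (n ℕ.∸ k) (term w)))
    partial-product z w n = trans
      (+-congˡ (-‿cong (trans (∑-cong n (λ j _ → term-+ z w j)) (cauchy-product n (term z) (term w)))))
      (product-difference n (term z) (term w))

-- Bounds for complex numbers and null sequences.

module Majorant {c ℓ₁ ℓ₂ ℓ₃} (R : RealNumbers c ℓ₁ ℓ₂ ℓ₃) where
  private module ℝ = Reals R
  open ℝ using (_<_) renaming (Carrier to ℝ)
  open Complex R using (ℂ; _+i_; re; im; conj)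
  open ComplexRing R using (ℂ-commutativeRing)
  open RingKit ℂ-commutativeRing

  open import Data.Integer.Base using (+_)
  open import Data.Nat.Base as ℕ using (ℕ; zero; suc)
  import Data.Nat.Properties as ℕ
  open import Data.Product.Base using (_,_; proj₁; proj₂; ∃) renaming (_×_ to _∧_)
  open import Data.Empty using (⊥)
  open import Data.Sum.Base using (_⊎_; inj₁; inj₂)
  open import Level using (_⊔_)

  infixl 7 _∙_
  infixl 6 _⊞_
  private
    _∙_ = ℝ._*_
    _⊞_ = ℝ._+_

  -- Bounds the 1-norm without absolute values: z lies in B times the open
  -- convex hull of 1, −1, i, −i, which is closed under multiplication.
  record Maj (z : ℂ) (B : ℝ) : Set (c ⊔ ℓ₁ ⊔ ℓ₃) where
    constructor maj
    field
      {a₊ a₋ b₊ b₋} : ℝ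
      0<a₊ : ℝ.0# < a₊
      0<a₋ : ℝ.0# < a₋
      0<b₊ : ℝ.0# < b₊
      0<b₋ : ℝ.0# < b₋
      re≈  : re z ℝ.≈ a₊ ℝ.- a₋
      im≈  : im z ℝ.≈ b₊ ℝ.- b₋
      sum< : a₊ ⊞ a₋ ⊞ (b₊ ⊞ b₋) < B

  Maj-resp : ∀ {z w B} → z ≈ w → Maj z B → Maj w B
  Maj-resp (e , f) (maj p q r s x y l) = maj p q r s (ℝ.trans (ℝ.sym e) x) (ℝ.trans (ℝ.sym f) y) l

  Maj-respʳ : ∀ {z B C} → B ℝ.≈ C → Maj z B → Maj z C
  Maj-respʳ e (maj p q r s x y l) = maj p q r s x y (ℝ.<-respʳ-≈ e l)

  Maj-mono : ∀ {z B C} → B < C → Maj z B → Maj z C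
  Maj-mono l' (maj p q r s x y l) = maj p q r s x y (ℝ.<-trans l l')

  Maj-pos : ∀ {z B} → Maj z B → ℝ.0# < B
  Maj-pos (maj p q r s x y l) = ℝ.<-trans (ℝ.+-pos (ℝ.+-pos p q) (ℝ.+-pos r s)) l

  Maj-+ : ∀ {z w B C} → Maj z B → Maj w C → Maj (z + w) (B ⊞ C)
  Maj-+ (maj p q r s x y l) (maj p' q' r' s' x' y' l') = maj
    (ℝ.+-pos p p') (ℝ.+-pos q q') (ℝ.+-pos r r') (ℝ.+-pos s s')
    (ℝ.trans (ℝ.+-cong x x') (rearr _ _ _ _)) (ℝ.trans (ℝ.+-cong y y') (rearr _ _ _ _))
    (ℝ.<-respˡ-≈ (ℝ.solve 8 (λ a b c d a' b' c' d' → (a ℝ.:+ b ℝ.:+ (c ℝ.:+ d)) ℝ.:+ (a' ℝ.:+ b' ℝ.:+ (c' ℝ.:+ d'))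
        ℝ.:= (a ℝ.:+ a') ℝ.:+ (b ℝ.:+ b') ℝ.:+ ((c ℝ.:+ c') ℝ.:+ (d ℝ.:+ d'))) ℝ.refl _ _ _ _ _ _ _ _) (ℝ.+-mono-< l l'))
    where
    rearr : ∀ a b a' b' → (a ℝ.- b) ⊞ (a' ℝ.- b') ℝ.≈ (a ⊞ a') ℝ.- (b ⊞ b')
    rearr = ℝ.solve 4 (λ a b a' b' → (a ℝ.:- b) ℝ.:+ (a' ℝ.:- b') ℝ.:= (a ℝ.:+ a') ℝ.:- (b ℝ.:+ b')) ℝ.refl

  -- The sixteen products of positive parts are dealt out by sign and by real or imaginary type;
  -- their total is the product of the two totals.
  Maj-* : ∀ {z w B C} → Maj z B → Maj w C → Maj (z * w) (B ∙ C)
  Maj-* M@(maj {a} {b} {c} {d} p q r s x y l) (maj {a'} {b'} {c'} {d'} p' q' r' s' x' y' l') = maj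
    (four (ℝ.*-pos p p') (ℝ.*-pos q q') (ℝ.*-pos r s') (ℝ.*-pos s r'))
    (four (ℝ.*-pos p q') (ℝ.*-pos q p') (ℝ.*-pos r r') (ℝ.*-pos s s'))
    (four (ℝ.*-pos p r') (ℝ.*-pos q s') (ℝ.*-pos r p') (ℝ.*-pos s q'))
    (four (ℝ.*-pos p s') (ℝ.*-pos q r') (ℝ.*-pos r q') (ℝ.*-pos s p'))
    (ℝ.trans (ℝ.+-cong (ℝ.*-cong x x') (ℝ.-‿cong (ℝ.*-cong y y')))
      (ℝ.solve 8 (λ a b c d a' b' c' d' → (a ℝ.:- b) ℝ.:* (a' ℝ.:- b') ℝ.:- (c ℝ.:- d) ℝ.:* (c' ℝ.:- d')
        ℝ.:= ((a ℝ.:* a' ℝ.:+ b ℝ.:* b') ℝ.:+ (c ℝ.:* d' ℝ.:+ d ℝ.:* c')) ℝ.:- ((a ℝ.:* b' ℝ.:+ b ℝ.:* a') ℝ.:+ (c ℝ.:* c' ℝ.:+ d ℝ.:* d')))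
        ℝ.refl a b c d a' b' c' d'))
    (ℝ.trans (ℝ.+-cong (ℝ.*-cong x y') (ℝ.*-cong y x'))
      (ℝ.solve 8 (λ a b c d a' b' c' d' → (a ℝ.:- b) ℝ.:* (c' ℝ.:- d') ℝ.:+ (c ℝ.:- d) ℝ.:* (a' ℝ.:- b')
        ℝ.:= ((a ℝ.:* c' ℝ.:+ b ℝ.:* d') ℝ.:+ (c ℝ.:* a' ℝ.:+ d ℝ.:* b')) ℝ.:- ((a ℝ.:* d' ℝ.:+ b ℝ.:* c') ℝ.:+ (c ℝ.:* b' ℝ.:+ d ℝ.:* a')))
        ℝ.refl a b c d a' b' c' d'))
    (ℝ.<-respˡ-≈
      (ℝ.solve 8 (λ a b c d a' b' c' d' → (a ℝ.:+ b ℝ.:+ (c ℝ.:+ d)) ℝ.:* (a' ℝ.:+ b' ℝ.:+ (c' ℝ.:+ d'))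
        ℝ.:= (((a ℝ.:* a' ℝ.:+ b ℝ.:* b') ℝ.:+ (c ℝ.:* d' ℝ.:+ d ℝ.:* c')) ℝ.:+ ((a ℝ.:* b' ℝ.:+ b ℝ.:* a') ℝ.:+ (c ℝ.:* c' ℝ.:+ d ℝ.:* d')))
          ℝ.:+ (((a ℝ.:* c' ℝ.:+ b ℝ.:* d') ℝ.:+ (c ℝ.:* a' ℝ.:+ d ℝ.:* b')) ℝ.:+ ((a ℝ.:* d' ℝ.:+ b ℝ.:* c') ℝ.:+ (c ℝ.:* b' ℝ.:+ d ℝ.:* a'))))
        ℝ.refl a b c d a' b' c' d')
      (ℝ.*-mono-< (Maj-pos M) (ℝ.+-pos (ℝ.+-pos p' q') (ℝ.+-pos r' s')) l l'))
    where
    four : ∀ {x y u v} → ℝ.0# < x → ℝ.0# < y → ℝ.0# < u → ℝ.0# < v → ℝ.0# < (x ⊞ y) ⊞ (u ⊞ v)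
    four x y u v = ℝ.+-pos (ℝ.+-pos x y) (ℝ.+-pos u v)

  Maj-scale : ∀ {r z B} → ℝ.0# < r → Maj z B → Maj ((r +i ℝ.0#) * z) (r ∙ B)
  Maj-scale {r} {z} 0<r (maj {a} {b} {c} {d} p q t s x y l) = maj (ℝ.*-pos 0<r p) (ℝ.*-pos 0<r q) (ℝ.*-pos 0<r t) (ℝ.*-pos 0<r s)
    (ℝ.trans (ℝ.solve 3 (λ r u v → r ℝ.:* u ℝ.:- ℝ.con (+ 0) ℝ.:* v ℝ.:= r ℝ.:* u) ℝ.refl r (re z) (im z)) (ℝ.trans (ℝ.*-congˡ x) (ℝ.x[y-z]≈xy-xz r a b)))
    (ℝ.trans (ℝ.solve 3 (λ r u v → r ℝ.:* v ℝ.:+ ℝ.con (+ 0) ℝ.:* u ℝ.:= r ℝ.:* v) ℝ.refl r (re z) (im z)) (ℝ.trans (ℝ.*-congˡ y) (ℝ.x[y-z]≈xy-xz r c d)))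
    (ℝ.<-respˡ-≈ (ℝ.solve 5 (λ r a b c d → r ℝ.:* (a ℝ.:+ b ℝ.:+ (c ℝ.:+ d)) ℝ.:= r ℝ.:* a ℝ.:+ r ℝ.:* b ℝ.:+ (r ℝ.:* c ℝ.:+ r ℝ.:* d)) ℝ.refl r a b c d) (ℝ.*-monoʳ-< r 0<r l))

  Maj-neg : ∀ {z B} → Maj z B → Maj (- z) B
  Maj-neg (maj p q r s x y l) = maj q p s r (ℝ.trans (ℝ.-‿cong x) (flip _ _)) (ℝ.trans (ℝ.-‿cong y) (flip _ _))
    (ℝ.<-respˡ-≈ (ℝ.+-cong (ℝ.+-comm _ _) (ℝ.+-comm _ _)) l)
    where
    flip : ∀ a b → ℝ.- (a ℝ.- b) ℝ.≈ b ℝ.- a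
    flip = ℝ.solve 2 (λ a b → ℝ.:- (a ℝ.:- b) ℝ.:= b ℝ.:- a) ℝ.refl

  Maj-conj : ∀ {z B} → Maj z B → Maj (conj z) B
  Maj-conj (maj p q r s x y l) = maj p q s r x (ℝ.trans (ℝ.-‿cong y) (flip _ _))
    (ℝ.<-respˡ-≈ (ℝ.+-congˡ (ℝ.+-comm _ _)) l)
    where
    flip : ∀ a b → ℝ.- (a ℝ.- b) ℝ.≈ b ℝ.- a
    flip = ℝ.solve 2 (λ a b → ℝ.:- (a ℝ.:- b) ℝ.:= b ℝ.:- a) ℝ.refl

  -- Without deciding the sign of x, write x = (x + ε) - ε. Both parts are positive with total below
  -- 3ε, and the two components together give 6ε.
  bounded⇒Maj : ∀ {z ε} → ℝ.- ε < re z → re z < ε → ℝ.- ε < im z → im z < ε → ℝ.0# < ε → Maj z (6 ℝ.× ε)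
  bounded⇒Maj {z} {ε} l u l' u' 0<ε = maj (pos l) 0<ε (pos l') 0<ε (split (re z)) (split (im z))
    (ℝ.<-respˡ-≈ (ℝ.solve 3 (λ x y e → (x ℝ.:+ (y ℝ.:+ (e ℝ.:+ (e ℝ.:+ (e ℝ.:+ (e ℝ.:+ ℝ.con (+ 0))))))) ℝ.:= (x ℝ.:+ e ℝ.:+ e) ℝ.:+ (y ℝ.:+ e ℝ.:+ e)) ℝ.refl (re z) (im z) ε)
      (ℝ.+-mono-< u (ℝ.+-monoˡ-< (4 ℝ.× ε) u')))
    where
    pos : ∀ {x} → ℝ.- ε < x → ℝ.0# < x ⊞ ε
    pos l = ℝ.<-respˡ-≈ (ℝ.-‿inverseˡ ε) (ℝ.+-monoˡ-< ε l)
    split : ∀ x → x ℝ.≈ x ⊞ ε ℝ.- ε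
    split x = ℝ.solve 2 (λ x e → x ℝ.:= x ℝ.:+ e ℝ.:- e) ℝ.refl x ε

  private
    component-bounds : ∀ {x a b s B} → ℝ.0# < a → ℝ.0# < b → ℝ.0# < s → x ℝ.≈ a ℝ.- b → a ⊞ b ⊞ s < B → (ℝ.- B < x) ∧ (x < B)
    component-bounds {x} {a} {b} {s} {B} 0<a 0<b 0<s e l =
      ℝ.<-resp-≈ ℝ.refl (ℝ.sym e) (ℝ.<-trans (ℝ.neg-mono-< l) (ℝ.0<-⇒< (ℝ.<-respʳ-≈ (ℝ.solve 3 (λ a b s → a ℝ.:+ a ℝ.:+ s ℝ.:= (a ℝ.:- b) ℝ.:- (ℝ.:- (a ℝ.:+ b ℝ.:+ s))) ℝ.refl a b s) (ℝ.+-pos (ℝ.+-pos 0<a 0<a) 0<s)))) ,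
      ℝ.<-respˡ-≈ (ℝ.sym e) (ℝ.<-trans (ℝ.0<-⇒< (ℝ.<-respʳ-≈ (ℝ.solve 3 (λ a b s → b ℝ.:+ b ℝ.:+ s ℝ.:= (a ℝ.:+ b ℝ.:+ s) ℝ.:- (a ℝ.:- b)) ℝ.refl a b s) (ℝ.+-pos (ℝ.+-pos 0<b 0<b) 0<s))) l)

  Maj⇒re-bounds : ∀ {z B} → Maj z B → (ℝ.- B < re z) ∧ (re z < B)
  Maj⇒re-bounds (maj p q r s x y l) = component-bounds p q (ℝ.+-pos r s) x l

  Maj⇒im-bounds : ∀ {z B} → Maj z B → (ℝ.- B < im z) ∧ (im z < B)
  Maj⇒im-bounds (maj p q r s x y l) = component-bounds r s (ℝ.+-pos p q) y (ℝ.<-respˡ-≈ (ℝ.+-comm _ _) l)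

  Maj-0 : ∀ {ε} → ℝ.0# < ε → Maj 0# ε
  Maj-0 {ε} 0<ε with ℝ.quotient (ℝ.×-pos 5 ℝ.0<1) 0<ε
  ... | δ , 0<δ , e = Maj-respʳ (ℝ.trans (ℝ.trans (ℝ.×≈×1* 6 δ) (ℝ.*-comm _ δ)) e)
    (bounded⇒Maj (ℝ.<-respʳ-≈ ℝ.-0#≈0# (ℝ.neg-mono-< 0<δ)) 0<δ (ℝ.<-respʳ-≈ ℝ.-0#≈0# (ℝ.neg-mono-< 0<δ)) 0<δ 0<δ)

  -- The bound is a natural number so that its powers can be compared with factorials in ℕ.
  Maj-exists : ∀ z → ∃ λ n → Maj z (n ℝ.× ℝ.1#)
  Maj-exists z with ℝ.archimedean (re z) | ℝ.archimedean (ℝ.- re z) | ℝ.archimedean (im z) | ℝ.archimedean (ℝ.- im z)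
  ... | n₁ , l₁ | n₂ , l₂ | n₃ , l₃ | n₄ , l₄ = 6 ℕ.* N , Maj-respʳ (ℝ.×-assocˡ ℝ.1# 6 N)
      (bounded⇒Maj (below (raise l₂ (ℕ.≤-trans (ℕ.m≤n+m n₂ n₁) (ℕ.m≤m+n _ (n₃ ℕ.+ n₄)))))
        (raise l₁ (ℕ.≤-trans (ℕ.m≤m+n n₁ n₂) (ℕ.m≤m+n _ (n₃ ℕ.+ n₄))))
        (below (raise l₄ (ℕ.≤-trans (ℕ.m≤n+m n₄ n₃) (ℕ.m≤n+m _ (n₁ ℕ.+ n₂)))))
        (raise l₃ (ℕ.≤-trans (ℕ.m≤m+n n₃ n₄) (ℕ.m≤n+m _ (n₁ ℕ.+ n₂))))
        (ℝ.×-pos (n₁ ℕ.+ n₂ ℕ.+ (n₃ ℕ.+ n₄)) ℝ.0<1))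
    where
    N = suc (n₁ ℕ.+ n₂ ℕ.+ (n₃ ℕ.+ n₄))
    raise : ∀ {x n} → x < n ℝ.× ℝ.1# → n ℕ.≤ n₁ ℕ.+ n₂ ℕ.+ (n₃ ℕ.+ n₄) → x < N ℝ.× ℝ.1#
    raise l n≤ = ℝ.<-×-≤ ℝ.0<1 (ℕ.m≤n⇒m≤1+n n≤) l
    below : ∀ {x y} → ℝ.- x < y → ℝ.- y < x
    below {x} l = ℝ.<-respʳ-≈ (ℝ.-‿involutive x) (ℝ.neg-mono-< l)

  -- One summand B is added because bounds are strict: even the empty sum needs a positive one.
  Maj-∑ : ∀ n {f : ℕ → ℂ} {B} → ℝ.0# < B → (∀ i → i ℕ.< n → Maj (f i) B) → Maj (∑ n f) (suc n ℝ.× B)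
  Maj-∑ zero    0<B h = Maj-respʳ (ℝ.sym (ℝ.+-identityʳ _)) (Maj-0 0<B)
  Maj-∑ (suc n) 0<B h = Maj-respʳ (ℝ.+-comm _ _) (Maj-+ (Maj-∑ n 0<B (λ i i<n → h i (ℕ.m<n⇒m<1+n i<n))) (h n (ℕ.n<1+n n)))

  Null : (ℕ → ℂ) → Set _
  Null x = ∀ ε → ℝ.0# < ε → ∃ λ N → ∀ n → N ℕ.≤ n → Maj (x n) ε

  Null-resp : ∀ {x y : ℕ → ℂ} → (∀ n → x n ≈ y n) → Null x → Null y
  Null-resp e X ε 0<ε = proj₁ (X ε 0<ε) , λ n N≤n → Maj-resp (e n) (proj₂ (X ε 0<ε) n N≤n)

  Null-neg : ∀ {x : ℕ → ℂ} → Null x → Null (λ n → - x n)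
  Null-neg X ε 0<ε = proj₁ (X ε 0<ε) , λ n N≤n → Maj-neg (proj₂ (X ε 0<ε) n N≤n)

  Null-+ : ∀ {x y : ℕ → ℂ} → Null x → Null y → Null (λ n → x n + y n)
  Null-+ X Y ε 0<ε with ℝ.quotient (ℝ.×-pos 1 ℝ.0<1) 0<ε
  ... | δ , 0<δ , e with X δ 0<δ | Y δ 0<δ
  ... | N , hx | M , hy = N ℕ.+ M , λ n N+M≤n → Maj-respʳ (ℝ.trans (ℝ.trans (ℝ.+-congˡ (ℝ.sym (ℝ.+-identityʳ δ))) (ℝ.trans (ℝ.×≈×1* 2 δ) (ℝ.*-comm _ δ))) e)
        (Maj-+ (hx n (ℕ.≤-trans (ℕ.m≤m+n N M) N+M≤n)) (hy n (ℕ.≤-trans (ℕ.m≤n+m M N) N+M≤n)))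

  Null-* : ∀ {x y : ℕ → ℂ} {B} → Null x → (∃ λ N → ∀ n → N ℕ.≤ n → Maj (y n) B) → Null (λ n → x n * y n)
  Null-* {B = B} X (M , hy) ε 0<ε with ℝ.quotient (Maj-pos (hy M ℕ.≤-refl)) 0<ε
  ... | δ , 0<δ , e with X δ 0<δ
  ... | N , hx = N ℕ.+ M , λ n N+M≤n → Maj-respʳ e
        (Maj-* {B = δ} (hx n (ℕ.≤-trans (ℕ.m≤m+n N M) N+M≤n)) (hy n (ℕ.≤-trans (ℕ.m≤n+m M N) N+M≤n)))

  Null-const : ∀ {z} → Null (λ _ → z) → z ≈ 0#
  Null-const {z} Z = ℝ.¬#⇒≈ (λ l → absurd Maj⇒re-bounds (ℝ.#0⇒ l)) , ℝ.¬#⇒≈ (λ l → absurd Maj⇒im-bounds (ℝ.#0⇒ l))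
    where
    absurd : ∀ {x} → (∀ {B} → Maj z B → (ℝ.- B < x) ∧ (x < B)) → x < ℝ.0# ⊎ ℝ.0# < x → ⊥
    absurd {x} bounds (inj₂ 0<x) = ℝ.<-irrefl ℝ.refl (proj₂ (bounds (proj₂ (Z x 0<x) _ ℕ.≤-refl)))
    absurd {x} bounds (inj₁ x<0) = ℝ.<-irrefl ℝ.refl (ℝ.<-respˡ-≈ (ℝ.-‿involutive x)
      (proj₁ (bounds (proj₂ (Z (ℝ.- x) (ℝ.<-respˡ-≈ ℝ.-0#≈0# (ℝ.neg-mono-< x<0))) _ ℕ.≤-refl))))

-- The functional equation of exp and the root of unity ω.

module Exponential {c ℓ₁ ℓ₂ ℓ₃} (R : RealNumbers c ℓ₁ ℓ₂ ℓ₃) where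
  private module ℝ = Reals R
  open ℝ using (_<_) renaming (Carrier to ℝ)
  open Complex R using (ℂ; _+i_; re; conj; IsExp; IsExp2πi/; expPartialSum; expTerm)
  open ComplexRing R
  open RingKit ℂ-commutativeRing
  open Majorant R
  private module Series = ExpSeries ℂ-commutativeRing
  open import Algebra.Properties.CommutativeSemiring.Exp ℝ.commutativeSemiring using () renaming (^-distrib-* to ℝ^-distrib-*)

  open import Data.Nat.Base as ℕ using (ℕ; zero; suc; s≤s; z≤n; _!; NonZero)
  import Data.Nat.Properties as ℕ
  open import Data.Nat.Tactic.RingSolver as ℕSolver using ()
  open import Data.Product.Base using (_,_; proj₁; proj₂; ∃) renaming (_×_ to _∧_)
  open import Data.Sum.Base using (inj₁; inj₂)
  open import Relation.Nullary.Negation.Core using (¬_)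
  open import Relation.Binary.PropositionalEquality.Core as ≡ using (_≡_)

  -- Up to k = L + 1 the constant alone suffices; afterwards each new factor L + 1 is at most the
  -- new factor of k!.
  power≤factorial : ∀ L k → suc L ℕ.^ k ℕ.≤ suc L ℕ.^ suc L ℕ.* k !
  power≤factorial L k with ℕ.≤-total k (suc L)
  ... | inj₁ k≤L = ℕ.≤-trans (ℕ.^-monoʳ-≤ (suc L) k≤L)
        (ℕ.≤-trans (ℕ.≤-reflexive (≡.sym (ℕ.*-identityʳ _))) (ℕ.*-monoʳ-≤ (suc L ℕ.^ suc L) (ℕ.1≤n! k)))
  power≤factorial L zero    | inj₂ _ = ℕ.≤-trans (ℕ.^-monoʳ-≤ (suc L) {0} {suc L} z≤n) (ℕ.≤-reflexive (≡.sym (ℕ.*-identityʳ _)))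
  power≤factorial L (suc k) | inj₂ L≤k = ℕ.≤-trans (ℕ.*-mono-≤ L≤k (power≤factorial L k)) (ℕ.≤-reflexive (rearr (suc k) (suc L ℕ.^ suc L) (k !)))
    where
    rearr : ∀ a b c → a ℕ.* (b ℕ.* c) ≡ b ℕ.* (a ℕ.* c)
    rearr = ℕSolver.solve-∀

  cube≤8^ : ∀ n → suc n ℕ.* suc n ℕ.* suc n ℕ.≤ 8 ℕ.^ n
  cube≤8^ n = ℕ.≤-trans (ℕ.*-mono-≤ (ℕ.*-mono-≤ (linear n) (linear n)) (linear n)) (ℕ.≤-reflexive (cube n))
    where
    linear : ∀ n → suc n ℕ.≤ 2 ℕ.^ n
    linear zero    = ℕ.≤-refl
    linear (suc n) = ℕ.≤-trans (ℕ.≤-trans (s≤s (ℕ.m≤n+m (suc n) n)) (ℕ.≤-reflexive (rearr n))) (ℕ.*-monoʳ-≤ 2 (linear n))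
      where
      rearr : ∀ n → suc (n ℕ.+ suc n) ≡ 2 ℕ.* suc n
      rearr = ℕSolver.solve-∀
    cube : ∀ n → 2 ℕ.^ n ℕ.* 2 ℕ.^ n ℕ.* 2 ℕ.^ n ≡ 8 ℕ.^ n
    cube zero    = ≡.refl
    cube (suc n) = ≡.trans (rearr (2 ℕ.^ n)) (≡.cong (8 ℕ.*_) (cube n))
      where
      rearr : ∀ a → 2 ℕ.* a ℕ.* (2 ℕ.* a) ℕ.* (2 ℕ.* a) ≡ 8 ℕ.* (a ℕ.* a ℕ.* a)
      rearr = ℕSolver.solve-∀

  -- The ratio of the geometric majorant of the series. It is 1/8 because 8^n dominates (n + 1)³,
  -- the polynomial factor met in `discrepancy-null`.
  q : ℝ
  q = ℝ.1/ 8

  0<q : ℝ.0# < q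
  0<q = ℝ.1/-pos 8

  q<1 : q < ℝ.1#
  q<1 = ℝ.<-respʳ-≈ (ℝ.trans (ℝ.×≈×1* 8 q) (ℝ.1/-correct 8))
    (ℝ.<-respˡ-≈ (ℝ.+-identityʳ q) (ℝ.+-monoʳ-< q (ℝ.×-pos 6 0<q)))

  0<^ : ∀ k {x} → ℝ.0# < x → ℝ.0# < x ℝ.^ k
  0<^ zero    l = ℝ.0<1
  0<^ (suc k) l = ℝ.*-pos l (0<^ k l)

  ×1-^ : ∀ n k → (n ℝ.× ℝ.1#) ℝ.^ k ℝ.≈ (n ℕ.^ k) ℝ.× ℝ.1#
  ×1-^ n zero    = ℝ.sym (ℝ.+-identityʳ ℝ.1#)
  ×1-^ n (suc k) = ℝ.trans (ℝ.*-congˡ (×1-^ n k)) (ℝ.sym (ℝ.×1-homo-* n (n ℕ.^ k)))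

  8^q^≈1 : ∀ n → (8 ℕ.^ n) ℝ.× (q ℝ.^ n) ℝ.≈ ℝ.1#
  8^q^≈1 n = ℝ.trans (ℝ.×≈×1* (8 ℕ.^ n) _) (ℝ.trans (ℝ.*-congʳ (ℝ.sym (×1-^ 8 n)))
    (ℝ.trans (ℝ.sym (ℝ^-distrib-* _ q n)) (ℝ.trans (ℝ.^-congˡ n (ℝ.1/-correct 8)) (1^ n))))
    where
    1^ : ∀ n → ℝ.1# ℝ.^ n ℝ.≈ ℝ.1#
    1^ zero    = ℝ.refl
    1^ (suc n) = ℝ.trans (ℝ.*-identityˡ _) (1^ n)

  1/! : ℕ → ℝ
  1/! k = (ℝ.1/ (k !)) {{k ℕ.!≢0}}

  φ : ℕ → ℂ
  φ k = 1/! k +i ℝ.0#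

  k!φ≈1 : ∀ k → (k !) × φ k ≈ Complex.1# R
  k!φ≈1 k = ℝ.trans (ℝ.reflexive (re-× (k !) (φ k))) (ℝ.trans (ℝ.×≈×1* (k !) _) (ℝ.1/-correct (k !) {{k ℕ.!≢0}})) ,
            ℝ.trans (ℝ.reflexive (im-× (k !) (φ k))) (ℝ.trans (ℝ.×≈×1* (k !) ℝ.0#) (ℝ.zeroʳ _))

  term : ℂ → ℕ → ℂ
  term = Series.term φ k!φ≈1

  Maj-^ : ∀ {z B B₁} → Maj (Complex.1# R) B₁ → Maj z B → ∀ k → Maj (z ^ k) (B₁ ℝ.* B ℝ.^ k)
  Maj-^ M₁ M zero    = Maj-respʳ (ℝ.sym (ℝ.*-identityʳ _)) M₁
  Maj-^ {B = B} {B₁} M₁ M (suc k) = Maj-respʳ (ℝ.solve 3 (λ b c x → b ℝ.:* (c ℝ.:* x) ℝ.:= c ℝ.:* (b ℝ.:* x)) ℝ.refl B B₁ _) (Maj-* M (Maj-^ M₁ M k))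

  -- If N bounds z, then N^k / k! = ((8N)^k / k!) q^k, and `power≤factorial` bounds the first factor
  -- by M. `B₁` bounds z^0 = 1, and `suc M` makes the inequality strict.
  term-bound : ∀ z → ∃ λ K → ∀ k → Maj (term z k) (K ℝ.* q ℝ.^ k)
  term-bound z = K , λ k → Maj-mono (bound k) (Maj-scale (ℝ.1/-pos (k !) {{k ℕ.!≢0}}) (Maj-^ (proj₂ (Maj-exists _)) (proj₂ (Maj-exists z)) k))
    where
    N = proj₁ (Maj-exists z)
    B₁ = proj₁ (Maj-exists (Complex.1# R)) ℝ.× ℝ.1#
    L = suc (8 ℕ.* N)
    M = L ℕ.^ L
    K = B₁ ℝ.* (suc M ℝ.× ℝ.1#)
    module _ (k : ℕ) where
      P = (8 ℕ.* N) ℕ.^ k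
      P< : P ℕ.< suc M ℕ.* k !
      P< = ℕ.≤-<-trans (ℕ.^-monoˡ-≤ k (ℕ.n≤1+n (8 ℕ.* N))) (ℕ.≤-<-trans (power≤factorial (8 ℕ.* N) k)
        (ℕ.*-monoˡ-< (k !) {{k ℕ.!≢0}} (ℕ.n<1+n M)))
      ×1-mono-< : ∀ {m n} → m ℕ.< n → m ℝ.× ℝ.1# < n ℝ.× ℝ.1#
      ×1-mono-< {m} m<n = ℝ.<-×-≤ ℝ.0<1 m<n (ℝ.<-respˡ-≈ (ℝ.+-identityˡ _) (ℝ.+-monoˡ-< (m ℝ.× ℝ.1#) ℝ.0<1))
      N^≈ : (N ℝ.× ℝ.1#) ℝ.^ k ℝ.≈ (P ℝ.× ℝ.1#) ℝ.* q ℝ.^ k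
      N^≈ = ℝ.trans (ℝ.^-congˡ k N≈) (ℝ.trans (ℝ^-distrib-* _ q k) (ℝ.*-congʳ (×1-^ (8 ℕ.* N) k)))
        where
        N≈ : N ℝ.× ℝ.1# ℝ.≈ ((8 ℕ.* N) ℝ.× ℝ.1#) ℝ.* q
        N≈ = ℝ.trans (ℝ.sym (ℝ.*-identityˡ _)) (ℝ.trans (ℝ.*-congʳ (ℝ.sym (ℝ.1/-correct 8)))
          (ℝ.trans (ℝ.solve 3 (λ e q n → e ℝ.:* q ℝ.:* n ℝ.:= e ℝ.:* n ℝ.:* q) ℝ.refl (8 ℝ.× ℝ.1#) q (N ℝ.× ℝ.1#)) (ℝ.*-congʳ (ℝ.sym (ℝ.×1-homo-* 8 N)))))
      0<B₁ : ℝ.0# < B₁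
      0<B₁ = Maj-pos (proj₂ (Maj-exists (Complex.1# R)))
      bound : 1/! k ℝ.* (B₁ ℝ.* (N ℝ.× ℝ.1#) ℝ.^ k) < K ℝ.* q ℝ.^ k
      bound = ℝ.<-resp-≈
        (ℝ.trans (ℝ.solve 4 (λ r b n Q → n ℝ.:* (r ℝ.:* b ℝ.:* Q) ℝ.:= r ℝ.:* (b ℝ.:* (n ℝ.:* Q))) ℝ.refl (1/! k) B₁ (P ℝ.× ℝ.1#) (q ℝ.^ k)) (ℝ.*-congˡ (ℝ.*-congˡ (ℝ.sym N^≈))))
        (ℝ.trans (ℝ.*-congʳ (ℝ.×1-homo-* (suc M) (k !)))
          (ℝ.trans (ℝ.solve 5 (λ m f r b Q → (m ℝ.:* f) ℝ.:* (r ℝ.:* b ℝ.:* Q) ℝ.:= (f ℝ.:* r) ℝ.:* (b ℝ.:* m ℝ.:* Q)) ℝ.refl (suc M ℝ.× ℝ.1#) ((k !) ℝ.× ℝ.1#) (1/! k) B₁ (q ℝ.^ k))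
            (ℝ.trans (ℝ.*-congʳ (ℝ.1/-correct (k !) {{k ℕ.!≢0}})) (ℝ.*-identityˡ _))))
        (ℝ.*-monoˡ-< (1/! k ℝ.* B₁ ℝ.* q ℝ.^ k) (ℝ.*-pos (ℝ.*-pos (ℝ.1/-pos (k !) {{k ℕ.!≢0}}) 0<B₁) (0<^ k 0<q)) (×1-mono-< P<))

  Maj-absorb : ∀ i {z B} → ℝ.0# < B → Maj z (B ℝ.* q ℝ.^ i) → Maj z B
  Maj-absorb zero    0<B M = Maj-respʳ (ℝ.*-identityʳ _) M
  Maj-absorb (suc i) {B = B} 0<B M = Maj-absorb i 0<B (Maj-mono (ℝ.*-monoʳ-< B 0<B
    (ℝ.<-respʳ-≈ (ℝ.*-identityˡ _) (ℝ.*-monoˡ-< (q ℝ.^ i) (0<^ i 0<q) q<1))) M)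

  Maj-× : ∀ {m n z x} → ℝ.0# < x → m ℕ.≤ n → Maj z (m ℝ.× x) → Maj z (n ℝ.× x)
  Maj-× 0<x m≤n (maj p q r s e f l) = maj p q r s e f (ℝ.<-×-≤ 0<x m≤n l)

  discrepancy : ℂ → ℂ → ℕ → ℂ
  discrepancy z w n = ∑ n (term z) * ∑ n (term w) - ∑ n (term (z + w))

  -- Each of the n products is at most K q^k times a tail of k terms, each bounded by K' q^(n - k).
  -- The powers of q combine to q^n, and the two counts are bounded by n + 1 each.
  discrepancy-bound : ∀ z w → ∃ λ X → ∀ n → Maj (discrepancy z w n) ((suc n ℕ.* suc n) ℝ.× (X ℝ.* q ℝ.^ n))
  discrepancy-bound z w = K ℝ.* K' , λ n → Maj-resp (sym (Series.partial-product φ k!φ≈1 z w n))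
      (Maj-respʳ (ℝ.×-assocˡ _ (suc n) (suc n)) (Maj-∑ n (ℝ.×-pos n (ℝ.*-pos (ℝ.*-pos 0<K 0<K') (0<^ n 0<q))) (product n)))
    where
    K = proj₁ (term-bound z)
    K' = proj₁ (term-bound w)
    0<coefficient : ∀ {z B} → Maj z (B ℝ.* q ℝ.^ 0) → ℝ.0# < B
    0<coefficient M = ℝ.<-respʳ-≈ (ℝ.*-identityʳ _) (Maj-pos M)
    0<K : ℝ.0# < K
    0<K = 0<coefficient (proj₂ (term-bound z) 0)
    0<K' : ℝ.0# < K'
    0<K' = 0<coefficient (proj₂ (term-bound w) 0)
    module _ (n k : ℕ) (k<n : k ℕ.< n) where
      j = n ℕ.∸ k
      j+k≡n : j ℕ.+ k ≡ n
      j+k≡n = ℕ.m∸n+n≡m (ℕ.<⇒≤ k<n)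
      tail≈ : ∑ k (λ i → term w (j ℕ.+ i)) ≈ ∑ n (term w) - ∑ j (term w)
      tail≈ = trans (solve 2 (λ x y → y := (x :+ y) :- x) refl (∑ j (term w)) _)
        (+-congʳ (trans (sym (∑-split j k (term w))) (reflexive (≡.cong (λ m → ∑ m (term w)) j+k≡n))))
      tail : Maj (∑ n (term w) - ∑ j (term w)) (suc n ℝ.× (K' ℝ.* q ℝ.^ j))
      tail = Maj-× (ℝ.*-pos 0<K' (0<^ j 0<q)) (s≤s (ℕ.<⇒≤ k<n)) (Maj-resp tail≈ (Maj-∑ k (ℝ.*-pos 0<K' (0<^ j 0<q)) (λ i _ →
        Maj-absorb i (ℝ.*-pos 0<K' (0<^ j 0<q)) (Maj-respʳ (ℝ.trans (ℝ.*-congˡ (ℝ.^-homo-* q j i)) (ℝ.sym (ℝ.*-assoc K' _ _))) (proj₂ (term-bound w) (j ℕ.+ i))))))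
      product : Maj (term z k * (∑ n (term w) - ∑ j (term w))) (suc n ℝ.× (K ℝ.* K' ℝ.* q ℝ.^ n))
      product = Maj-respʳ
        (ℝ.trans (ℝ.×-comm-* (suc n) _ _) (ℝ.×-congʳ (suc n) (ℝ.trans (ℝ.solve 4 (λ a x b y → (a ℝ.:* x) ℝ.:* (b ℝ.:* y) ℝ.:= a ℝ.:* b ℝ.:* (y ℝ.:* x)) ℝ.refl K (q ℝ.^ k) K' (q ℝ.^ j))
          (ℝ.*-congˡ (ℝ.trans (ℝ.sym (ℝ.^-homo-* q j k)) (ℝ.reflexive (≡.cong (q ℝ.^_) j+k≡n)))))))
        (Maj-* (proj₂ (term-bound z) k) tail)

  -- For large n the Archimedean axiom gives X < (n + 1) ε, so the bound is below (n + 1)³ q^n ε,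
  -- and hence below 8^n q^n ε = ε.
  discrepancy-null : ∀ z w → Null (discrepancy z w)
  discrepancy-null z w ε 0<ε = N , λ n N≤n → Maj-mono (bound n N≤n) (proj₂ (discrepancy-bound z w) n)
    where
    X = proj₁ (discrepancy-bound z w)
    N = proj₁ (ℝ.archimedean-unit X 0<ε)
    bound : ∀ n → N ℕ.≤ n → (suc n ℕ.* suc n) ℝ.× (X ℝ.* q ℝ.^ n) < ε
    bound n N≤n = ℝ.<-respʳ-≈ total (ℝ.<-×-≤ 0<εQ (cube≤8^ n) cubic)
      where
      Q = q ℝ.^ n
      0<εQ : ℝ.0# < ε ℝ.* Q
      0<εQ = ℝ.*-pos 0<ε (0<^ n 0<q)
      X< : X < suc n ℝ.× ε
      X< = ℝ.<-×-≤ 0<ε (ℕ.m≤n⇒m≤1+n N≤n) (proj₂ (ℝ.archimedean-unit X 0<ε))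
      cubic : (suc n ℕ.* suc n) ℝ.× (X ℝ.* Q) < (suc n ℕ.* suc n ℕ.* suc n) ℝ.× (ε ℝ.* Q)
      cubic = ℝ.<-respʳ-≈ (ℝ.trans (ℝ.×-congʳ (suc n ℕ.* suc n) (ℝ.×-assoc-* (suc n) ε Q)) (ℝ.×-assocˡ (ε ℝ.* Q) (suc n ℕ.* suc n) (suc n)))
        (ℝ.×-mono-< (n ℕ.+ n ℕ.* suc n) (ℝ.*-monoˡ-< Q (0<^ n 0<q) X<))
      total : (8 ℕ.^ n) ℝ.× (ε ℝ.* Q) ℝ.≈ ε
      total = ℝ.trans (ℝ.sym (ℝ.×-comm-* (8 ℕ.^ n) ε Q)) (ℝ.trans (ℝ.*-congˡ (8^q^≈1 n)) (ℝ.*-identityʳ ε))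

  infix 4 _⟹_
  -- `IsExp` restated with `Maj`, in which products of sequences can be estimated.
  _⟹_ : ℂ → ℂ → Set _
  z ⟹ w = Null (λ n → ∑ n (term z) - w)

  exp-+ : ∀ {z z' w w'} → z ⟹ w → z' ⟹ w' → z + z' ⟹ w * w'
  exp-+ {z} {z'} {w} {w'} E E' = Null-resp (λ n → solve 5 (λ s s' t w w' → ((s :- w) :* s' :+ (s' :- w') :* w) :+ :- (s :* s' :- t) := t :- w :* w')
      refl (∑ n (term z)) (∑ n (term z')) (∑ n (term (z + z'))) w w')
    (Null-+ (Null-+ (Null-* E (proj₁ (E' ℝ.1# ℝ.0<1) , λ n N≤n → Maj-resp (solve 2 (λ s w → (s :- w) :+ w := s) refl _ w') (Maj-+ (proj₂ (E' ℝ.1# ℝ.0<1) n N≤n) (proj₂ (Maj-exists w')))))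
                    (Null-* E' (0 , λ _ _ → proj₂ (Maj-exists w)))) (Null-neg (discrepancy-null z z')))

  exp-unique : ∀ {z w w'} → z ⟹ w → z ⟹ w' → w ≈ w'
  exp-unique {z} {w} {w'} E E' = trans (solve 2 (λ w w' → w := (w :- w') :+ w') refl w w')
    (trans (+-congʳ (Null-const (Null-resp (λ n → solve 3 (λ s w w' → (s :- w') :+ :- (s :- w) := w :- w') refl (∑ n (term z)) w w') (Null-+ E' (Null-neg E))))) (+-identityˡ w'))

  exp-cong : ∀ {z z' w w'} → z ≈ z' → w ≈ w' → z ⟹ w → z' ⟹ w'
  exp-cong e f = Null-resp (λ n → +-cong (∑-cong n (λ k _ → *-congˡ {x = φ k} (^-congˡ k e))) (-‿cong f))

  exp-0 : Complex.0# R ⟹ Complex.1# R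
  exp-0 ε 0<ε = 1 , λ { (suc n) _ → Maj-resp (sym (trans (+-congʳ (sum≈1 n)) (-‿inverseʳ (Complex.1# R)))) (Maj-0 0<ε) }
    where
    φ0≈1 : φ 0 ≈ Complex.1# R
    φ0≈1 = trans (sym (×-homo-1 (φ 0))) (k!φ≈1 0)
    sum≈1 : ∀ n → ∑ (suc n) (term (Complex.0# R)) ≈ Complex.1# R
    sum≈1 n = trans (∑-suc n (term (Complex.0# R))) (trans (+-cong (trans (*-identityʳ (φ 0)) φ0≈1)
      (∑-zero n (λ i _ → trans (*-congˡ {x = φ (suc i)} (zeroˡ (Complex.0# R ^ i))) (zeroʳ (φ (suc i)))))) (+-identityʳ _))

  exp-× : ∀ n {z w} → z ⟹ w → n × z ⟹ w ^ n
  exp-× zero    E = exp-0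
  exp-× (suc n) E = exp-+ E (exp-× n E)

  exp-conj : ∀ {z w} → z ⟹ w → conj z ⟹ conj w
  exp-conj {z} {w} E ε 0<ε = proj₁ (E ε 0<ε) , λ n N≤n → Maj-resp (conj-difference n) (Maj-conj (proj₂ (E ε 0<ε) n N≤n))
    where
    conj-neg : ∀ w → conj (- w) ≈ - conj w
    conj-neg w = ℝ.refl , ℝ.refl
    conj-∑ : ∀ n → conj (∑ n (term z)) ≈ ∑ n (term (conj z))
    conj-∑ zero    = conj-0
    conj-∑ (suc n) = trans (conj-+ (∑ n (term z)) (term z n)) (+-cong (conj-∑ n)
      (trans (conj-* (φ n) (z ^ n)) (*-cong {x = conj (φ n)} {φ n} (ℝ.refl , ℝ.-0#≈0#) (conj-^ z n))))
    conj-difference : ∀ n → conj (∑ n (term z) - w) ≈ ∑ n (term (conj z)) - conj w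
    conj-difference n = trans (conj-+ (∑ n (term z)) (- w)) (+-cong (conj-∑ n) (conj-neg w))

  IsExp⇒⟹ : ∀ {z w} → IsExp z w → z ⟹ w
  IsExp⇒⟹ {z} {w} (reE , imE) ε 0<ε with ℝ.quotient (ℝ.×-pos 5 ℝ.0<1) 0<ε
  ... | δ , 0<δ , e with reE δ 0<δ | imE δ 0<δ
  ... | N , hr | M , hi = N ℕ.+ M , λ n N+M≤n →
    let l , u = hr n (ℕ.≤-trans (ℕ.m≤m+n N M) N+M≤n)
        l' , u' = hi n (ℕ.≤-trans (ℕ.m≤n+m M N) N+M≤n)
    in Maj-respʳ (ℝ.trans (ℝ.trans (ℝ.×≈×1* 6 δ) (ℝ.*-comm _ δ)) e)
         (Maj-resp (+-congʳ (sum≈∑ n (expTerm z))) (bounded⇒Maj {expPartialSum z n - w} l u l' u' 0<δ))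

  ⟹⇒IsExp : ∀ {z w} → z ⟹ w → IsExp z w
  ⟹⇒IsExp {z} {w} E =
    (λ ε 0<ε → proj₁ (E ε 0<ε) , λ n N≤n → Maj⇒re-bounds (M ε 0<ε n N≤n)) ,
    (λ ε 0<ε → proj₁ (E ε 0<ε) , λ n N≤n → Maj⇒im-bounds (M ε 0<ε n N≤n))
    where
    M : ∀ ε 0<ε n → proj₁ (E ε 0<ε) ℕ.≤ n → Maj (expPartialSum z n - w) ε
    M ε 0<ε n N≤n = Maj-resp (+-congʳ (sym (sum≈∑ n (expTerm z)))) (proj₂ (E ε 0<ε) n N≤n)

  -- The conjugate of i x is - i x, so the product is the exponential of 0.
  imaginary-unimodular : ∀ {x w} → ℝ.0# +i x ⟹ w → w * conj w ≈ Complex.1# R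
  imaginary-unimodular {x} {w} E = exp-unique (exp-cong (ℝ.+-identityʳ ℝ.0# , ℝ.-‿inverseʳ x) refl (exp-+ E (exp-conj E))) exp-0

  module _ (p : ℕ) .{{p≢0 : NonZero p}} (p≥3 : 3 ℕ.≤ p) (ω : ℂ) (exp-ω : IsExp2πi/ p ω) where

    private
      π = proj₁ exp-ω
      0<π = proj₁ (proj₁ (proj₂ exp-ω))
      sin-π = proj₁ (proj₂ (proj₁ (proj₂ exp-ω)))
      least = proj₂ (proj₂ (proj₁ (proj₂ exp-ω)))
      θ = (2 ℝ.× π) ℝ.* (ℝ.1/ p)
      E : ℝ.0# +i θ ⟹ ω
      E = IsExp⇒⟹ (proj₂ (proj₂ exp-ω))

      pθ≈2π : (p ℝ.× ℝ.1#) ℝ.* θ ℝ.≈ 2 ℝ.× π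
      pθ≈2π = ℝ.trans (ℝ.solve 3 (λ p t r → p ℝ.:* (t ℝ.:* r) ℝ.:= t ℝ.:* (p ℝ.:* r)) ℝ.refl (p ℝ.× ℝ.1#) (2 ℝ.× π) (ℝ.1/ p))
        (ℝ.trans (ℝ.*-congˡ (ℝ.1/-correct p)) (ℝ.*-identityʳ _))

    ω-unimodular : ω * conj ω ≈ Complex.1# R
    ω-unimodular = imaginary-unimodular E

    -- ω^p is the square of e^(πi). Since sin π = 0, that number is real, and its square is its
    -- squared modulus 1.
    ω^p≈1 : ω ^ p ≈ Complex.1# R
    ω^p≈1 = exp-unique (exp-cong p×iθ≈ refl (exp-× p E))
      (exp-cong refl (trans (*-congˡ {x = w} (ℝ.refl , ℝ.sym ℝ.-0#≈0#)) (imaginary-unimodular Eπ)) (exp-+ Eπ Eπ))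
      where
      w = proj₁ sin-π +i ℝ.0#
      Eπ : ℝ.0# +i π ⟹ w
      Eπ = IsExp⇒⟹ (proj₂ sin-π)
      p×iθ≈ : p × (ℝ.0# +i θ) ≈ (ℝ.0# +i π) + (ℝ.0# +i π)
      p×iθ≈ = ℝ.trans (ℝ.reflexive (re-× p (ℝ.0# +i θ))) (ℝ.trans (ℝ.×≈×1* p ℝ.0#) (ℝ.trans (ℝ.zeroʳ _) (ℝ.sym (ℝ.+-identityʳ ℝ.0#)))) ,
        ℝ.trans (ℝ.reflexive (im-× p (ℝ.0# +i θ))) (ℝ.trans (ℝ.×≈×1* p θ) (ℝ.trans pθ≈2π (ℝ.+-congˡ (ℝ.+-identityʳ π))))

    -- Otherwise 2π/p would be a zero of the sine in the interval (0 , π).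
    ω≉1 : ¬ ω ≈ Complex.1# R
    ω≉1 ω≈1 = least θ 0<θ (re ω , ⟹⇒IsExp (exp-cong refl (ℝ.refl , proj₂ ω≈1) E)) θ<π
      where
      0<θ : ℝ.0# < θ
      0<θ = ℝ.*-pos (ℝ.×-pos 1 0<π) (ℝ.1/-pos p)
      2θ<2π : 2 ℝ.× θ < 2 ℝ.× π
      2θ<2π = ℝ.<-respʳ-≈ (ℝ.trans (ℝ.×≈×1* p θ) pθ≈2π) (ℝ.<-×-≤ 0<θ p≥3 (ℝ.<-respˡ-≈ (ℝ.+-identityˡ _) (ℝ.+-monoˡ-< (2 ℝ.× θ) 0<θ)))
      θ<π : θ < π
      θ<π = ℝ.<-resp-≈ (halve θ) (halve π) (ℝ.*-monoʳ-< (ℝ.1/ 2) (ℝ.1/-pos 2) 2θ<2π)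
        where
        halve : ∀ x → (ℝ.1/ 2) ℝ.* (2 ℝ.× x) ℝ.≈ x
        halve x = ℝ.trans (ℝ.*-congˡ (ℝ.×≈×1* 2 x)) (ℝ.trans (ℝ.sym (ℝ.*-assoc _ _ x)) (ℝ.trans (ℝ.*-congʳ (ℝ.trans (ℝ.*-comm _ _) (ℝ.1/-correct 2))) (ℝ.*-identityˡ x)))

-- The equivalence over ℂ for p = 2m + 1.

open import Defs
open import Data.Fin.Base using (Fin; toℕ)
open import Data.Nat.Base as ℕ using (ℕ; NonZero; _≥_; zero; suc; s≤s)
open import Data.Nat.Primality using (Prime; prime⇒irreducible)
open import Data.Product.Base using (_×_; ∃; _,_; proj₁)
open import Function.Bundles using (_⇔_; mk⇔)
open import Relation.Binary.PropositionalEquality.Core using (_≡_; _≢_; refl; sym; trans; cong; subst)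
open import Data.Nat.Divisibility using (divides)
open import Data.Nat.Properties using (*-comm; +-identityʳ; +-suc)
open import Data.Sum.Base using (_⊎_; inj₁; inj₂)
open import Relation.Nullary.Negation.Core using (contradiction)
import Algebra.Properties.CommutativeMonoid.Sum as CommutativeMonoidSum

odd-prime : ∀ {p} → Prime p → p ≥ 3 → ∃ λ m → p ≡ suc (suc m ℕ.+ suc m)
odd-prime {p} pr p≥3 = go (halve p)
  where
  halve : ∀ n → ∃ λ k → n ≡ k ℕ.+ k ⊎ n ≡ suc (k ℕ.+ k)
  halve zero = 0 , inj₁ refl
  halve (suc n) with halve n
  ... | k , inj₁ e = k , inj₂ (cong suc e)
  ... | k , inj₂ e = suc k , inj₁ (trans (cong suc e) (cong suc (sym (+-suc k k))))
  go : (∃ λ k → p ≡ k ℕ.+ k ⊎ p ≡ suc (k ℕ.+ k)) → ∃ λ m → p ≡ suc (suc m ℕ.+ suc m)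
  go (suc m , inj₂ e) = m , e
  go (zero , inj₂ e) = contradiction (subst (_≥ 3) e p≥3) λ { (s≤s ()) }
  go (k , inj₁ e) with prime⇒irreducible pr (divides k (trans e (trans (cong (k ℕ.+_) (sym (+-identityʳ k))) (*-comm 2 k))))
  ... | inj₂ refl = contradiction p≥3 λ { (s≤s (s≤s ())) }

-- Fixes the shape of p, so that ℤ/p and ℂ can be inserted into `OddPrime`; conjugates of powers
-- become powers of `conj ω`.
odd-case : ∀ {c ℓ₁ ℓ₂ ℓ₃} (R : RealNumbers c ℓ₁ ℓ₂ ℓ₃) (let open Complex R)
    (m : ℕ) (let p = suc (suc m ℕ.+ suc m)) (let open ZMod p) → Prime p → p ≥ 3 →
    (ω : ℂ) → IsExp2πi/ p ω →
    (M : Fin p → Fin p → Fin p) → Circulant M →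
    IsComplexHadamard (λ i j → ω ^ toℕ (M i j))
    ⇔ (∃ λ a → ∃ λ b → ∃ λ c → a ≢ 0ₙ × (∀ j → M 0ₙ j ≡ a ⊗ (j ⊗ j) ⊕ b ⊗ j ⊕ c))
odd-case R m pr p≥3 ω exp-ω M circulant = mk⇔
  (λ H → Forward.quadratic-coefficients M circulant (λ i k i≢k → ℂR.trans
    (Sum.sum-cong-≋ (λ j → ℂR.*-congˡ {x = ω ^ toℕ (M i j)} (ℂR.sym (conj-^ ω (toℕ (M k j))))))
    (IsComplexHadamard.orthogonal H i k i≢k)))
  (λ (a , b , c , a≢0 , quadratic) → record
    { unimodular = λ i j → (λ l → ℝ.<-irrefl ℝ.refl (ℝ.<-trans ℝ.0<1 l)) , ℝ.trans (ℝ.*-identityˡ ℝ.1#)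
        (proj₁ (ℂR.trans (ℂR.sym (ℂR.trans (ℂR.*-congˡ {x = ω ^ toℕ (M i j)} (conj-^ ω (toℕ (M i j)))) (ω^*ω̄^≈1 (toℕ (M i j)))))
          (*-conj (ω ^ toℕ (M i j)))))
    ; orthogonal = λ i k i≢k → ℂR.trans
        (Sum.sum-cong-≋ (λ j → ℂR.*-congˡ {x = ω ^ toℕ (M i j)} (conj-^ ω (toℕ (M k j)))))
        (Backward.orthogonal M circulant a b c a≢0 quadratic i k i≢k) })
  where
  p = suc (suc m ℕ.+ suc m)
  open Complex R using (ℂ; conj; _^_; module IsComplexHadamard)
  open ComplexRing R using (ℂ-commutativeRing; char0; cancel-≉0; conj-^; *-conj)
  module ℝ = Reals R
  module ℂR = RingKit ℂ-commutativeRing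
  module Sum = CommutativeMonoidSum ℂR.+-commutativeMonoid
  open ModRing p using (ℤ/p; char; faithful; residue; *-≈0; ≈0?)
  open Exponential R using (ω-unimodular; ω^p≈1; ω≉1)
  open CirculantHadamard ℂ-commutativeRing ℤ/p using (module OddPrime)
  open OddPrime m pr char faithful (*-≈0 pr) ≈0? residue char0 cancel-≉0
    ω (conj ω) (ω-unimodular p p≥3 ω exp-ω) (ω^p≈1 p p≥3 ω exp-ω) (ω≉1 p p≥3 ω exp-ω)
    using (ω^*ω̄^≈1; module Forward; module Backward)

theorem5p1 : ∀ {c ℓ₁ ℓ₂ ℓ₃} (R : RealNumbers c ℓ₁ ℓ₂ ℓ₃) (let open Complex R)
    (p : ℕ) .{{_ : NonZero p}} (let open ZMod p) → Prime p → p ≥ 3 →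
    (ω : ℂ) → IsExp2πi/ p ω →
    (M : Fin p → Fin p → Fin p) → Circulant M →
    IsComplexHadamard (λ i j → ω ^ toℕ (M i j))
    ⇔ (∃ λ a → ∃ λ b → ∃ λ c → a ≢ 0ₙ × (∀ j → M 0ₙ j ≡ a ⊗ (j ⊗ j) ⊕ b ⊗ j ⊕ c))
theorem5p1 R p pr p≥3 with odd-prime pr p≥3
... | m , refl = odd-case R m pr p≥3
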